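{- A connected 4-valent vertex-transitive graph admits a strong clique if and only if it is isomorphic to one of the graphs $K_{4,4}$, $K_5$, $K_3[2K_1]$, $L(K_{3,3})$, $H_n$ (for some $n$), $\mathrm{Cay}(\mathbb{Z}_{3k},\{\pm1,\pm k\})$ (for some $k$), or $C_3\square C_n$ (for some $n$). In particular, every 4-valent vertex-transitive graph admitting a strong clique is localizable.
   Context: All graphs are finite and simple. A clique is strong if it intersects every inclusion-maximal independent set; a graph is localizable if its vertex set can be partitioned into strong cliques. $\Gamma_1[\Gamma_2]$ is the lexicographic product: vertex set $V(\Gamma_1)\times V(\Gamma_2)$, $(u,x)\sim(v,y)$ iff $uv\in E(\Gamma_1)$, or $u=v$ and $xy\in E(\Gamma_2)$; $2K_1$ is the edgeless graph on 2 vertices. $L(K_{3,3})$ is the line graph of $K_{3,3}$. $\Gamma_1\square\Gamma_2$ is the Cartesian product: $(x_1,y_1)\sim(x_2,y_2)$ iff ($x_1=x_2$ and $y_1y_2\in E(\Gamma_2)$) or ($y_1=y_2$ and $x_1x_2\in E(\Gamma_1)$). For a group $G$ and inverse-closed $S\subseteq G\setminus\{1\}$, $\mathrm{Cay}(G,S)$ has vertex set $G$ with $x\sim y$ iff $x^{ -1}y\in S$. For $n\ge2$, $H_n$ is the graph on $\{x_i,y_i,z_i,w_i: 1\le i\le n\}$ in which for each $i$ the vertices $x_i,y_i,z_i,w_i$ are pairwise adjacent, and additionally $z_i\sim x_{i+1}$, $w_i\sim y_{i+1}$ for $i=1,\dots,n-1$, and $z_n\sim x_1$, $w_n\sim y_1$.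 A graph is vertex-transitive if its automorphism group acts transitively on its vertices. -}

module Defs where

open import Data.Nat as ℕ using (ℕ; zero; suc; _+_; _*_; _∸_; _%_; _≥_)
open import Data.Fin as F using (Fin; toℕ; remQuot)
open import Data.Fin.Subset using (Subset; _∈_; _∉_; _⊆_; ∣_∣)
open import Data.Fin.Permutation using (Permutation; Permutation′; _⟨$⟩ʳ_)
open import Data.Vec using (tabulate)
open import Data.Bool using (Bool; true; false; _∧_; _∨_; not)
open import Data.Product using (Σ; ∃; ∃-syntax; _×_; _,_; proj₁; proj₂)
open import Data.Sum using (_⊎_)
open import Relation.Nullary.Decidable using (⌊_⌋)
open import Relation.Binary.PropositionalEquality using (_≡_; _≢_)
open import Function.Bundles using (_⇔_)

record Graph : Set where
  constructor mkGraph
  field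
    n   : ℕ
    adj : Fin n → Fin n → Bool
open Graph public

IsSimple : Graph → Set
IsSimple G = (∀ u v → adj G u v ≡ adj G v u) × (∀ u → adj G u u ≡ false)

simplify : (m : ℕ) → (Fin m → Fin m → Bool) → Graph
simplify m R = mkGraph m (λ u v → not ⌊ u F.≟ v ⌋ ∧ (R u v ∨ R v u))

nbhd : (G : Graph) → Fin (n G) → Subset (n G)
nbhd G v = tabulate (adj G v)

degree : (G : Graph) → Fin (n G) → ℕ
degree G v = ∣ nbhd G v ∣

Regular : ℕ → Graph → Set
Regular d G = ∀ v → degree G v ≡ d

data Walk (G : Graph) : Fin (n G) → Fin (n G) → Set where
  here : ∀ {u} → Walk G u u
  step : ∀ {u v w} → adj G u v ≡ true → Walk G v w → Walk G u w

Connected : Graph → Set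
Connected G = Fin (n G) × (∀ u v → Walk G u v)

IsAutomorphism : (G : Graph) → Permutation′ (n G) → Set
IsAutomorphism G σ = ∀ u v → adj G (σ ⟨$⟩ʳ u) (σ ⟨$⟩ʳ v) ≡ adj G u v

VertexTransitive : Graph → Set
VertexTransitive G =
  ∀ u v → ∃[ σ ] (IsAutomorphism G σ × σ ⟨$⟩ʳ u ≡ v)

record _≅_ (G H : Graph) : Set where
  field
    iso   : Permutation (n G) (n H)
    preserves : ∀ u v → adj H (iso ⟨$⟩ʳ u) (iso ⟨$⟩ʳ v) ≡ adj G u v

IsClique : (G : Graph) → Subset (n G) → Set
IsClique G C = ∀ u v → u ∈ C → v ∈ C → u ≢ v → adj G u v ≡ true

IsIndependent : (G : Graph) → Subset (n G) → Set
IsIndependent G I = ∀ u v → u ∈ I → v ∈ I → adj G u v ≡ false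

IsMaximalIndependent : (G : Graph) → Subset (n G) → Set
IsMaximalIndependent G I =
  IsIndependent G I × (∀ J → IsIndependent G J → I ⊆ J → J ⊆ I)

IsStrongClique : (G : Graph) → Subset (n G) → Set
IsStrongClique G C =
  IsClique G C × (∀ I → IsMaximalIndependent G I → ∃[ v ] (v ∈ C × v ∈ I))

HasStrongClique : Graph → Set
HasStrongClique G = ∃[ C ] IsStrongClique G C

Localizable : Graph → Set
Localizable G =
  ∃[ m ] Σ (Fin m → Subset (n G)) λ C →
    (∀ i → IsStrongClique G (C i)) ×
    (∀ v → ∃[ i ] (v ∈ C i × (∀ j → v ∈ C j → j ≡ i)))

-- a mod m (with a mod 0 = a; only used for m ≥ 1)
_mod_ : ℕ → ℕ → ℕ
a mod zero = a
a mod (suc m) = a % suc m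

_==_ : ∀ {m} → Fin m → Fin m → Bool
u == v = ⌊ u F.≟ v ⌋

_=ℕ_ : ℕ → ℕ → Bool
a =ℕ b = ⌊ a ℕ.≟ b ⌋

K : ℕ → Graph
K m = simplify m (λ _ _ → true)

E : ℕ → Graph
E m = mkGraph m (λ _ _ → false)

K44 : Graph
K44 = simplify 8 (λ u v → ⌊ toℕ u ℕ.<? 4 ⌋ ∧ not ⌊ toℕ v ℕ.<? 4 ⌋)

lex : Graph → Graph → Graph
lex G H = mkGraph (n G * n H) λ a b →
  let (u , x) = remQuot {n G} (n H) a
      (v , y) = remQuot {n G} (n H) b
  in adj G u v ∨ (u == v ∧ adj H x y)

cart : Graph → Graph → Graph
cart G H = mkGraph (n G * n H) λ a b →
  let (x₁ , y₁) = remQuot {n G} (n H) a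
      (x₂ , y₂) = remQuot {n G} (n H) b
  in (x₁ == x₂ ∧ adj H y₁ y₂) ∨ (y₁ == y₂ ∧ adj G x₁ x₂)

-- cycle C_m (i ~ i+1 mod m), intended for m ≥ 3
C : ℕ → Graph
C m = simplify m (λ i j → toℕ j =ℕ (suc (toℕ i) mod m))

-- line graph of K_{3,3}: the edge {a_i, b_j} of K_{3,3} (i, j ∈ Fin 3)
-- is encoded as combine i j; two edges are adjacent iff they are
-- distinct and share an end-vertex
LK33 : Graph
LK33 = simplify 9 λ e f →
  let (i , j) = remQuot {3} 3 e
      (i′ , j′) = remQuot {3} 3 f
  in i == i′ ∨ j == j′

CayZ : (m : ℕ) → (ℕ → Bool) → Graph
CayZ m S = mkGraph m λ x y →
  not (x == y) ∧ S ((toℕ y + m ∸ toℕ x) mod m)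

CayZ3k : ℕ → Graph
CayZ3k k = CayZ (3 * k) λ d →
  (d =ℕ 1) ∨ (d =ℕ (3 * k ∸ 1)) ∨ (d =ℕ k) ∨ (d =ℕ (3 * k ∸ k))

-- H_m: vertex x_i, y_i, z_i, w_i (i ∈ Fin m, 0-based) encoded as
-- combine i t with t = 0,1,2,3 respectively
H : ℕ → Graph
H m = simplify (m * 4) λ a b →
  let (i , s) = remQuot {m} 4 a
      (j , t) = remQuot {m} 4 b
      next = toℕ j =ℕ (suc (toℕ i) mod m)
  in i == j
     ∨ (next ∧ toℕ s =ℕ 2 ∧ toℕ t =ℕ 0)
     ∨ (next ∧ toℕ s =ℕ 3 ∧ toℕ t =ℕ 1)

InFamily : Graph → Set
InFamily G =
    (G ≅ K44)
  ⊎ (G ≅ K 5)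
  ⊎ (G ≅ lex (K 3) (E 2))
  ⊎ (G ≅ LK33)
  ⊎ (∃[ m ] (m ≥ 2 × G ≅ H m))
  ⊎ (∃[ k ] (k ≥ 1 × G ≅ CayZ3k k))
  ⊎ (∃[ m ] (m ≥ 3 × G ≅ cart (C 3) (C m)))

{-# OPTIONS --safe #-}

-- A clique C of a graph is strong iff no independent set dominates it, which is a condition on the
-- neighbourhoods of the vertices of C. In a connected 4-valent graph a strong clique has two to
-- five vertices, and two or five vertices give K₄,₄ and K₅. For four vertices,
-- vertex-transitivity splits the graph into disjoint 4-cliques whose outer edges form a perfect
-- matching, and strength doubles these edges up, so that the cliques close up to some Hₘ. For a
-- strong triangle, either two of its vertices have a common neighbour outside it, and the graph
-- is the octahedron, or every neighbourhood is 2K₂, and the graph is L(K₃,₃), or each vertex lies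
-- in exactly one triangle. In the last case call an edge inside a triangle a mate edge and any
-- other edge a cross edge. If the ends of cross paths of length three are always mates, or never
-- are, then adjacent triangles are joined by perfect matchings, and a parity argument excludes
-- the mixed case. The triangles then form a cycle; by vertex-transitivity the monodromy around it
-- is the identity, giving C₃ □ Cₘ, or a rotation, giving the circulant on ℤ₃ₖ. The local case
-- distinctions are settled by a verified search over equalities and adjacencies of finitely many
-- named vertices. Being determined by local data, the strong cliques found in this way also
-- partition disconnected graphs.

module Submission where

open import Defs hiding (here; step)
open import Data.Bool using (Bool; true; false; _∧_; _∨_; not; if_then_else_; T)
open import Data.Bool.Properties using (T-≡; T-∧; T-∨; T?)
import Data.Bool as B
open import Data.Bool.ListAction using (all; any)
open import Data.Empty using (⊥; ⊥-elim)
open import Data.Fin as F using (Fin; zero; suc; toℕ; fromℕ<; combine; remQuot)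
open import Data.Fin.Patterns
import Data.Fin.Properties as F
open import Data.Fin.Permutation using (_⟨$⟩ʳ_; _⟨$⟩ˡ_; inverseˡ; inverseʳ; permutation)
open import Data.Fin.Subset using (Subset; _∈_; _∉_; _⊆_; ∣_∣)
open import Data.Fin.Subset.Properties using (_∈?_)
open import Data.List using (List; []; _∷_; _++_; map; length; mapMaybe; concatMap; filter; tabulate; allFin)
import Data.List as L
import Data.List.Properties as L
open import Data.List.Membership.Propositional using (find; lose) renaming (_∈_ to _∈ˡ_; _∉_ to _∉ˡ_)
open import Data.List.Membership.Propositional.Properties using (∈-map⁺; ∈-++⁻; ∈-++⁺ˡ; ∈-++⁺ʳ; ∈-filter⁺; ∈-filter⁻; ∈-allFin; ∈-∃++; ∈-lookup)
open import Data.List.Relation.Unary.All as All using (All; []; _∷_)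
import Data.List.Relation.Unary.All.Properties as All
open import Data.List.Relation.Unary.AllPairs as AllPairs using (AllPairs; []; _∷_)
import Data.List.Relation.Unary.AllPairs.Properties as AllPairs
open import Data.List.Relation.Unary.Any as Any using (Any; here; there)
import Data.List.Relation.Unary.Any.Properties as Any
open import Data.List.Relation.Unary.Unique.Propositional using (Unique)
import Data.List.Relation.Unary.Unique.Propositional.Properties as Unique
open import Data.List.Relation.Binary.Permutation.Propositional using (_↭_; ↭-refl; ↭-sym; ↭-trans; prep; swap; ↭⇒↭ₛ)
import Data.List.Relation.Binary.Permutation.Propositional.Properties as Perm
import Data.List.Relation.Binary.Permutation.Setoid.Properties as SetoidPerm
open import Data.Maybe using (Maybe; just; nothing)
open import Data.Nat as ℕ using (ℕ; zero; suc; _+_; _*_; _∸_; _%_; _≤_; _<_; _≥_; z≤n; s≤s; _<ᵇ_; _≡ᵇ_; NonZero)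
import Data.Nat.DivMod as ℕ
import Data.Nat.Properties as ℕ
open import Data.Product using (Σ; ∃; ∃-syntax; ∃₂; _×_; _,_; proj₁; proj₂)
open import Data.Sum using (_⊎_; inj₁; inj₂; [_,_]′)
import Data.Sum as Sum
open import Data.Unit using (⊤; tt)
open import Data.Vec using (Vec; []; _∷_)
import Data.Vec as V
import Data.Vec.Properties as V
open import Function using (_∘_; id; case_of_)
open import Function.Bundles using (_⇔_; mk⇔; Equivalence)
open import Relation.Binary using (DecidableEquality; Tri; tri<; tri≈; tri>)
open import Relation.Binary.PropositionalEquality using (_≡_; _≢_; refl; sym; trans; cong; cong₂; setoid; subst; subst₂)
open import Relation.Nullary using (¬_; Dec; yes; no; contradiction)
open import Relation.Nullary.Decidable using (⌊_⌋; True; toWitness; fromWitness; _×-dec_; _⊎-dec_; _→-dec_; ¬?; map′)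

-- Refutation of local configurations by search

-- The target of every case is an `Embedding`, an injection onto a union of connected components.
-- Connectedness turns it into an isomorphism; without connectedness, composing it with symmetries
-- still covers every vertex of the graph by copies of the model. `Strong` speaks of domination by
-- arbitrary independent predicates, so that it can be pulled back along such maps. The obstacle in
-- the infinite families is that a walk through the cliques returns to its start only up to a
-- permutation inside the first clique. For 4-cliques the walk enters through one pair of vertices
-- and leaves through the other, and since all four are adjacent the labels of the entry pair can be
-- chosen to absorb the permutation. For triangles the same labels are used on entering and leaving,
-- so the permutation is an invariant that separates the two families. The walks are studied up to a
-- relation given as a parameter, because the level of a clique and the exact vertex have different
-- periods. The parity argument: in the mixed case each vertex of a triangle would have exactly one
-- mate joined to it by a cross path of length three, a perfect matching on three points.

private
  variable
    A B : Set

mapMaybe-All : {P : A → Set} {Q : B → Set} {f : A → Maybe B} →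
  (∀ x {y} → P x → f x ≡ just y → Q y) → ∀ {xs} → All P xs → All Q (mapMaybe f xs)
mapMaybe-All h [] = []
mapMaybe-All {f = f} h (_∷_ {x = x} p ps) with f x in e
... | just _  = h x p e ∷ mapMaybe-All h ps
... | nothing = mapMaybe-All h ps

data Literal : Set where
  eq ne ad na : ℕ → ℕ → Literal

Clause : Set
Clause = List Literal

negate : Literal → Literal
negate (eq i j) = ne i j
negate (ne i j) = eq i j
negate (ad i j) = na i j
negate (na i j) = ad i j

data Verdict : Set where
  holds fails open′ : Verdict

samePair : ℕ → ℕ → ℕ → ℕ → Bool
samePair i j k l = (i ≡ᵇ k) ∧ (j ≡ᵇ l)

-- The verdict on the second literal when the first one is known to be true.
judge : Literal → Literal → Verdict
judge (eq _ _) _        = open′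
judge (ne i j) (eq k l) = if samePair i j k l then fails else open′
judge (ne i j) (ne k l) = if samePair i j k l then holds else open′
judge (ne i j) _        = open′
judge (ad i j) (eq k l) = if samePair i j k l then fails else open′
judge (ad i j) (ne k l) = if samePair i j k l then holds else open′
judge (ad i j) (ad k l) = if samePair i j k l then holds else open′
judge (ad i j) (na k l) = if samePair i j k l then fails else open′
judge (na i j) (ad k l) = if samePair i j k l then fails else open′
judge (na i j) (na k l) = if samePair i j k l then holds else open′
judge (na i j) _        = open′

judgeLoop : Literal → Verdict
judgeLoop (eq i j) = if i ≡ᵇ j then holds else open′
judgeLoop (ne i j) = if i ≡ᵇ j then fails else open′
judgeLoop (ad i j) = if i ≡ᵇ j then fails else open′
judgeLoop (na i j) = if i ≡ᵇ j then holds else open′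

reduce : (Literal → Verdict) → Clause → Maybe Clause
reduce f [] = just []
reduce f (l ∷ c) with f l
... | holds = nothing
... | fails = reduce f c
... | open′ with reduce f c
...   | nothing = nothing
...   | just c′ = just (l ∷ c′)

-- All four relations are symmetric; sorting the indices lets `samePair` recognise equal facts
-- syntactically.
ordered : (ℕ → ℕ → Literal) → ℕ → ℕ → Literal
ordered f i j = if j <ᵇ i then f j i else f i j

onIndices : (ℕ → ℕ) → Literal → Literal
onIndices f (eq i j) = ordered eq (f i) (f j)
onIndices f (ne i j) = ordered ne (f i) (f j)
onIndices f (ad i j) = ordered ad (f i) (f j)
onIndices f (na i j) = ordered na (f i) (f j)

replace : ℕ → ℕ → ℕ → ℕ
replace i j k = if j ≡ᵇ k then i else k

rename : (ℕ → ℕ) → Clause → Maybe Clause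
rename f c = reduce judgeLoop (map (onIndices f) c)

-- An equation is used up by substitution. Merging two names can make earlier literals clash, so the
-- trail re-enters as unit clauses and starts empty again.
assign : Literal → List Literal → List Clause → List Literal × List Clause
assign (eq i j) trail cs =
  [] , mapMaybe (rename (replace i j)) (map (_∷ []) trail ++ cs)
assign l trail cs = l ∷ trail , mapMaybe (reduce (judge l)) cs

-- Splitting on equalities first makes the search markedly shorter.
weight : Clause → ℕ
weight [] = 0
weight (eq _ _ ∷ c) = 1 + weight c
weight (ne _ _ ∷ c) = 3 + weight c
weight (_ ∷ c)      = 2 + weight c

-- An empty or unit clause is taken at once, since it closes the branch or is propagated without a
-- split.
lightest : Clause → ℕ → List Clause → Clause
lightest [] _ _ = []
lightest c@(_ ∷ []) _ _ = c
lightest c _ [] = c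
lightest c k (d ∷ ds) = let k′ = weight d in
  if (k′ <ᵇ k) ∨ (length d <ᵇ 2) then lightest d k′ ds else lightest c k ds

-- The number is fuel bounding the depth. Exhausted fuel answers `false`, and only the answer `true`
-- is ever interpreted.
unsat : ℕ → List Literal → List Clause → Bool
branch : ℕ → List Literal → List Clause → Clause → Bool

unsat zero trail cs = false
unsat (suc k) trail [] = false
unsat (suc k) trail (c ∷ cs) = branch k trail (c ∷ cs) (lightest c (weight c) cs)

branch k trail cs [] = true
branch k trail cs (l ∷ []) = let (t , d) = assign l trail cs in unsat k t d
branch k trail cs (l ∷ _ ∷ _) =
  (let (t , d) = assign l trail cs in unsat k t d) ∧
  (let (t , d) = assign (negate l) trail cs in unsat k t d)

module Refutation {V : Set} (_≟_ : DecidableEquality V) (R : V → V → Bool)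
  (R-sym : ∀ u v → R u v ≡ R v u) (R-irrefl : ∀ u → R u u ≡ false) where

  ⟦_⟧ˡ : Literal → (ℕ → V) → Set
  ⟦ eq i j ⟧ˡ ρ = ρ i ≡ ρ j
  ⟦ ne i j ⟧ˡ ρ = ρ i ≢ ρ j
  ⟦ ad i j ⟧ˡ ρ = R (ρ i) (ρ j) ≡ true
  ⟦ na i j ⟧ˡ ρ = R (ρ i) (ρ j) ≡ false

  module _ (ρ : ℕ → V) where
    Holds : Literal → Set
    Holds l = ⟦ l ⟧ˡ ρ

    Correct : Verdict → Literal → Set
    Correct holds l = ⊤
    Correct fails l = ¬ Holds l
    Correct open′ l = ⊤

    excluded-middle : ∀ l → Holds l ⊎ Holds (negate l)
    excluded-middle (eq i j) with ρ i ≟ ρ j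
    ... | yes p = inj₁ p
    ... | no p  = inj₂ p
    excluded-middle (ne i j) with ρ i ≟ ρ j
    ... | yes p = inj₂ p
    ... | no p  = inj₁ p
    excluded-middle (ad i j) with R (ρ i) (ρ j)
    ... | true  = inj₁ refl
    ... | false = inj₂ refl
    excluded-middle (na i j) with R (ρ i) (ρ j)
    ... | true  = inj₂ refl
    ... | false = inj₁ refl

    true≢false : ∀ {b : Bool} → b ≡ true → b ≡ false → ⊥
    true≢false refl ()

    adj⇒≢ : ∀ {u v} → R u v ≡ true → u ≢ v
    adj⇒≢ {u} p refl = true≢false p (R-irrefl u)

    samePair⇒≡ : ∀ i j k l → samePair i j k l ≡ true → i ≡ k × j ≡ l
    samePair⇒≡ i j k l p =
      let (q , r) = Equivalence.to T-∧ (Equivalence.from T-≡ p)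
      in ℕ.≡ᵇ⇒≡ i k q , ℕ.≡ᵇ⇒≡ j l r

    judge-correct : ∀ l m → Holds l → Correct (judge l m) m
    judge-correct (eq _ _) m p = tt
    judge-correct (ne i j) (eq k l) p with samePair i j k l in e
    ... | true with refl , refl ← samePair⇒≡ i j k l e = p
    ... | false = tt
    judge-correct (ne i j) (ne k l) p with samePair i j k l
    ... | true = tt
    ... | false = tt
    judge-correct (ne i j) (ad k l) p = tt
    judge-correct (ne i j) (na k l) p = tt
    judge-correct (ad i j) (eq k l) p with samePair i j k l in e
    ... | true with refl , refl ← samePair⇒≡ i j k l e = adj⇒≢ p
    ... | false = tt
    judge-correct (ad i j) (ne k l) p with samePair i j k l
    ... | true = tt
    ... | false = tt
    judge-correct (ad i j) (ad k l) p with samePair i j k l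
    ... | true = tt
    ... | false = tt
    judge-correct (ad i j) (na k l) p with samePair i j k l in e
    ... | true with refl , refl ← samePair⇒≡ i j k l e = true≢false p
    ... | false = tt
    judge-correct (na i j) (eq k l) p = tt
    judge-correct (na i j) (ne k l) p = tt
    judge-correct (na i j) (ad k l) p with samePair i j k l in e
    ... | true with refl , refl ← samePair⇒≡ i j k l e = λ q → true≢false q p
    ... | false = tt
    judge-correct (na i j) (na k l) p with samePair i j k l
    ... | true = tt
    ... | false = tt

    judgeLoop-correct : ∀ l → Correct (judgeLoop l) l
    judgeLoop-correct (eq i j) with i ≡ᵇ j
    ... | true = tt
    ... | false = tt
    judgeLoop-correct (ne i j) with i ≡ᵇ j in e
    ... | true with refl ← ℕ.≡ᵇ⇒≡ i j (Equivalence.from T-≡ e) = λ p → p refl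
    ... | false = tt
    judgeLoop-correct (ad i j) with i ≡ᵇ j in e
    ... | true with refl ← ℕ.≡ᵇ⇒≡ i j (Equivalence.from T-≡ e) = λ p → true≢false p (R-irrefl _)
    ... | false = tt
    judgeLoop-correct (na i j) with i ≡ᵇ j
    ... | true = tt
    ... | false = tt

    reduce-sound : ∀ f → (∀ l → Correct (f l) l) →
      ∀ c {c′} → Any Holds c → reduce f c ≡ just c′ → Any Holds c′
    reduce-sound f ok (l ∷ c) p e with f l | ok l
    reduce-sound f ok (l ∷ c) (here p)  e | fails | q = ⊥-elim (q p)
    reduce-sound f ok (l ∷ c) (there p) e | fails | q = reduce-sound f ok c p e
    ... | open′ | _ with reduce f c in r
    reduce-sound f ok (l ∷ c) (here p)  refl | open′ | _ | just _ = here p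
    reduce-sound f ok (l ∷ c) (there p) refl | open′ | _ | just _ =
      there (reduce-sound f ok c p r)

    ordered-sound : ∀ f → (∀ {i j} → Holds (f i j) → Holds (f j i)) →
      ∀ i j → Holds (f i j) → Holds (ordered f i j)
    ordered-sound f s i j p with j <ᵇ i
    ... | true  = s p
    ... | false = p

    onIndices-sound : ∀ f → (∀ i → ρ (f i) ≡ ρ i) → ∀ l → Holds l → Holds (onIndices f l)
    onIndices-sound f e (eq i j) p =
      ordered-sound eq sym (f i) (f j) (trans (e i) (trans p (sym (e j))))
    onIndices-sound f e (ne i j) p =
      ordered-sound ne (λ q → q ∘ sym) (f i) (f j) (λ q → p (trans (sym (e i)) (trans q (e j))))
    onIndices-sound f e (ad i j) p =
      ordered-sound ad (trans (R-sym _ _)) (f i) (f j) (trans (cong₂ R (e i) (e j)) p)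
    onIndices-sound f e (na i j) p =
      ordered-sound na (trans (R-sym _ _)) (f i) (f j) (trans (cong₂ R (e i) (e j)) p)

    rename-sound : ∀ f → (∀ i → ρ (f i) ≡ ρ i) →
      ∀ c {c′} → Any Holds c → rename f c ≡ just c′ → Any Holds c′
    rename-sound f e c p =
      reduce-sound judgeLoop judgeLoop-correct _ (Any.map⁺ (Any.map (onIndices-sound f e _) p))

    replace-sound : ∀ i j → ρ i ≡ ρ j → ∀ k → ρ (replace i j k) ≡ ρ k
    replace-sound i j p k with j ≡ᵇ k in e
    ... | true with refl ← ℕ.≡ᵇ⇒≡ j k (Equivalence.from T-≡ e) = p
    ... | false = refl

    assign-sound : ∀ l trail cs → Holds l → All Holds trail → All (Any Holds) cs →
      let (t , d) = assign l trail cs in All Holds t × All (Any Holds) d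
    assign-sound (eq i j) trail cs p ts qs =
      [] , mapMaybe-All (rename-sound _ (replace-sound i j p))
             (All.++⁺ (All.map⁺ (All.map here ts)) qs)
    assign-sound l@(ne _ _) trail cs p ts qs =
      p ∷ ts , mapMaybe-All (reduce-sound (judge l) (λ m → judge-correct l m p)) qs
    assign-sound l@(ad _ _) trail cs p ts qs =
      p ∷ ts , mapMaybe-All (reduce-sound (judge l) (λ m → judge-correct l m p)) qs
    assign-sound l@(na _ _) trail cs p ts qs =
      p ∷ ts , mapMaybe-All (reduce-sound (judge l) (λ m → judge-correct l m p)) qs

    lightest-All : ∀ {P : Clause → Set} c k cs → P c → All P cs → P (lightest c k cs)
    lightest-All [] k cs p ps = p
    lightest-All (_ ∷ []) k cs p ps = p
    lightest-All (_ ∷ _ ∷ _) k [] p ps = p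
    lightest-All c@(_ ∷ _ ∷ _) k (d ∷ ds) p (q ∷ ps) with (weight d <ᵇ k) ∨ (length d <ᵇ 2)
    ... | true  = lightest-All d _ ds q ps
    ... | false = lightest-All c k ds p ps

    unsat-sound : ∀ k trail cs → unsat k trail cs ≡ true →
      All Holds trail → All (Any Holds) cs → ⊥
    branch-sound : ∀ k trail cs c → branch k trail cs c ≡ true →
      All Holds trail → All (Any Holds) cs → Any Holds c → ⊥
    step-sound : ∀ k trail cs l → (let (t , d) = assign l trail cs in unsat k t d) ≡ true →
      All Holds trail → All (Any Holds) cs → Holds l → ⊥

    unsat-sound (suc k) trail (c ∷ cs) u ts ps@(q ∷ qs) =
      branch-sound k trail (c ∷ cs) (lightest c (weight c) cs) u ts ps (lightest-All c _ cs q qs)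

    branch-sound k trail cs (l ∷ []) u ts ps (here p) = step-sound k trail cs l u ts ps p
    branch-sound k trail cs (l ∷ _ ∷ _) u ts ps _
      with uᵗ , uᶠ ← Equivalence.to T-∧ (Equivalence.from T-≡ u) | excluded-middle l
    ... | inj₁ p = step-sound k trail cs l (Equivalence.to T-≡ uᵗ) ts ps p
    ... | inj₂ p = step-sound k trail cs (negate l) (Equivalence.to T-≡ uᶠ) ts ps p

    step-sound k trail cs l u ts ps p =
      let (ts′ , ps′) = assign-sound l trail cs p ts ps
      in unsat-sound k _ _ u ts′ ps′

  record Neighbours (v : V) (ws : List V) : Set where
    constructor neighbours
    field
      adjacent : All (λ w → R v w ≡ true) ws
      distinct : Unique ws
      complete : ∀ {x} → R v x ≡ true → x ∈ˡ ws
  open Neighbours public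

  Transversal : V → V → V → Set
  Transversal a b c = ∀ x y z → R a x ≡ true → R b y ≡ true → R c z ≡ true →
    R x y ≡ true ⊎ R y z ≡ true ⊎ R x z ≡ true

  -- The lists in `tra` leave its meaning unchanged and only select the instances given to the
  -- search. In `iso f xs`, index `f i` names the image of vertex `i` under an adjacency-preserving
  -- map.
  data Fact : Set where
    cl  : Clause → Fact
    nb  : ℕ → List ℕ → Fact
    tra : (a b c : ℕ) (as bs cs : List ℕ) → Fact
    iso : (ℕ → ℕ) → List ℕ → Fact

  -- A unit clause means its literal, without a trailing empty summand, so that hypotheses and
  -- conclusions can be passed directly; the goal `[]` asks for a contradiction.
  ⟦_⟧ᶜ : Clause → (ℕ → V) → Set
  ⟦ [] ⟧ᶜ ρ = ⊥
  ⟦ l ∷ [] ⟧ᶜ ρ = ⟦ l ⟧ˡ ρ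
  ⟦ l ∷ c@(_ ∷ _) ⟧ᶜ ρ = ⟦ l ⟧ˡ ρ ⊎ ⟦ c ⟧ᶜ ρ

  ⟦_⟧ᶠ : Fact → (ℕ → V) → Set
  ⟦ cl c ⟧ᶠ ρ = ⟦ c ⟧ᶜ ρ
  ⟦ nb i ws ⟧ᶠ ρ = Neighbours (ρ i) (map ρ ws)
  ⟦ tra a b c _ _ _ ⟧ᶠ ρ = Transversal (ρ a) (ρ b) (ρ c)
  ⟦ iso f xs ⟧ᶠ ρ = Σ (V → V) λ g → ((∀ u v → R (g u) (g v) ≡ R u v) × All (λ i → ρ (f i) ≡ g (ρ i)) xs)

  ⟦_⟧ᶠˢ : List Fact → (ℕ → V) → Set
  ⟦ [] ⟧ᶠˢ ρ = ⊤
  ⟦ f ∷ fs ⟧ᶠˢ ρ = ⟦ f ⟧ᶠ ρ × ⟦ fs ⟧ᶠˢ ρ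

  ⟦_⟧ᵍˢ : List Clause → (ℕ → V) → Set
  ⟦ [] ⟧ᵍˢ ρ = ⊤
  ⟦ c ∷ [] ⟧ᵍˢ ρ = ⟦ c ⟧ᶜ ρ
  ⟦ c ∷ cs@(_ ∷ _) ⟧ᵍˢ ρ = ⟦ c ⟧ᶜ ρ × ⟦ cs ⟧ᵍˢ ρ

  pairs : {X : Set} → List X → List (X × X)
  pairs [] = []
  pairs (x ∷ xs) = map (x ,_) xs ++ pairs xs

  -- The completeness of a neighbour list quantifies over all vertices; it is instantiated at the
  -- `k` named ones.
  clauses : ℕ → Fact → List Clause
  clauses k (cl c) = c ∷ []
  clauses k (nb i ws) =
    map (λ w → ad i w ∷ []) ws ++ map (λ (u , w) → ne u w ∷ []) (pairs ws)
    ++ map (λ x → na i x ∷ map (eq x) ws) (L.upTo k)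
  clauses k (tra a b c as bs cs) =
    concatMap (λ x → concatMap (λ y → map (λ z →
      na a x ∷ na b y ∷ na c z ∷ ad x y ∷ ad y z ∷ ad x z ∷ []) cs) bs) as
  clauses k (iso f xs) =
    concatMap (λ (i , j) → (na i j ∷ ad (f i) (f j) ∷ []) ∷ (ad i j ∷ na (f i) (f j) ∷ []) ∷ [])
      (pairs xs)

  module _ (ρ : ℕ → V) where
    pairs-All : ∀ {X Y : Set} {f : X → Y} {P : Y → Y → Set} {xs : List X} →
      AllPairs P (map f xs) → All (λ (u , w) → P (f u) (f w)) (pairs xs)
    pairs-All {xs = []} _ = []
    pairs-All {xs = x ∷ xs} (p ∷ ps) =
      All.++⁺ (All.map⁺ (All.map⁻ p)) (pairs-All ps)

    pairs-All₂ : ∀ {X : Set} {P : X → Set} {xs} → All P xs → All (λ (u , w) → P u × P w) (pairs xs)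
    pairs-All₂ [] = []
    pairs-All₂ (p ∷ ps) = All.++⁺ (All.map⁺ (All.map (p ,_) ps)) (pairs-All₂ ps)

    clause-Any : ∀ c → ⟦ c ⟧ᶜ ρ → Any (Holds ρ) c
    clause-Any (l ∷ []) p = here p
    clause-Any (l ∷ _ ∷ _) (inj₁ p) = here p
    clause-Any (l ∷ c@(_ ∷ _)) (inj₂ p) = there (clause-Any c p)

    concatMap-All : ∀ {X Y : Set} {P : Y → Set} {f : X → List Y} xs →
      All (All P ∘ f) xs → All P (concatMap f xs)
    concatMap-All xs ps = All.concat⁺ (All.map⁺ ps)

    clauses-sound : ∀ k f → ⟦ f ⟧ᶠ ρ → All (Any (Holds ρ)) (clauses k f)
    clauses-sound k (cl c) p = clause-Any c p ∷ []
    clauses-sound k (nb i ws) p =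
      All.++⁺ (All.map⁺ (All.map here (All.map⁻ (adjacent p))))
        (All.++⁺ (All.map⁺ (All.map here (pairs-All {P = _≢_} {xs = ws} (distinct p))))
          (All.map⁺ (All.universal completeness (L.upTo k))))
      where
      completeness : ∀ x → Any (Holds ρ) (na i x ∷ map (eq x) ws)
      completeness x with R (ρ i) (ρ x) in e
      ... | true  = there (Any.map⁺ (Any.map⁻ (complete p e)))
      ... | false = here e
    clauses-sound k (tra a b c as bs cs) p =
      concatMap-All as (All.universal (λ x → concatMap-All bs (All.universal (λ y →
        All.map⁺ (All.universal (λ z → clause-Any _ (lemma x y z)) cs)) bs)) as)
      where
      lemma : ∀ x y z → ⟦ na a x ∷ na b y ∷ na c z ∷ ad x y ∷ ad y z ∷ ad x z ∷ [] ⟧ᶜ ρ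
      lemma x y z with excluded-middle ρ (na a x) | excluded-middle ρ (na b y) | excluded-middle ρ (na c z)
      ... | inj₁ q | _ | _ = inj₁ q
      ... | _ | inj₁ q | _ = inj₂ (inj₁ q)
      ... | _ | _ | inj₁ q = inj₂ (inj₂ (inj₁ q))
      ... | inj₂ q | inj₂ r | inj₂ s = inj₂ (inj₂ (inj₂ (p _ _ _ q r s)))
    clauses-sound k (iso f xs) (g , g-adj , es) =
      concatMap-All (pairs xs) (All.map (λ { {i , j} → both i j }) (pairs-All₂ {P = λ i → ρ (f i) ≡ g (ρ i)} es))
      where
      both : ∀ i j → ρ (f i) ≡ g (ρ i) × ρ (f j) ≡ g (ρ j) →
        All (Any (Holds ρ)) ((na i j ∷ ad (f i) (f j) ∷ []) ∷ (ad i j ∷ na (f i) (f j) ∷ []) ∷ [])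
      both i j (ei , ej) with e′ ← trans (cong₂ R ei ej) (g-adj (ρ i) (ρ j)) | R (ρ i) (ρ j) in e
      ... | true  = there (here e′) ∷ here e ∷ []
      ... | false = here e ∷ there (here e′) ∷ []

    allClauses : ℕ → List Fact → List Clause
    allClauses k = mapMaybe (rename id) ∘ concatMap (clauses k)

    allClauses-sound : ∀ k fs → ⟦ fs ⟧ᶠˢ ρ → All (Any (Holds ρ)) (allClauses k fs)
    allClauses-sound k fs ps =
      mapMaybe-All (rename-sound ρ id (λ _ → refl)) (concatMap-All fs (each fs ps))
      where
      each : ∀ fs → ⟦ fs ⟧ᶠˢ ρ → All (All (Any (Holds ρ)) ∘ clauses k) fs
      each [] _ = []
      each (f ∷ fs) (p , ps) = clauses-sound k f p ∷ each fs ps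

  refutes : ℕ → List Clause → Clause → Bool
  refutes k cs goal =
    unsat 1000 [] (mapMaybe (rename id) (map (λ l → negate l ∷ []) goal) ++ cs)

  follows : ℕ → List Fact → List Clause → Bool
  follows k fs goals =
    let cs = mapMaybe (rename id) (concatMap (clauses k) fs)
    in all (refutes k cs) goals

  -- Indices beyond the end stand for the last vertex.
  look : ∀ {k} → Vec V (suc k) → ℕ → V
  look (x ∷ _) zero = x
  look (x ∷ []) (suc _) = x
  look (_ ∷ xs@(_ ∷ _)) (suc i) = look xs i

  module _ (ρ : ℕ → V) where
    refutes-sound : ∀ k cs goal → refutes k cs goal ≡ true → All (Any (Holds ρ)) cs → ⟦ goal ⟧ᶜ ρ
    refutes-sound k cs goal r ps = [ id , (λ q → ⊥-elim (refuted q)) ]′ (split goal)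
      where
      split : ∀ c → ⟦ c ⟧ᶜ ρ ⊎ All (Holds ρ ∘ negate) c
      split [] = inj₂ []
      split (l ∷ c) with excluded-middle ρ l | split c
      split (l ∷ []) | inj₁ p | _ = inj₁ p
      split (l ∷ _ ∷ _) | inj₁ p | _ = inj₁ (inj₁ p)
      split (l ∷ []) | inj₂ p | _ = inj₂ (p ∷ [])
      split (l ∷ _ ∷ _) | inj₂ p | inj₁ q = inj₁ (inj₂ q)
      split (l ∷ _ ∷ _) | inj₂ p | inj₂ q = inj₂ (p ∷ q)
      refuted : All (Holds ρ ∘ negate) goal → ⊥
      refuted q = unsat-sound ρ 1000 [] _ r []
        (All.++⁺ (mapMaybe-All (rename-sound ρ id (λ _ → refl)) (All.map⁺ (All.map here q))) ps)

    follows-sound : ∀ k fs goals → follows k fs goals ≡ true → ⟦ fs ⟧ᶠˢ ρ →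
      All (λ g → ⟦ g ⟧ᶜ ρ) goals
    follows-sound k fs goals r ps = go goals r
      where
      go : ∀ gs → all (refutes k (allClauses ρ k fs)) gs ≡ true → All (λ g → ⟦ g ⟧ᶜ ρ) gs
      go [] _ = []
      go (g ∷ gs) e =
        let (p , q) = Equivalence.to T-∧ (Equivalence.from T-≡ e)
        in refutes-sound k _ g (Equivalence.to T-≡ p) (allClauses-sound ρ k fs ps)
           ∷ go gs (Equivalence.to T-≡ q)

    tuple : ∀ {gs} → All (λ g → ⟦ g ⟧ᶜ ρ) gs → ⟦ gs ⟧ᵍˢ ρ
    tuple [] = tt
    tuple (p ∷ []) = p
    tuple (p ∷ ps@(_ ∷ _)) = p , tuple ps

  -- The search sees only indices, never the graph, so `follows` evaluates on closed data and its
  -- equation with `true` is supplied as `refl`.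
  by-search : ∀ {k} (ρ : Vec V (suc k)) fs goals → ⟦ fs ⟧ᶠˢ (look ρ) →
    follows (suc k) fs goals ≡ true → ⟦ goals ⟧ᵍˢ (look ρ)
  by-search {k} ρ fs goals ps r = tuple (look ρ) (follows-sound (look ρ) (suc k) fs goals r ps)

-- Decidable subsets, duplicate-free lists and neighbour lists

module _ {m : ℕ} {P : Fin m → Set} (P? : ∀ v → Dec (P v)) where
  ⟪_⟫ : Subset m
  ⟪_⟫ = V.tabulate (λ v → ⌊ P? v ⌋)

  ∈⟪⟫⁺ : ∀ {v} → P v → v ∈ ⟪_⟫
  ∈⟪⟫⁺ {v} p = V.lookup⇒[]= v _
    (trans (V.lookup∘tabulate _ v) (Equivalence.to T-≡ (fromWitness {a? = P? v} p)))

  ∈⟪⟫⁻ : ∀ {v} → v ∈ ⟪_⟫ → P v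
  ∈⟪⟫⁻ {v} p = toWitness {a? = P? v}
    (Equivalence.from T-≡ (trans (sym (V.lookup∘tabulate _ v)) (V.[]=⇒lookup p)))

-- Serves to put the known neighbours of a vertex in front; the length of the whole list then tells
-- how many are still to be named.
unique-extends : {X : Set} {xs ys : List X} → Unique xs → (∀ {x} → x ∈ˡ xs → x ∈ˡ ys) →
  ∃[ zs ] xs ++ zs ↭ ys
unique-extends {xs = []} {ys} _ _ = ys , ↭-refl
unique-extends {xs = x ∷ xs} (x∉ ∷ u) sub with ∈-∃++ (sub (here refl))
... | as , bs , refl =
  let (zs , p) = unique-extends u sub′
  in zs , ↭-trans (prep x p) (↭-sym (Perm.shift x as bs))
  where
  sub′ : ∀ {y} → y ∈ˡ xs → y ∈ˡ as ++ bs
  sub′ y∈ with ∈-++⁻ as (sub (there y∈))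
  ... | inj₁ q         = ∈-++⁺ˡ q
  ... | inj₂ (here e)  = contradiction (sym e) (All.lookup x∉ y∈)
  ... | inj₂ (there q) = ∈-++⁺ʳ as q

lookup-injective : {X : Set} {xs : List X} → Unique xs → ∀ i j → L.lookup xs i ≡ L.lookup xs j → i ≡ j
lookup-injective (x∉ ∷ u) zero    zero    e = refl
lookup-injective (x∉ ∷ u) zero    (suc j) e = contradiction e (All.lookup x∉ (∈-lookup j))
lookup-injective (x∉ ∷ u) (suc i) zero    e = contradiction (sym e) (All.lookup x∉ (∈-lookup i))
lookup-injective (x∉ ∷ u) (suc i) (suc j) e = cong suc (lookup-injective u i j e)

∣tabulate∣ : ∀ {m} (f : Fin m → Bool) → ∣ V.tabulate f ∣ ≡ length (filter (T? ∘ f) (allFin m))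
∣tabulate∣ f = go f id
  where
  -- The tail of the enumeration runs through `g ∘ suc`, so the induction is over an arbitrary
  -- reindexing `g`.
  go : ∀ {k m} (f : Fin m → Bool) (g : Fin k → Fin m) →
    ∣ V.tabulate (f ∘ g) ∣ ≡ length (filter (T? ∘ f) (tabulate g))
  go {zero} f g = refl
  go {suc k} f g with f (g zero)
  ... | true  = cong suc (go f (g ∘ suc))
  ... | false = go f (g ∘ suc)

module Neighbourhoods (G : Graph) (simple : IsSimple G) where
  V : Set
  V = Fin (n G)

  infix 4 _~_ _≁_
  _~_ _≁_ : V → V → Set
  u ~ v = adj G u v ≡ true
  u ≁ v = adj G u v ≡ false

  open Refutation F._≟_ (adj G) (proj₁ simple) (proj₂ simple) public

  ~-sym : ∀ {u v} → u ~ v → v ~ u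
  ~-sym {u} {v} p = trans (proj₁ simple v u) p

  ~⇒≢ : ∀ {u v} → u ~ v → u ≢ v
  ~⇒≢ {u} p refl = case trans (sym p) (proj₂ simple u) of λ ()

  ≁⇒¬~ : ∀ {u v} → u ≁ v → ¬ (u ~ v)
  ≁⇒¬~ p q = case trans (sym p) q of λ ()

  ¬~⇒≁ : ∀ {u v} → ¬ (u ~ v) → u ≁ v
  ¬~⇒≁ {u} {v} p with adj G u v
  ... | true  = contradiction refl p
  ... | false = refl

  _~?_ : ∀ u v → Dec (u ~ v)
  u ~? v with adj G u v
  ... | true  = yes refl
  ... | false = no λ ()

  reorder : ∀ {v ws ws′} → ws ↭ ws′ → Neighbours v ws → Neighbours v ws′
  reorder p N = neighbours (Perm.All-resp-↭ p (adjacent N))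
    (SetoidPerm.Unique-resp-↭ (setoid V) (↭⇒↭ₛ p) (distinct N)) (Perm.∈-resp-↭ p ∘ complete N)

  module Degree4 (regular : Regular 4 G) where
    list : V → List V
    list v = filter (T? ∘ adj G v) (allFin (n G))

    list⁺ : ∀ {v w} → v ~ w → w ∈ˡ list v
    list⁺ {v} {w} p = ∈-filter⁺ (T? ∘ adj G v) (∈-allFin w) (Equivalence.from T-≡ p)

    list⁻ : ∀ {v w} → w ∈ˡ list v → v ~ w
    list⁻ {v} p = Equivalence.to T-≡ (proj₂ (∈-filter⁻ (T? ∘ adj G v) {xs = allFin (n G)} p))

    length-list : ∀ v → length (list v) ≡ 4
    length-list v = trans (sym (∣tabulate∣ (adj G v))) (regular v)

    extend : ∀ {v} {xs} → Unique xs → All (v ~_) xs →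
      ∃[ zs ] Neighbours v (xs ++ zs) × length (xs ++ zs) ≡ 4
    extend {v} {xs} u a =
      let (zs , p) = unique-extends {ys = list v} u (list⁺ ∘ All.lookup a)
      in zs
         , reorder (↭-sym p) (neighbours (All.tabulate list⁻) unique-list list⁺)
         , trans (Perm.↭-length p) (length-list v)
      where
      unique-list : Unique (list v)
      unique-list = Unique.filter⁺ (T? ∘ adj G v) (Unique.allFin⁺ (n G))

    neighbours₀ : ∀ v → ∃[ a ] ∃[ b ] ∃[ c ] ∃[ d ] Neighbours v (a ∷ b ∷ c ∷ d ∷ [])
    neighbours₀ v with extend {v} [] []
    ... | a ∷ b ∷ c ∷ d ∷ [] , N , _ = a , b , c , d , N

    neighbours₁ : ∀ {v a} → v ~ a → ∃[ b ] ∃[ c ] ∃[ d ] Neighbours v (a ∷ b ∷ c ∷ d ∷ [])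
    neighbours₁ p with extend ([] ∷ []) (p ∷ [])
    ... | b ∷ c ∷ d ∷ [] , N , _ = b , c , d , N

    neighbours₂ : ∀ {v a b} → v ~ a → v ~ b → a ≢ b →
      ∃[ c ] ∃[ d ] Neighbours v (a ∷ b ∷ c ∷ d ∷ [])
    neighbours₂ p q r with extend ((r ∷ []) ∷ [] ∷ []) (p ∷ q ∷ [])
    ... | c ∷ d ∷ [] , N , _ = c , d , N

    neighbours₃ : ∀ {v a b c} → v ~ a → v ~ b → v ~ c → a ≢ b → a ≢ c → b ≢ c →
      ∃[ d ] Neighbours v (a ∷ b ∷ c ∷ d ∷ [])
    neighbours₃ p q r s t u with extend ((s ∷ t ∷ []) ∷ (u ∷ []) ∷ [] ∷ []) (p ∷ q ∷ r ∷ [])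
    ... | d ∷ [] , N , _ = d , N

    neighbours₄ : ∀ {v a b c d} → All (v ~_) (a ∷ b ∷ c ∷ d ∷ []) → Unique (a ∷ b ∷ c ∷ d ∷ []) →
      Neighbours v (a ∷ b ∷ c ∷ d ∷ [])
    neighbours₄ p u with extend u p
    ... | [] , N , _ = N

    no-five : ∀ {v a b c d e xs} → Unique (a ∷ b ∷ c ∷ d ∷ e ∷ xs) → ¬ All (v ~_) (a ∷ b ∷ c ∷ d ∷ e ∷ xs)
    no-five u p with extend u p
    ... | _ , _ , ()

-- Strong cliques and embedded components

-- Maximality of an independent set only enters through the fact that it dominates the
-- vertices outside it.
Unavoidable : (G : Graph) → Subset (n G) → Set₁
Unavoidable G C = (I : Fin (n G) → Set) →
  (∀ {u v} → I u → I v → adj G u v ≢ true) →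
  ¬ (∀ c → c ∈ C → ∃[ s ] I s × adj G c s ≡ true)

Strong : (G : Graph) → Subset (n G) → Set₁
Strong G C = IsClique G C × Unavoidable G C

-- A graph H embedded as a union of connected components.
record Embedding (H G : Graph) : Set where
  field
    f         : Fin (n H) → Fin (n G)
    injective : ∀ {u v} → f u ≡ f v → u ≡ v
    preserves : ∀ {u v} → adj H u v ≡ true → adj G (f u) (f v) ≡ true
    lifts     : ∀ {u w} → adj G (f u) w ≡ true → ∃[ v ] f v ≡ w × adj H u v ≡ true

module _ {H G : Graph} (e : Embedding H G) where
  open Embedding e

  inImage? : (P : Subset (n H)) → ∀ w → Dec (∃[ u ] u ∈ P × f u ≡ w)
  inImage? P w = F.any? λ u → (u ∈? P) ×-dec (f u F.≟ w)

  image : Subset (n H) → Subset (n G)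
  image P = ⟪ inImage? P ⟫

  image⁺ : ∀ {P u} → u ∈ P → f u ∈ image P
  image⁺ {P} p = ∈⟪⟫⁺ (inImage? P) (_ , p , refl)

  image⁻ : ∀ {P w} → w ∈ image P → ∃[ u ] u ∈ P × f u ≡ w
  image⁻ {P} = ∈⟪⟫⁻ (inImage? P)

  -- A dominating independent predicate on `G` pulls back along `f`: by `lifts`, whatever dominates
  -- an image vertex is itself in the image.
  Strong-image : ∀ {P} → Strong H P → Strong G (image P)
  Strong-image {P} (clique , unavoidable) = clique′ , λ I independent dominates →
    unavoidable (I ∘ f) (λ p q r → independent p q (preserves r))
      (λ c c∈ → let (s , s∈ , c~s) = dominates (f c) (image⁺ c∈)
                    (v , v↦s , c~v) = lifts c~s
                in v , subst I (sym v↦s) s∈ , c~v)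
    where
    clique′ : IsClique G (image P)
    clique′ u v p q u≢v with image⁻ p | image⁻ q
    ... | a , a∈ , refl | b , b∈ , refl = preserves (clique a b a∈ b∈ (u≢v ∘ cong f))

  -- By `lifts` the image is closed under adjacency, so every walk that starts in it stays in it,
  -- and connectedness makes `f` surjective.
  isomorphism : Connected G → Fin (n H) → G ≅ H
  isomorphism (_ , connected) u₀ = record
    { iso = permutation back f (λ u → injective (proj₂ (surjective (f u)))) (proj₂ ∘ surjective)
    ; preserves = λ u v → trans (same (back u) (back v))
        (cong₂ (adj G) (proj₂ (surjective u)) (proj₂ (surjective v))) }
    where
    along : ∀ {x y} → Walk G x y → ∃[ u ] f u ≡ x → ∃[ u ] f u ≡ y
    along Walk.here p = p
    along (Walk.step x~z w) (u , refl) = let (v , p , _) = lifts x~z in along w (v , p)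
    surjective : ∀ w → ∃[ u ] f u ≡ w
    surjective w = along (connected (f u₀) w) (u₀ , refl)
    back : Fin (n G) → Fin (n H)
    back = proj₁ ∘ surjective
    same : ∀ u v → adj H u v ≡ adj G (f u) (f v)
    same u v with adj H u v in e | adj G (f u) (f v) in e′
    ... | true  | true  = refl
    ... | false | false = refl
    ... | true  | false = trans (sym (preserves e)) e′
    ... | false | true with lifts e′
    ...   | v′ , p , q with refl ← injective p = trans (sym e) q

≅⇒Embedding : ∀ {G H} → G ≅ H → Embedding H G
≅⇒Embedding {G} {H} φ = record
  { f = iso ⟨$⟩ˡ_
  ; injective = λ p → trans (sym (inverseʳ iso)) (trans (cong (iso ⟨$⟩ʳ_) p) (inverseʳ iso))
  ; preserves = λ {u} {v} p → trans (sym (back u v)) p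
  ; lifts = λ {u} {w} p → iso ⟨$⟩ʳ w , inverseˡ iso
      , trans (back u _) (trans (cong (adj G _) (inverseˡ iso)) p) }
  where
  open _≅_ φ
  back : ∀ u v → adj H u v ≡ adj G (iso ⟨$⟩ˡ u) (iso ⟨$⟩ˡ v)
  back u v = trans (sym (cong₂ (adj H) (inverseʳ iso) (inverseʳ iso))) (preserves _ _)

Embedding-∘ : ∀ {A B C} → Embedding B C → Embedding A B → Embedding A C
Embedding-∘ d e = record
  { f = d.f ∘ e.f
  ; injective = e.injective ∘ d.injective
  ; preserves = d.preserves ∘ e.preserves
  ; lifts = λ p → let (v , v↦ , q) = d.lifts p ; (u , u↦ , r) = e.lifts q
                  in u , trans (cong d.f u↦) v↦ , r }
  where
  module d = Embedding d
  module e = Embedding e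

module StrongCliques (G : Graph) (simple : IsSimple G) where
  open Neighbourhoods G simple

  -- A maximal independent `I` that misses `C` dominates `C`: an undominated `c` could be added to
  -- `I`.
  Strong⇒IsStrongClique : ∀ {C} → Strong G C → IsStrongClique G C
  Strong⇒IsStrongClique {C} (clique , unavoidable) = clique , meets
    where
    meets : ∀ I → IsMaximalIndependent G I → ∃[ v ] v ∈ C × v ∈ I
    meets I (independent , maximal) with F.any? (λ v → (v ∈? C) ×-dec (v ∈? I))
    ... | yes p = p
    ... | no missed = contradiction dominates
            (unavoidable (_∈ I) (λ p q → ≁⇒¬~ (independent _ _ p q)))
      where
      dominates : ∀ c → c ∈ C → ∃[ s ] s ∈ I × c ~ s
      dominates c c∈ with F.any? (λ s → (s ∈? I) ×-dec (c ~? s))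
      ... | yes p = p
      ... | no undominated = contradiction (c , c∈ , maximal J J-independent I⊆J (∈⟪⟫⁺ J? (inj₂ refl))) missed
        where
        J? : ∀ v → Dec (v ∈ I ⊎ v ≡ c)
        J? v = (v ∈? I) ⊎-dec (v F.≟ c)
        J = ⟪ J? ⟫
        I⊆J : I ⊆ J
        I⊆J = ∈⟪⟫⁺ J? ∘ inj₁
        J-independent : IsIndependent G J
        J-independent u v p q with ∈⟪⟫⁻ J? p | ∈⟪⟫⁻ J? q
        ... | inj₁ p′   | inj₁ q′   = independent u v p′ q′
        ... | inj₁ p′   | inj₂ refl = ¬~⇒≁ λ e → undominated (u , p′ , ~-sym e)
        ... | inj₂ refl | inj₁ q′   = ¬~⇒≁ λ e → undominated (v , q′ , e)
        ... | inj₂ refl | inj₂ refl = proj₂ simple u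

  IndependentList : List V → Set
  IndependentList S = ∀ {u v} → u ∈ˡ S → v ∈ˡ S → u ≁ v

  grow : ∀ vs {S} → IndependentList S → ∃[ M ] IndependentList M × (∀ {v} → v ∈ˡ S → v ∈ˡ M) ×
    (∀ {v} → v ∈ˡ vs → v ∈ˡ M ⊎ Any (_~ v) M)
  grow [] {S} ind = S , ind , id , λ ()
  grow (v ∷ vs) {S} ind with grow vs ind
  ... | M , indM , S⊆M , covers with Any.any? (_~? v) M
  ...   | yes p = M , indM , S⊆M , λ { (here refl) → inj₂ p ; (there q) → covers q }
  ...   | no ¬p = v ∷ M , ind′ , there ∘ S⊆M
                  , λ { (here refl) → inj₁ (here refl) ; (there q) → Sum.map there there (covers q) }
    where
    away : ∀ {u} → u ∈ˡ M → u ≁ v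
    away u∈ = ¬~⇒≁ λ e → ¬p (Any.map (λ { refl → e }) u∈)
    ind′ : IndependentList (v ∷ M)
    ind′ (here refl) (here refl) = proj₂ simple v
    ind′ (here refl) (there q)   = trans (proj₁ simple _ _) (away q)
    ind′ (there p)   (here refl) = away p
    ind′ (there p)   (there q)   = indM p q

  -- Grow `S` greedily to a maximal independent `M`. A common vertex of `C` and `M` has a neighbour
  -- in `S`, hence in `M`.
  not-dominated : ∀ {C} → IsStrongClique G C → ∀ S → IndependentList S →
    ¬ (∀ c → c ∈ C → Any (c ~_) S)
  not-dominated {C} (clique , meets) S ind dominates with grow (allFin (n G)) ind
  ... | M , indM , S⊆M , covers =
    let (v , v∈C , v∈M) = meets ⟪ inM? ⟫ (M-independent , M-maximal)
        (s , s∈S , v~s) = find (dominates v v∈C)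
    in ≁⇒¬~ (indM (∈⟪⟫⁻ inM? v∈M) (S⊆M s∈S)) v~s
    where
    inM? : ∀ v → Dec (v ∈ˡ M)
    inM? v = Any.any? (v F.≟_) M
    M-independent : IsIndependent G ⟪ inM? ⟫
    M-independent u v p q = indM (∈⟪⟫⁻ inM? p) (∈⟪⟫⁻ inM? q)
    M-maximal : ∀ J → IsIndependent G J → ⟪ inM? ⟫ ⊆ J → J ⊆ ⟪ inM? ⟫
    M-maximal J indJ M⊆J {v} v∈J with covers (∈-allFin v)
    ... | inj₁ v∈M = ∈⟪⟫⁺ inM? v∈M
    ... | inj₂ p = let (u , u∈M , u~v) = find p
                   in contradiction u~v (≁⇒¬~ (indJ u v (M⊆J (∈⟪⟫⁺ inM? u∈M)) v∈J))

  -- The predicate `I` may be undecidable, so one dominating vertex for each vertex of `C` is first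
  -- collected into a list.
  IsStrongClique⇒Strong : ∀ {C} → IsStrongClique G C → Strong G C
  IsStrongClique⇒Strong {C} strong@(clique , meets) = clique , λ I ind dominates →
    not-dominated strong (dominators I dominates (allFin (n G)))
      (λ p q → ¬~⇒≁ (ind (inI I dominates (allFin _) p) (inI I dominates (allFin _) q)))
      (λ c c∈ → dominated I dominates (∈-allFin _) c∈)
    where
    module _ (I : V → Set) (dominates : ∀ c → c ∈ C → ∃[ s ] I s × c ~ s) where
      dominators : List V → List V
      dominators [] = []
      dominators (c ∷ cs) with c ∈? C
      ... | yes c∈ = proj₁ (dominates c c∈) ∷ dominators cs
      ... | no _   = dominators cs
      inI : ∀ cs {s} → s ∈ˡ dominators cs → I s
      inI (c ∷ cs) p with c ∈? C
      inI (c ∷ cs) (here refl) | yes c∈ = proj₁ (proj₂ (dominates c c∈))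
      inI (c ∷ cs) (there p)   | yes c∈ = inI cs p
      inI (c ∷ cs) p           | no _   = inI cs p
      dominated : ∀ {c cs} → c ∈ˡ cs → c ∈ C → Any (c ~_) (dominators cs)
      dominated {c} (here refl) c∈ with c ∈? C
      ... | yes c∈′ = here (proj₂ (proj₂ (dominates c c∈′)))
      ... | no c∉   = contradiction c∈ c∉
      dominated (there {x = d} p) c∈ with d ∈? C
      ... | yes _ = there (dominated p c∈)
      ... | no _  = dominated p c∈

-- Localizable graphs

module Partition (G : Graph) where
  private
    V = Fin (n G)

  Disjoint : Subset (n G) → Subset (n G) → Set
  Disjoint A B = ∀ {v} → v ∈ A → v ∉ B

  Covers : List (Subset (n G)) → V → Set
  Covers L v = Any (v ∈_) L

  -- Partial partitions into strong cliques. Closure under R, with each clique linked by R,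
  -- forces a clique of one partial partition to lie inside or outside the union of another.
  record Partial (R : V → V → Set) (L : List (Subset (n G))) : Set where
    field
      strong   : All (IsStrongClique G) L
      disjoint : AllPairs Disjoint L
      linked   : All (λ C → ∀ {x y} → x ∈ C → y ∈ C → R x y) L
      closed   : ∀ {x y} → Covers L x → R x y → Covers L y
  open Partial

  Meets : List (Subset (n G)) → Subset (n G) → Set
  Meets L C = ∃[ v ] v ∈ C × Covers L v

  meets? : ∀ L C → Dec (Meets L C)
  meets? L C = F.any? λ v → (v ∈? C) ×-dec Any.any? (v ∈?_) L

  module _ {R : V → V → Set} {L M : List (Subset (n G))} (l : Partial R L) (m : Partial R M) where
    private
      new = filter (¬? ∘ meets? L) M

    covered : ∀ {v} → Covers M v → Covers (L ++ new) v
    covered {v} p with find p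
    ... | C , C∈M , v∈C with meets? L C
    ...   | no ¬q = Any.++⁺ʳ L (lose (∈-filter⁺ (¬? ∘ meets? L) C∈M ¬q) v∈C)
    ...   | yes (u , u∈C , u∈L) =
            Any.++⁺ˡ (closed l u∈L (All.lookup (linked m) C∈M u∈C v∈C))

    join : Partial R (L ++ new)
    join = record
      { strong = All.++⁺ (strong l) (All.filter⁺ (¬? ∘ meets? L) (strong m))
      ; disjoint = AllPairs.++⁺ (disjoint l) (AllPairs.filter⁺ (¬? ∘ meets? L) (disjoint m))
          (All.tabulate λ {A} A∈L → All.map (λ ¬q {v} v∈A v∈B → ¬q (v , v∈B , lose A∈L v∈A))
            (All.all-filter (¬? ∘ meets? L) M))
      ; linked = All.++⁺ (linked l) (All.filter⁺ (¬? ∘ meets? L) (linked m))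
      ; closed = closed′ }
      where
      closed′ : ∀ {x y} → Covers (L ++ new) x → R x y → Covers (L ++ new) y
      closed′ p r with Any.++⁻ L p
      ... | inj₁ q = Any.++⁺ˡ (closed l q r)
      ... | inj₂ q = let (C , C∈ , x∈C) = find q
                     in covered (closed m (lose (proj₁ (∈-filter⁻ (¬? ∘ meets? L) C∈)) x∈C) r)

  localizable : ∀ {R : V → V → Set} → (∀ v → ∃[ L ] Partial R L × Covers L v) → Localizable G
  localizable {R} local = length L , L.lookup L , (λ i → All.lookup (strong p) (∈-lookup i))
    , λ v → let c = covers (∈-allFin v) in Any.index c , Any.lookup-index c , unique (disjoint p) c
    where
    collect : ∀ vs → ∃[ L ] Partial R L × (∀ {v} → v ∈ˡ vs → Covers L v)
    collect [] = [] , record { strong = [] ; disjoint = [] ; linked = [] ; closed = λ () } , λ ()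
    collect (v ∷ vs) =
      let (L , l , c) = collect vs ; (M , m , d) = local v
      in L ++ filter (¬? ∘ meets? L) M , join l m
         , λ { (here refl) → covered l m d ; (there q) → Any.++⁺ˡ (c q) }
    everything = collect (allFin (n G))
    L = proj₁ everything
    p = proj₁ (proj₂ everything)
    covers = λ {v} → proj₂ (proj₂ everything) {v}
    unique : ∀ {L v} → AllPairs Disjoint L → (c : Covers L v) → ∀ j → v ∈ L.lookup L j → j ≡ Any.index c
    unique (d ∷ ds) (here p)  zero    q = refl
    unique (d ∷ ds) (here p)  (suc j) q = contradiction q (All.lookup d (∈-lookup j) p)
    unique (d ∷ ds) (there c) zero    q =
      let (C , C∈ , v∈) = find c in contradiction v∈ (All.lookup d C∈ q)
    unique (d ∷ ds) (there c) (suc j) q = cong suc (unique ds c j q)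

  classes-localizable : {_≈_ : V → V → Set} (_≈?_ : ∀ u v → Dec (u ≈ v)) →
    (∀ {u} → u ≈ u) → (∀ {u v} → u ≈ v → v ≈ u) → (∀ {u v w} → u ≈ v → v ≈ w → u ≈ w) →
    (∀ v → IsStrongClique G ⟪ v ≈?_ ⟫) → Localizable G
  classes-localizable {_≈_} _≈?_ ≈-refl ≈-sym ≈-trans strong = localizable {_≈_} λ v →
    ⟪ v ≈?_ ⟫ ∷ [] , record
      { strong = strong v ∷ []
      ; disjoint = [] ∷ []
      ; linked = (λ p q → ≈-trans (≈-sym (∈⟪⟫⁻ (v ≈?_) p)) (∈⟪⟫⁻ (v ≈?_) q)) ∷ []
      ; closed = λ { (here p) r → here (∈⟪⟫⁺ (v ≈?_) (≈-trans (∈⟪⟫⁻ (v ≈?_) p) r)) } }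
    , here (∈⟪⟫⁺ (v ≈?_) ≈-refl)

record StrongColouring (H : Graph) : Set₁ where
  field
    {colours} : ℕ
    colour    : Fin (n H) → Fin colours
  class : Fin colours → Subset (n H)
  class i = ⟪ (λ u → colour u F.≟ i) ⟫
  field
    strong : ∀ i → Strong H (class i)

-- Each embedded copy of `H` is a union of components, hence closed under equality-or-adjacency;
-- this is the relation along which the partial partitions are joined.
StrongColouring⇒Localizable : ∀ {G H} → IsSimple G → StrongColouring H →
  (∀ v → Σ (Embedding H G) λ e → ∃[ u ] Embedding.f e u ≡ v) → Localizable G
StrongColouring⇒Localizable {G} {H} simple κ local = localizable {R} λ v → pieces (local v)
  where
  open Partition G
  open StrongColouring κ renaming (strong to class-strong)
  R : Fin (n G) → Fin (n G) → Set
  R x y = x ≡ y ⊎ adj G x y ≡ true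
  pieces : ∀ {v} → (Σ (Embedding H G) λ e → ∃[ u ] Embedding.f e u ≡ v) →
    ∃[ L ] Partial R L × Covers L v
  pieces (e , u , refl) = map part (allFin colours) , record
    { strong = All.map⁺ (All.universal part-strong (allFin colours))
    ; disjoint = AllPairs.map⁺ (AllPairs.map disjoint (Unique.allFin⁺ colours))
    ; linked = All.map⁺ (All.universal (λ i {x} {y} → linked i {x} {y}) (allFin colours))
    ; closed = closed } , covers u
    where
    open Embedding e
    part : Fin colours → Subset (n G)
    part i = image e (class i)
    part-strong : ∀ i → IsStrongClique G (part i)
    part-strong i = StrongCliques.Strong⇒IsStrongClique G simple (Strong-image e (class-strong i))
    coloured : ∀ {i x} → x ∈ part i → ∃[ u ] colour u ≡ i × f u ≡ x
    coloured {i} p = let (u , q , r) = image⁻ e p in u , ∈⟪⟫⁻ (λ u → colour u F.≟ i) q , r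
    in-part : ∀ u → f u ∈ part (colour u)
    in-part u = image⁺ e (∈⟪⟫⁺ (λ w → colour w F.≟ colour u) refl)
    covers : ∀ u → Covers (map part (allFin colours)) (f u)
    covers u = Any.map⁺ (lose (∈-allFin (colour u)) (in-part u))
    disjoint : ∀ {i j} → i ≢ j → Disjoint (part i) (part j)
    disjoint i≢j p q with coloured p | coloured q
    ... | u , refl , refl | w , refl , r = i≢j (cong colour (sym (injective r)))
    linked : ∀ i {x y} → x ∈ part i → y ∈ part i → R x y
    linked i {x} {y} p q with x F.≟ y
    ... | yes r = inj₁ r
    ... | no r  = inj₂ (proj₁ (part-strong i) x y p q r)
    closed : ∀ {x y} → Covers (map part (allFin colours)) x → R x y →
      Covers (map part (allFin colours)) y
    closed c (inj₁ refl) = c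
    closed c (inj₂ x~y) with find (Any.map⁻ c)
    ... | i , _ , x∈ with coloured x∈
    ...   | u , _ , refl with lifts x~y
    ...     | w , refl , _ = covers w

-- Finite checks for the four fixed graphs

module _ (H : Graph) where
  -- Every choice of dominating vertices for the listed clique members contains an edge.
  clash : List (Fin (n H)) → List (Fin (n H)) → Bool
  clash chosen [] = false
  clash chosen (c ∷ cs) =
    all (λ s → not (adj H c s) ∨ (any (adj H s) chosen ∨ clash (s ∷ chosen) cs)) (allFin (n H))

  clash-sound : ∀ (I : Fin (n H) → Set) → (∀ {u v} → I u → I v → adj H u v ≢ true) →
    ∀ chosen cs → T (clash chosen cs) → All I chosen →
    ¬ All (λ c → ∃[ s ] I s × adj H c s ≡ true) cs
  clash-sound I ind chosen (c ∷ cs) t chs ((s , s∈ , c~s) ∷ ps)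
    with Equivalence.to (T-∨ {not (adj H c s)}) (All.lookup (All.all⁺ _ (allFin (n H)) t) (∈-allFin s))
  ... | inj₁ q = subst (T ∘ not) c~s q
  ... | inj₂ q with Equivalence.to (T-∨ {any (adj H s) chosen}) q
  ...   | inj₂ r = clash-sound I ind (s ∷ chosen) cs r (s∈ ∷ chs) ps
  ...   | inj₁ r =
    let (u , u∈ , s~u) = find (Any.any⁻ _ chosen r)
    in ind s∈ (All.lookup chs u∈) (Equivalence.to T-≡ s~u)

  module _ {k} (colour : Fin (n H) → Fin k) where
    monochromatic-edges? : Dec (∀ u v → colour u ≡ colour v → u ≢ v → adj H u v ≡ true)
    monochromatic-edges? = F.all? λ u → F.all? λ v →
      (colour u F.≟ colour v) →-dec (¬? (u F.≟ v) →-dec (adj H u v B.≟ true))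

    strongColouring : True monochromatic-edges? →
      T (all (λ i → clash [] (filter (λ u → colour u F.≟ i) (allFin (n H)))) (allFin k)) →
      StrongColouring H
    strongColouring m t = record
      { colour = colour
      ; strong = λ i →
          (λ u v p q → toWitness {a? = monochromatic-edges?} m u v
            (trans (∈⟪⟫⁻ (λ u → colour u F.≟ i) p) (sym (∈⟪⟫⁻ (λ u → colour u F.≟ i) q))))
          , λ I ind dominates → clash-sound I ind [] _
              (All.lookup (All.all⁺ _ (allFin k) t) (∈-allFin i)) []
              (All.tabulate λ {c} c∈ → dominates c (∈⟪⟫⁺ (λ u → colour u F.≟ i)
                (proj₂ (∈-filter⁻ (λ u → colour u F.≟ i) {xs = allFin (n H)} c∈)))) }

  successors : Fin (n H) → List (Fin (n H))
  successors u = filter (λ v → adj H u v B.≟ true) (allFin (n H))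

  -- Distinctness and edges suffice for a 4-valent `H`: the images of the four successors of a
  -- vertex exhaust the neighbours of its image, and this gives `lifts`.
  embeddingGoals : List Clause
  embeddingGoals = concatMap (λ u → concatMap (λ v →
    (if toℕ u <ᵇ toℕ v then (ne (toℕ u) (toℕ v) ∷ []) ∷ [] else []) ++
    (if adj H u v then (ad (toℕ u) (toℕ v) ∷ []) ∷ [] else []))
    (allFin (n H))) (allFin (n H))

module FixedEmbedding (G : Graph) (simple : IsSimple G) (regular : Regular 4 G) where
  open Neighbourhoods G simple
  open Degree4 regular

  embedding : ∀ H {k} (ρ : Vec V (suc k)) (fs : List Fact) →
    all (λ u → length (successors H u) ≡ᵇ 4) (allFin (n H)) ≡ true →
    ⟦ fs ⟧ᶠˢ (look ρ) → follows (suc k) fs (embeddingGoals H) ≡ true → Embedding H G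
  embedding H {k} ρ fs four ps r = record
    { f = f ; injective = injective ; preserves = preserves ; lifts = lifts }
    where
    f : Fin (n H) → V
    f u = look ρ (toℕ u)
    goals : ∀ u v → All (λ c → ⟦ c ⟧ᶜ (look ρ))
      ((if toℕ u <ᵇ toℕ v then (ne (toℕ u) (toℕ v) ∷ []) ∷ [] else []) ++
       (if adj H u v then (ad (toℕ u) (toℕ v) ∷ []) ∷ [] else []))
    goals u v = All.lookup (All.map⁻ (All.concat⁻ (All.lookup (All.map⁻ (All.concat⁻
      (follows-sound (look ρ) (suc k) fs (embeddingGoals H) r ps))) (∈-allFin u)))) (∈-allFin v)
    preserves : ∀ {u v} → adj H u v ≡ true → f u ~ f v
    preserves {u} {v} p with All.++⁻ʳ (if toℕ u <ᵇ toℕ v then (ne (toℕ u) (toℕ v) ∷ []) ∷ [] else []) (goals u v)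
    ... | q rewrite p = All.head q
    separated : ∀ {u v} → toℕ u < toℕ v → f u ≢ f v
    separated {u} {v} lt with goals u v
    ... | q rewrite Equivalence.to T-≡ (ℕ.<⇒<ᵇ lt) = All.head q
    injective : ∀ {u v} → f u ≡ f v → u ≡ v
    injective {u} {v} p with ℕ.<-cmp (toℕ u) (toℕ v)
    ... | tri< lt _ _ = contradiction p (separated lt)
    ... | tri≈ _ e _  = F.toℕ-injective e
    ... | tri> _ _ gt = contradiction (sym p) (separated gt)
    lifts : ∀ {u w} → f u ~ w → ∃[ v ] f v ≡ w × adj H u v ≡ true
    lifts {u} {w} p with four-successors | extend {f u} {map f (successors H u)}
        (Unique.map⁺ injective (Unique.filter⁺ (λ v → adj H u v B.≟ true) (Unique.allFin⁺ (n H))))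
        (All.map⁺ (All.map (λ {v} → preserves {u} {v}) (All.all-filter (λ v → adj H u v B.≟ true) (allFin (n H)))))
      where
      four-successors : length (successors H u) ≡ 4
      four-successors = ℕ.≡ᵇ⇒≡ _ 4 (All.lookup (All.all⁺ _ (allFin (n H)) (Equivalence.from T-≡ four)) (∈-allFin u))
    ... | e | z ∷ zs , _ , len = contradiction (trans (sym (trans (L.length-++ (map f (successors H u)))
            (cong (_+ suc (length zs)) (trans (L.length-map f (successors H u)) e)))) len) λ ()
    ... | e | [] , N , _ with find (Any.map⁻ (subst (w ∈ˡ_) (L.++-identityʳ _) (complete N p)))
    ...   | v , v∈ , refl = v , refl , proj₂ (∈-filter⁻ (λ v → adj H u v B.≟ true) {xs = allFin (n H)} v∈)

-- The classes are the edges joining `u` to `u + 4`, a perfect matching.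
colouring-K44 : StrongColouring K44
colouring-K44 = strongColouring K44 {4} (λ u → V.lookup (0F ∷ 1F ∷ 2F ∷ 3F ∷ 0F ∷ 1F ∷ 2F ∷ 3F ∷ []) u) _ _

colouring-K5 : StrongColouring (K 5)
colouring-K5 = strongColouring (K 5) {1} (λ _ → 0F) _ _

-- Vertex `(u , x)` has index `2u + x`, so the classes are two opposite faces of the octahedron.
colouring-octahedron : StrongColouring (lex (K 3) (E 2))
colouring-octahedron = strongColouring (lex (K 3) (E 2)) {2}
  (λ u → V.lookup (0F ∷ 1F ∷ 0F ∷ 1F ∷ 0F ∷ 1F ∷ []) u) _ _

colouring-LK33 : StrongColouring LK33
colouring-LK33 = strongColouring LK33 {3} (λ u → proj₁ (remQuot {3} 3 u)) _ _

-- Automorphisms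

record Symmetry (G : Graph) : Set where
  field
    g g⁻   : Fin (n G) → Fin (n G)
    g-adj  : ∀ u v → adj G (g u) (g v) ≡ adj G u v
    g⁻g    : ∀ v → g⁻ (g v) ≡ v
    gg⁻    : ∀ v → g (g⁻ v) ≡ v

  g-injective : ∀ {u v} → g u ≡ g v → u ≡ v
  g-injective p = trans (sym (g⁻g _)) (trans (cong g⁻ p) (g⁻g _))

  g-embedding : Embedding G G
  g-embedding = record
    { f = g ; injective = g-injective ; preserves = trans (g-adj _ _)
    ; lifts = λ p → g⁻ _ , gg⁻ _ , trans (sym (g-adj _ _)) (trans (cong (adj G _) (gg⁻ _)) p) }

  inverse : Symmetry G
  inverse = record
    { g = g⁻ ; g⁻ = g ; g⁻g = gg⁻ ; gg⁻ = g⁻g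
    ; g-adj = λ u v → trans (sym (g-adj _ _)) (cong₂ (adj G) (gg⁻ u) (gg⁻ v)) }

symmetry : ∀ {G} → VertexTransitive G → ∀ u v → Σ (Symmetry G) λ s → Symmetry.g s u ≡ v
symmetry vt u v =
  let (σ , aut , p) = vt u v
  in record { g = σ ⟨$⟩ʳ_ ; g⁻ = σ ⟨$⟩ˡ_ ; g-adj = aut
            ; g⁻g = λ _ → inverseˡ σ ; gg⁻ = λ _ → inverseʳ σ } , p

-- Closed walks

least : ∀ {P : ℕ → Set} → (∀ k → Dec (P k)) → ∀ k → P k → ∃[ m ] P m × (∀ {j} → j < m → ¬ P j)
least P? zero p = 0 , p , λ ()
least P? (suc k) p with P? 0
... | yes q = 0 , q , λ ()
... | no ¬q = let (m , r , h) = least (P? ∘ suc) k p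
              in suc m , r , λ { {zero} _ → ¬q ; {suc j} (s≤s lt) → h lt }

iterate : {D : Set} → (D → D) → ℕ → D → D
iterate S zero    s = s
iterate S (suc k) s = S (iterate S k s)

iterate-+ : ∀ {D : Set} (S : D → D) j k s → iterate S (j + k) s ≡ iterate S j (iterate S k s)
iterate-+ S zero    k s = refl
iterate-+ S (suc j) k s = cong S (iterate-+ S j k s)

iterate-comm : ∀ {D : Set} (S : D → D) k s → iterate S k (S s) ≡ S (iterate S k s)
iterate-comm S zero    s = refl
iterate-comm S (suc k) s = cong S (iterate-comm S k s)

-- A walk S on darts together with the reversal r: walking on from a reversed dart retraces
-- the walk.
module Darts {D : Set} {_≈_ : D → D → Set}
  (≈-refl : ∀ {s} → s ≈ s) (≈-sym : ∀ {s t} → s ≈ t → t ≈ s)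
  (≈-trans : ∀ {s t u} → s ≈ t → t ≈ u → s ≈ u)
  (S r : D → D) (S-cong : ∀ {s t} → s ≈ t → S s ≈ S t) (r-cong : ∀ {s t} → s ≈ t → r s ≈ r t)
  (rr : ∀ s → r (r s) ≈ s) (SrS : ∀ s → S (r (S s)) ≈ r s) where

  S^ : ℕ → D → D
  S^ = iterate S

  ≈-reflexive : ∀ {s t} → s ≡ t → s ≈ t
  ≈-reflexive refl = ≈-refl

  S^-cong : ∀ k {s t} → s ≈ t → S^ k s ≈ S^ k t
  S^-cong zero    p = p
  S^-cong (suc k) p = S-cong (S^-cong k p)

  S-injective : ∀ {s t} → S s ≈ S t → s ≈ t
  S-injective p = ≈-trans (≈-sym (back _)) (≈-trans (r-cong (S-cong (r-cong p))) (back _))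
    where
    back : ∀ s → r (S (r (S s))) ≈ s
    back s = ≈-trans (r-cong (SrS s)) (rr s)

  S^-injective : ∀ k {s t} → S^ k s ≈ S^ k t → s ≈ t
  S^-injective zero    p = p
  S^-injective (suc k) p = S^-injective k (S-injective p)

  retrace : ∀ k s → S^ k (r (S^ k s)) ≈ r s
  retrace zero    s = ≈-refl
  retrace (suc k) s = ≈-trans (≈-reflexive (sym (iterate-comm S k _)))
    (≈-trans (S^-cong k (SrS (S^ k s))) (retrace k s))

  module Oriented (s≉rs : ∀ s → ¬ s ≈ r s) (Ss≉rs : ∀ s → ¬ S s ≈ r s) where
    -- Descent by two: applying `S` to both sides and cancelling with `SrS` shortens the walk at
    -- both ends, down to the two excluded cases.
    no-return : ∀ d t → ¬ t ≈ r (S^ d t)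
    no-return zero          t p = s≉rs t p
    no-return (suc zero)    t p = Ss≉rs t (≈-sym (≈-trans (r-cong p) (rr (S t))))
    no-return (suc (suc d)) t p = no-return d (S t)
      (≈-trans (S-cong p) (≈-trans (SrS (S^ (suc d) t)) (r-cong (≈-reflexive (sym (iterate-comm S d t))))))

    no-reverse : ∀ i j s → ¬ S^ i s ≈ r (S^ j s)
    no-reverse i j s p with ℕ.≤-total i j
    ... | inj₁ le = no-return (j ∸ i) (S^ i s) (≈-trans p (r-cong (≈-reflexive
            (trans (cong (λ k → S^ k s) (sym (ℕ.m∸n+n≡m le))) (iterate-+ S (j ∸ i) i s)))))
    ... | inj₂ le = no-return (i ∸ j) (S^ j s) (≈-trans (≈-sym (rr _)) (r-cong (≈-trans (≈-sym p)
            (≈-reflexive (trans (cong (λ k → S^ k s) (sym (ℕ.m∸n+n≡m le))) (iterate-+ S (i ∸ j) j s))))))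

  gap : ∀ {i j s} → i < j → S^ i s ≈ S^ j s → s ≈ S^ (suc (j ∸ suc i)) s
  gap {i} {j} {s} lt p = S^-injective i (≈-trans p (≈-reflexive
    (trans (cong (λ k → S^ k s) (sym (trans (ℕ.+-suc i _) (ℕ.m+[n∸m]≡n lt))))
      (iterate-+ S i (suc (j ∸ suc i)) s))))

  -- `pred` is the period minus one, so that positions on the cycle form `Fin (suc pred)`.
  record Period (s : D) : Set where
    field
      pred     : ℕ
      returns  : S^ (suc pred) s ≈ s
      distinct : ∀ {i j} → i < j → j ≤ pred → ¬ S^ i s ≈ S^ j s

  -- The pigeonhole principle gives some repetition, which injectivity of `S` shifts back to the
  -- start; the least return then excludes every earlier repetition in the same way.
  period : (_≈?_ : ∀ s t → Dec (s ≈ t)) → ∀ {N} (code : D → Fin N) →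
    (∀ {s t} → code s ≡ code t → s ≈ t) → ∀ s → Period s
  period _≈?_ {N} code code⁻ s =
    let (i , j , i<j , e) = F.pigeonhole (ℕ.n<1+n N) (λ i → code (S^ (toℕ i) s))
        (m , r , h) = least (λ k → S^ (suc k) s ≈? s) (toℕ j ∸ suc (toℕ i)) (≈-sym (gap i<j (code⁻ e)))
    in record { pred = m ; returns = r
              ; distinct = λ lt le p → h (ℕ.≤-trans (shrink lt) le) (≈-sym (gap lt p)) }
    where
    shrink : ∀ {i j} → i < j → j ∸ suc i < j
    shrink {i} {suc j} _ = s≤s (ℕ.m∸n≤m j i)

-- Cyclic successors and decoding of Boolean adjacency

mod-cases : ∀ {n i j} → i ≤ n → j ≡ suc i mod suc n → (j ≡ suc i × suc i ≤ n) ⊎ (j ≡ 0 × i ≡ n)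
mod-cases {n} {i} le e with i ℕ.<? n
... | yes lt = inj₁ (trans e (ℕ.m<n⇒m%n≡m (s≤s lt)) , lt)
... | no ¬lt with refl ← ℕ.≤-antisym le (ℕ.≮⇒≥ ¬lt) = inj₂ (trans e (ℕ.n%n≡0 (suc n)) , refl)

Next : ∀ {m} → Fin m → Fin m → Set
Next {m} i j = toℕ j ≡ suc (toℕ i) mod m

next : ∀ {n} (i : Fin (suc n)) → ∃[ j ] Next i j
next {n} i = fromℕ< (ℕ.m%n<n (suc (toℕ i)) (suc n)) , F.toℕ-fromℕ< _

prev : ∀ {n} (j : Fin (suc n)) → ∃[ i ] Next i j
prev {n} zero = F.fromℕ n , trans (sym (ℕ.n%n≡0 (suc n))) (cong (λ k → suc k % suc n) (sym (F.toℕ-fromℕ n)))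
prev {n} (suc j) = F.inject₁ j , trans (sym (ℕ.m<n⇒m%n≡m (s≤s (F.toℕ<n j))))
  (cong (λ k → suc k % suc n) (sym (F.toℕ-inject₁ j)))

∧⁻ : ∀ {a b} → a ∧ b ≡ true → a ≡ true × b ≡ true
∧⁻ {true} {true} p = refl , refl

∧⁺ : ∀ {a b} → a ≡ true → b ≡ true → a ∧ b ≡ true
∧⁺ refl refl = refl

∨⁻ : ∀ {a b} → a ∨ b ≡ true → a ≡ true ⊎ b ≡ true
∨⁻ {true}  p = inj₁ refl
∨⁻ {false} p = inj₂ p

∨⁺ˡ : ∀ {a b} → a ≡ true → a ∨ b ≡ true
∨⁺ˡ refl = refl

∨⁺ʳ : ∀ {a b} → b ≡ true → a ∨ b ≡ true
∨⁺ʳ {true}  p = refl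
∨⁺ʳ {false} p = p

module _ {P : Set} where
  ⌊⌋⁻ : {d : Dec P} → ⌊ d ⌋ ≡ true → P
  ⌊⌋⁻ {yes p} _ = p

  ⌊⌋⁺ : {d : Dec P} → P → ⌊ d ⌋ ≡ true
  ⌊⌋⁺ {yes _} _ = refl
  ⌊⌋⁺ {no ¬p} p = contradiction p ¬p

  not⌊⌋⁻ : {d : Dec P} → not ⌊ d ⌋ ≡ true → ¬ P
  not⌊⌋⁻ {no ¬p} _ = ¬p

  not⌊⌋⁺ : {d : Dec P} → ¬ P → not ⌊ d ⌋ ≡ true
  not⌊⌋⁺ {yes p} ¬p = contradiction p ¬p
  not⌊⌋⁺ {no _}  _  = refl

remQuot-injective : ∀ {m} k {a b : Fin (m * k)} → remQuot {m} k a ≡ remQuot {m} k b → a ≡ b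
remQuot-injective {m} k {a} {b} p =
  trans (sym (F.combine-remQuot {m} k a)) (trans (cong (λ q → combine (proj₁ q) (proj₂ q)) p) (F.combine-remQuot {m} k b))

pigeonhole₃ : (b : Fin 3 → Bool) → ∃₂ λ s t → s F.< t × b s ≡ b t
pigeonhole₃ b with b 0F in p | b 1F in q | b 2F in r
... | true  | true  | _     = 0F , 1F , s≤s z≤n , trans p (sym q)
... | false | false | _     = 0F , 1F , s≤s z≤n , trans p (sym q)
... | true  | false | true  = 0F , 2F , s≤s z≤n , trans p (sym r)
... | false | true  | false = 0F , 2F , s≤s z≤n , trans p (sym r)
... | true  | false | false = 1F , 2F , s≤s (s≤s z≤n) , trans q (sym r)
... | false | true  | true  = 1F , 2F , s≤s (s≤s z≤n) , trans q (sym r)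

Next-functional : ∀ {m} {i j k : Fin m} → Next i j → Next i k → j ≡ k
Next-functional p q = F.toℕ-injective (trans p (sym q))

Next-injective : ∀ {m} {i j k : Fin m} → Next i k → Next j k → i ≡ j
Next-injective {suc m} {i} {j} p q
  with mod-cases (F.toℕ≤pred[n] i) p | mod-cases (F.toℕ≤pred[n] j) q
... | inj₁ (e , _) | inj₁ (e′ , _) = F.toℕ-injective (ℕ.suc-injective (trans (sym e) e′))
... | inj₂ (_ , e) | inj₂ (_ , e′) = F.toℕ-injective (trans e (sym e′))
... | inj₁ (e , _) | inj₂ (e′ , _) = contradiction (trans (sym e) e′) λ ()
... | inj₂ (e , _) | inj₁ (e′ , _) = contradiction (trans (sym e′) e) λ ()

-- A dominating vertex inside `C` would itself be adjacent to a vertex of the independent `I`.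
outside : ∀ {G C} {I : Fin (n G) → Set} → (∀ {u v} → I u → I v → adj G u v ≢ true) →
  (∀ c → c ∈ C → ∃[ s ] I s × adj G c s ≡ true) →
  ∀ c → c ∈ C → ∃[ s ] I s × s ∉ C × adj G c s ≡ true
outside ind dom c c∈ =
  let (s , s∈ , c~s) = dom c c∈
  in s , s∈ , (λ s∈C → let (t , t∈ , s~t) = dom s s∈C in ind s∈ t∈ s~t) , c~s

-- The graphs Hₘ

HLink : ∀ {m} → Fin m × Fin 4 → Fin m × Fin 4 → Set
HLink (i , s) (j , t) = Next i j × ((s ≡ 2F × t ≡ 0F) ⊎ (s ≡ 3F × t ≡ 1F))

HAdj : ∀ {m} → Fin m × Fin 4 → Fin m × Fin 4 → Set
HAdj p q = (proj₁ p ≡ proj₁ q × proj₂ p ≢ proj₂ q) ⊎ HLink p q ⊎ HLink q p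

module _ {m : ℕ} where
  private
    linkBool : Fin m × Fin 4 → Fin m × Fin 4 → ℕ → ℕ → Bool
    linkBool (i , s) (j , t) k l = (toℕ j =ℕ (suc (toℕ i) mod m)) ∧ (toℕ s =ℕ k ∧ toℕ t =ℕ l)

    Hbool : Fin m × Fin 4 → Fin m × Fin 4 → Bool
    Hbool p q = proj₁ p == proj₁ q ∨ (linkBool p q 2 0 ∨ linkBool p q 3 1)

    linkBool⁻ : ∀ p q k l → linkBool p q (toℕ k) (toℕ l) ≡ true →
      Next (proj₁ p) (proj₁ q) × proj₂ p ≡ k × proj₂ q ≡ l
    linkBool⁻ (i , s) (j , t) k l e =
      let (x , yz) = ∧⁻ {toℕ j =ℕ (suc (toℕ i) mod m)} e
          (y , z) = ∧⁻ {toℕ s =ℕ toℕ k} yz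
      in ⌊⌋⁻ {d = toℕ j ℕ.≟ (suc (toℕ i) mod m)} x
         , F.toℕ-injective (⌊⌋⁻ {d = toℕ s ℕ.≟ toℕ k} y)
         , F.toℕ-injective (⌊⌋⁻ {d = toℕ t ℕ.≟ toℕ l} z)

    linkBool⁺ : ∀ p q k l → Next (proj₁ p) (proj₁ q) → proj₂ p ≡ k → proj₂ q ≡ l →
      linkBool p q (toℕ k) (toℕ l) ≡ true
    linkBool⁺ (i , s) (j , t) k l x refl refl = ∧⁺ (⌊⌋⁺ {d = toℕ j ℕ.≟ (suc (toℕ i) mod m)} x)
      (∧⁺ (⌊⌋⁺ {d = toℕ s ℕ.≟ toℕ s} refl) (⌊⌋⁺ {d = toℕ t ℕ.≟ toℕ t} refl))

    Hbool⁻ : ∀ p q → Hbool p q ≡ true → proj₁ p ≡ proj₁ q ⊎ HLink p q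
    Hbool⁻ p q e with ∨⁻ {proj₁ p == proj₁ q} e
    ... | inj₁ x = inj₁ (⌊⌋⁻ {d = proj₁ p F.≟ proj₁ q} x)
    ... | inj₂ e′ with ∨⁻ {linkBool p q 2 0} e′
    ...   | inj₁ l = let (x , y) = linkBool⁻ p q 2F 0F l in inj₂ (x , inj₁ y)
    ...   | inj₂ l = let (x , y) = linkBool⁻ p q 3F 1F l in inj₂ (x , inj₂ y)

    Hbool⁺ : ∀ p q → HLink p q → Hbool p q ≡ true
    Hbool⁺ p q (x , inj₁ (y , z)) =
      ∨⁺ʳ {proj₁ p == proj₁ q} (∨⁺ˡ {linkBool p q 2 0} (linkBool⁺ p q 2F 0F x y z))
    Hbool⁺ p q (x , inj₂ (y , z)) =
      ∨⁺ʳ {proj₁ p == proj₁ q} (∨⁺ʳ {linkBool p q 2 0} (linkBool⁺ p q 3F 1F x y z))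

    link-irrefl : ∀ {p : Fin m × Fin 4} → ¬ HLink p p
    link-irrefl (_ , inj₁ (refl , ()))
    link-irrefl (_ , inj₂ (refl , ()))

    pair : Fin (m * 4) → Fin m × Fin 4
    pair = remQuot {m} 4

  H-adj⁻ : ∀ {a b} → adj (H m) a b ≡ true → HAdj (remQuot {m} 4 a) (remQuot {m} 4 b)
  H-adj⁻ {a} {b} e with ∧⁻ {not ⌊ a F.≟ b ⌋} e
  ... | x , y with not⌊⌋⁻ {d = a F.≟ b} x | ∨⁻ {Hbool (pair a) (pair b)} y
  ...   | a≢b | inj₁ r = [ (λ p → inj₁ (p , λ q → a≢b (remQuot-injective {m} 4 (cong₂ _,_ p q))))
                         , inj₂ ∘ inj₁ ]′ (Hbool⁻ (pair a) (pair b) r)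
  ...   | a≢b | inj₂ r = [ (λ p → inj₁ (sym p , λ q → a≢b (remQuot-injective {m} 4 (cong₂ _,_ (sym p) q))))
                         , inj₂ ∘ inj₂ ]′ (Hbool⁻ (pair b) (pair a) r)

  H-adj⁺ : ∀ {a b} → HAdj (remQuot {m} 4 a) (remQuot {m} 4 b) → adj (H m) a b ≡ true
  H-adj⁺ {a} {b} (inj₁ (p , q)) = ∧⁺ (not⌊⌋⁺ {d = a F.≟ b} λ { refl → q refl })
    (∨⁺ˡ {Hbool (pair a) (pair b)} (∨⁺ˡ (⌊⌋⁺ {d = proj₁ (pair a) F.≟ proj₁ (pair b)} p)))
  H-adj⁺ {a} {b} (inj₂ (inj₁ l)) = ∧⁺ (not⌊⌋⁺ {d = a F.≟ b} λ { refl → link-irrefl l })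
    (∨⁺ˡ {Hbool (pair a) (pair b)} (Hbool⁺ (pair a) (pair b) l))
  H-adj⁺ {a} {b} (inj₂ (inj₂ l)) = ∧⁺ (not⌊⌋⁺ {d = a F.≟ b} λ { refl → link-irrefl l })
    (∨⁺ʳ {Hbool (pair a) (pair b)} (Hbool⁺ (pair b) (pair a) l))

-- Outside the clique, a neighbour of its `x` can only be the `z`, and a neighbour of its `y` only
-- the `w`, of the preceding clique; these are adjacent.
H-strong : ∀ m → Strong (H (suc m)) ⟪ (λ a → proj₁ (remQuot {suc m} 4 a) F.≟ 0F) ⟫
H-strong m =
  (λ u v p q u≢v → H-adj⁺ {suc m} {u} {v} (inj₁ (trans (block⁻ p) (sym (block⁻ q))
     , λ e → u≢v (remQuot-injective {suc m} 4 (cong₂ _,_ (trans (block⁻ p) (sym (block⁻ q))) e)))))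
  , λ I ind dom →
    let (s , s∈ , s∉ , x~s) = outside {H (suc m)} ind dom (vertex 0F) (block⁺ (vertex-block 0F))
        (t , t∈ , t∉ , y~t) = outside {H (suc m)} ind dom (vertex 1F) (block⁺ (vertex-block 1F))
        (p , p′) = enter₀ (s∉ ∘ block⁺) (subst (λ v → HAdj v (remQuot 4 s)) (F.remQuot-combine 0F 0F) (H-adj⁻ {suc m} {vertex 0F} {s} x~s))
        (q , q′) = enter₁ (t∉ ∘ block⁺) (subst (λ v → HAdj v (remQuot 4 t)) (F.remQuot-combine 0F 1F) (H-adj⁻ {suc m} {vertex 1F} {t} y~t))
    in ind s∈ t∈ (H-adj⁺ {suc m} {s} {t} (inj₁ (Next-injective p q , λ e → contradiction (trans (sym p′) (trans e q′)) λ ())))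
  where
  block? : ∀ a → Dec (proj₁ (remQuot {suc m} 4 a) ≡ 0F)
  block? a = proj₁ (remQuot {suc m} 4 a) F.≟ 0F
  block⁺ : ∀ {a} → proj₁ (remQuot {suc m} 4 a) ≡ 0F → a ∈ ⟪ block? ⟫
  block⁺ = ∈⟪⟫⁺ block?
  block⁻ : ∀ {a} → a ∈ ⟪ block? ⟫ → proj₁ (remQuot {suc m} 4 a) ≡ 0F
  block⁻ = ∈⟪⟫⁻ block?
  vertex : Fin 4 → Fin (suc m * 4)
  vertex t = combine {suc m} 0F t
  vertex-block : ∀ t → proj₁ (remQuot {suc m} 4 (vertex t)) ≡ 0F
  vertex-block t = cong proj₁ (F.remQuot-combine {suc m} 0F t)
  enter₀ : ∀ {q : Fin (suc m) × Fin 4} → proj₁ q ≢ 0F → HAdj (0F , 0F) q → Next (proj₁ q) 0F × proj₂ q ≡ 2F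
  enter₀ h (inj₁ (e , _)) = contradiction (sym e) h
  enter₀ h (inj₂ (inj₁ (_ , inj₁ (() , _))))
  enter₀ h (inj₂ (inj₁ (_ , inj₂ (() , _))))
  enter₀ h (inj₂ (inj₂ (x , inj₁ (y , _)))) = x , y
  enter₁ : ∀ {q : Fin (suc m) × Fin 4} → proj₁ q ≢ 0F → HAdj (0F , 1F) q → Next (proj₁ q) 0F × proj₂ q ≡ 3F
  enter₁ h (inj₁ (e , _)) = contradiction (sym e) h
  enter₁ h (inj₂ (inj₁ (_ , inj₁ (() , _))))
  enter₁ h (inj₂ (inj₁ (_ , inj₂ (() , _))))
  enter₁ h (inj₂ (inj₂ (x , inj₂ (y , _)))) = x , y

-- Prisms over cycles

CycleAdj : ∀ {m} → Fin m → Fin m → Set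
CycleAdj i j = i ≢ j × (Next i j ⊎ Next j i)

CartAdj : ∀ {m} → Fin 3 × Fin m → Fin 3 × Fin m → Set
CartAdj p q = (proj₁ p ≡ proj₁ q × CycleAdj (proj₂ p) (proj₂ q)) ⊎ (proj₂ p ≡ proj₂ q × proj₁ p ≢ proj₁ q)

cycle-adj⁻ : ∀ {m} {i j : Fin m} → adj (C m) i j ≡ true → CycleAdj i j
cycle-adj⁻ {m} {i} {j} e with ∧⁻ {not ⌊ i F.≟ j ⌋} e
... | x , y = not⌊⌋⁻ {d = i F.≟ j} x
  , Sum.map (⌊⌋⁻ {d = toℕ j ℕ.≟ (suc (toℕ i) mod m)}) (⌊⌋⁻ {d = toℕ i ℕ.≟ (suc (toℕ j) mod m)})
      (∨⁻ {toℕ j =ℕ (suc (toℕ i) mod m)} y)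

cycle-adj⁺ : ∀ {m} {i j : Fin m} → CycleAdj i j → adj (C m) i j ≡ true
cycle-adj⁺ {m} {i} {j} (x , y) = ∧⁺ (not⌊⌋⁺ {d = i F.≟ j} x)
  ([ (λ p → ∨⁺ˡ {toℕ j =ℕ (suc (toℕ i) mod m)} (⌊⌋⁺ {d = toℕ j ℕ.≟ (suc (toℕ i) mod m)} p))
   , (λ p → ∨⁺ʳ {toℕ j =ℕ (suc (toℕ i) mod m)} (⌊⌋⁺ {d = toℕ i ℕ.≟ (suc (toℕ j) mod m)} p)) ]′ y)

C3-adj : ∀ i j → i ≢ j → adj (C 3) i j ≡ true
C3-adj = toWitness {a? = F.all? λ i → F.all? λ j → ¬? (i F.≟ j) →-dec (adj (C 3) i j B.≟ true)} tt

module _ {m : ℕ} where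
  private
    cartBool : Fin 3 × Fin m → Fin 3 × Fin m → Bool
    cartBool (x₁ , y₁) (x₂ , y₂) = (x₁ == x₂ ∧ adj (C m) y₁ y₂) ∨ (y₁ == y₂ ∧ adj (C 3) x₁ x₂)

    cartBool⁻ : ∀ p q → cartBool p q ≡ true → CartAdj p q
    cartBool⁻ (x₁ , y₁) (x₂ , y₂) e with ∨⁻ {x₁ == x₂ ∧ adj (C m) y₁ y₂} e
    ... | inj₁ l = let (x , y) = ∧⁻ {x₁ == x₂} l in inj₁ (⌊⌋⁻ {d = x₁ F.≟ x₂} x , cycle-adj⁻ {m} y)
    ... | inj₂ l = let (x , y) = ∧⁻ {y₁ == y₂} l in inj₂ (⌊⌋⁻ {d = y₁ F.≟ y₂} x , proj₁ (cycle-adj⁻ {3} {x₁} {x₂} y))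

    cartBool⁺ : ∀ p q → CartAdj p q → cartBool p q ≡ true
    cartBool⁺ (x₁ , y₁) (x₂ , y₂) (inj₁ (x , y)) = ∨⁺ˡ (∧⁺ (⌊⌋⁺ {d = x₁ F.≟ x₂} x) (cycle-adj⁺ {m} y))
    cartBool⁺ (x₁ , y₁) (x₂ , y₂) (inj₂ (x , y)) =
      ∨⁺ʳ {x₁ == x₂ ∧ adj (C m) y₁ y₂} (∧⁺ (⌊⌋⁺ {d = y₁ F.≟ y₂} x) (C3-adj x₁ x₂ y))

  cart-adj⁻ : ∀ {a b} → adj (cart (C 3) (C m)) a b ≡ true → CartAdj (remQuot {3} m a) (remQuot {3} m b)
  cart-adj⁻ {a} {b} = cartBool⁻ (remQuot {3} m a) (remQuot {3} m b)

  cart-adj⁺ : ∀ {a b} → CartAdj (remQuot {3} m a) (remQuot {3} m b) → adj (cart (C 3) (C m)) a b ≡ true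
  cart-adj⁺ {a} {b} = cartBool⁺ (remQuot {3} m a) (remQuot {3} m b)

-- Three outer dominating vertices lie in the next or the preceding layer. Two of them are on the
-- same side, hence in one triangle.
cart-strong : ∀ m → Strong (cart (C 3) (C (suc m))) ⟪ (λ a → proj₂ (remQuot {3} (suc m) a) F.≟ 0F) ⟫
cart-strong m =
  (λ u v p q u≢v → cart-adj⁺ {suc m} {u} {v} (inj₂ (trans (layer⁻ p) (sym (layer⁻ q))
     , λ e → u≢v (remQuot-injective {3} (suc m) (cong₂ _,_ e (trans (layer⁻ p) (sym (layer⁻ q))))))))
  , avoid
  where
  layer? : ∀ a → Dec (proj₂ (remQuot {3} (suc m) a) ≡ 0F)
  layer? a = proj₂ (remQuot {3} (suc m) a) F.≟ 0F
  layer⁻ : ∀ {a} → a ∈ ⟪ layer? ⟫ → proj₂ (remQuot {3} (suc m) a) ≡ 0F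
  layer⁻ = ∈⟪⟫⁻ layer?
  vertex : Fin 3 → Fin (3 * suc m)
  vertex t = combine {3} t 0F
  vertex-layer : ∀ t → vertex t ∈ ⟪ layer? ⟫
  vertex-layer t = ∈⟪⟫⁺ layer? (cong proj₂ (F.remQuot-combine {3} t 0F))
  side : ∀ t {q : Fin 3 × Fin (suc m)} → proj₂ q ≢ 0F → CartAdj (t , 0F) q →
    t ≡ proj₁ q × ∃[ b ] (if b then Next 0F (proj₂ q) else Next (proj₂ q) 0F)
  side t h (inj₁ (e , _ , inj₁ p)) = e , true , p
  side t h (inj₁ (e , _ , inj₂ p)) = e , false , p
  side t h (inj₂ (e , _)) = contradiction (sym e) h
  same-side : ∀ {b c} {i j : Fin (suc m)} → b ≡ c → (if b then Next 0F i else Next i 0F) →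
    (if c then Next 0F j else Next j 0F) → i ≡ j
  same-side {true}  refl p q = Next-functional {i = 0F} p q
  same-side {false} refl p q = Next-injective {k = 0F} p q
  avoid : Unavoidable (cart (C 3) (C (suc m))) ⟪ layer? ⟫
  avoid I ind dom =
    let (s , t , s<t , e) = pigeonhole₃ (λ t → proj₁ (proj₂ (sides t)))
    in ind (proj₁ (proj₂ (dominator s))) (proj₁ (proj₂ (dominator t)))
         (cart-adj⁺ {suc m} {proj₁ (dominator s)} {proj₁ (dominator t)} (inj₂ (same-side e (proj₂ (proj₂ (sides s))) (proj₂ (proj₂ (sides t)))
           , λ e′ → F.<⇒≢ s<t (trans (proj₁ (sides s)) (trans e′ (sym (proj₁ (sides t))))))))
    where
    dominator = λ t → outside {cart (C 3) (C (suc m))} ind dom (vertex t) (vertex-layer t)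
    sides = λ t → side t (proj₁ (proj₂ (proj₂ (dominator t))) ∘ ∈⟪⟫⁺ layer?)
      (subst (λ v → CartAdj v (remQuot {3} (suc m) (proj₁ (dominator t)))) (F.remQuot-combine {3} t 0F)
        (cart-adj⁻ {suc m} {vertex t} {proj₁ (dominator t)} (proj₂ (proj₂ (proj₂ (dominator t))))))

-- Circulant graphs

%-absorbʳ : ∀ a b m .{{_ : NonZero m}} → (a + b % m) % m ≡ (a + b) % m
%-absorbʳ a b m = trans (ℕ.%-distribˡ-+ a (b % m) m)
  (trans (cong (λ c → (a % m + c) % m) (ℕ.m%n%n≡m%n b m)) (sym (ℕ.%-distribˡ-+ a b m)))

%-absorbˡ : ∀ a b m .{{_ : NonZero m}} → (a % m + b) % m ≡ (a + b) % m
%-absorbˡ a b m = trans (cong (_% m) (ℕ.+-comm (a % m) b)) (trans (%-absorbʳ b a m) (cong (_% m) (ℕ.+-comm b a)))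

%-cancelˡ : ∀ {x d e} m .{{_ : NonZero m}} → x ≤ m → (x + d) % m ≡ (x + e) % m → d % m ≡ e % m
%-cancelˡ {x} {d} {e} m le p = trans (sym (shift d)) (trans (cong (λ c → (m ∸ x + c) % m) p) (shift e))
  where
  shift : ∀ c → (m ∸ x + (x + c) % m) % m ≡ c % m
  shift c = trans (%-absorbʳ (m ∸ x) (x + c) m) (trans (cong (_% m)
    (trans (sym (ℕ.+-assoc (m ∸ x) x c)) (trans (cong (_+ c) (ℕ.m∸n+n≡m le)) (ℕ.+-comm m c)))) (ℕ.[m+n]%n≡m%n c m))

module _ {n : ℕ} {S : ℕ → Bool} where
  private
    m = suc n

  Cay-adj⁻ : ∀ {x y} → adj (CayZ m S) x y ≡ true → ∃[ d ] S d ≡ true × toℕ y ≡ (toℕ x + d) % m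
  Cay-adj⁻ {x} {y} e = (toℕ y + m ∸ toℕ x) % m , proj₂ (∧⁻ {not (x == y)} e) , sym (
    trans (%-absorbʳ (toℕ x) (toℕ y + m ∸ toℕ x) m)
      (trans (cong (_% m) (ℕ.m+[n∸m]≡n (ℕ.≤-trans (ℕ.<⇒≤ (F.toℕ<n x)) (ℕ.m≤n+m m (toℕ y)))))
        (trans (ℕ.[m+n]%n≡m%n (toℕ y) m) (ℕ.m<n⇒m%n≡m (F.toℕ<n y)))))

  Cay-adj⁺ : ∀ {x y d} → S d ≡ true → 0 < d → d < m → toℕ y ≡ (toℕ x + d) % m → adj (CayZ m S) x y ≡ true
  Cay-adj⁺ {x} {y} {d} s pos lt p = ∧⁺ (not⌊⌋⁺ {d = x F.≟ y} x≢y) (trans (cong S same) s)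
    where
    x≢y : x ≢ y
    x≢y refl = ℕ.<⇒≢ pos (sym (trans (sym (ℕ.m<n⇒m%n≡m lt)) (%-cancelˡ m (ℕ.<⇒≤ (F.toℕ<n x))
      (trans (sym p) (trans (sym (ℕ.m<n⇒m%n≡m (F.toℕ<n x))) (cong (_% m) (sym (ℕ.+-identityʳ (toℕ x)))))))))
    same : (toℕ y + m ∸ toℕ x) % m ≡ d
    same = trans (%-cancelˡ {toℕ x} {toℕ y + m ∸ toℕ x} m (ℕ.<⇒≤ (F.toℕ<n x))
        (trans (cong (_% m) (ℕ.m+[n∸m]≡n (ℕ.≤-trans (ℕ.<⇒≤ (F.toℕ<n x)) (ℕ.m≤n+m m (toℕ y)))))
          (trans (ℕ.[m+n]%n≡m%n (toℕ y) m) (trans (ℕ.m<n⇒m%n≡m (F.toℕ<n y)) p))))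
      (ℕ.m<n⇒m%n≡m lt)

module Cay3 (k′ : ℕ) where
  k m : ℕ
  k = suc k′
  m = 3 * k

  steps : ℕ → Bool
  steps d = (d =ℕ 1) ∨ (d =ℕ (m ∸ 1)) ∨ (d =ℕ k) ∨ (d =ℕ (m ∸ k))

  m∸k : m ∸ k ≡ 2 * k
  m∸k = ℕ.m+n∸m≡n k (2 * k)

  Step : ℕ → Set
  Step d = d ≡ 1 ⊎ d ≡ m ∸ 1 ⊎ d ≡ k ⊎ d ≡ 2 * k

  steps⁻ : ∀ {d} → steps d ≡ true → Step d
  steps⁻ {d} p with ∨⁻ {d =ℕ 1} p
  ... | inj₁ q = inj₁ (⌊⌋⁻ {d = d ℕ.≟ 1} q)
  ... | inj₂ p′ with ∨⁻ {d =ℕ (m ∸ 1)} p′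
  ...   | inj₁ q = inj₂ (inj₁ (⌊⌋⁻ {d = d ℕ.≟ (m ∸ 1)} q))
  ...   | inj₂ p″ with ∨⁻ {d =ℕ k} p″
  ...     | inj₁ q = inj₂ (inj₂ (inj₁ (⌊⌋⁻ {d = d ℕ.≟ k} q)))
  ...     | inj₂ q = inj₂ (inj₂ (inj₂ (trans (⌊⌋⁻ {d = d ℕ.≟ (m ∸ k)} q) m∸k)))

  steps⁺ : ∀ {d} → Step d → steps d ≡ true
  steps⁺ {d} (inj₁ p) = ∨⁺ˡ {d =ℕ 1} (⌊⌋⁺ {d = d ℕ.≟ 1} p)
  steps⁺ {d} (inj₂ (inj₁ p)) = ∨⁺ʳ {d =ℕ 1} (∨⁺ˡ {d =ℕ (m ∸ 1)} (⌊⌋⁺ {d = d ℕ.≟ (m ∸ 1)} p))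
  steps⁺ {d} (inj₂ (inj₂ (inj₁ p))) = ∨⁺ʳ {d =ℕ 1} (∨⁺ʳ {d =ℕ (m ∸ 1)} (∨⁺ˡ {d =ℕ k} (⌊⌋⁺ {d = d ℕ.≟ k} p)))
  steps⁺ {d} (inj₂ (inj₂ (inj₂ p))) =
    ∨⁺ʳ {d =ℕ 1} (∨⁺ʳ {d =ℕ (m ∸ 1)} (∨⁺ʳ {d =ℕ k} (⌊⌋⁺ {d = d ℕ.≟ (m ∸ k)} (trans p (sym m∸k)))))

  k<m : k < m
  k<m = ℕ.m<m+n k (s≤s z≤n)

  2k<m : 2 * k < m
  2k<m = ℕ.+-monoˡ-< (2 * k) {0} {k} (s≤s z≤n)

  step-pos : ∀ {d} → Step d → 0 < d
  step-pos (inj₁ refl) = s≤s z≤n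
  step-pos (inj₂ (inj₁ refl)) = ℕ.≤-trans (s≤s z≤n) (ℕ.m≤n+m (2 * k) k′)
  step-pos (inj₂ (inj₂ (inj₁ refl))) = s≤s z≤n
  step-pos (inj₂ (inj₂ (inj₂ refl))) = s≤s z≤n

  step<m : ∀ {d} → Step d → d < m
  step<m (inj₁ refl) = ℕ.≤-trans (s≤s (s≤s z≤n)) (ℕ.+-mono-≤ {1} {k} {1} {2 * k} (s≤s z≤n) (s≤s z≤n))
  step<m (inj₂ (inj₁ refl)) = ℕ.n<1+n _
  step<m (inj₂ (inj₂ (inj₁ refl))) = k<m
  step<m (inj₂ (inj₂ (inj₂ refl))) = 2k<m

  adjacent⁻ : ∀ {x y} → adj (CayZ3k k) x y ≡ true → ∃[ d ] Step d × toℕ y ≡ (toℕ x + d) % m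
  adjacent⁻ {x} {y} e = let (d , s , p) = Cay-adj⁻ {S = steps} {x} {y} e in d , steps⁻ s , p

  adjacent⁺ : ∀ {x y d} → Step d → toℕ y ≡ (toℕ x + d) % m → adj (CayZ3k k) x y ≡ true
  adjacent⁺ {x} {y} s p = Cay-adj⁺ {S = steps} {x} {y} (steps⁺ s) (step-pos s) (step<m s) p

  -- `δ` is the difference of `t` and `s` modulo 3; the last alternative is the wrap-around.
  third : ∀ (s t : Fin 3) → s ≢ t →
    ∃[ δ ] (δ ≡ 1 ⊎ δ ≡ 2) × (toℕ s + δ ≡ toℕ t ⊎ toℕ s + δ ≡ 3 + toℕ t)
  third 0F 0F h = contradiction refl h
  third 0F 1F h = 1 , inj₁ refl , inj₁ refl
  third 0F 2F h = 2 , inj₂ refl , inj₁ refl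
  third 1F 0F h = 2 , inj₂ refl , inj₂ refl
  third 1F 1F h = contradiction refl h
  third 1F 2F h = 1 , inj₁ refl , inj₁ refl
  third 2F 0F h = 1 , inj₁ refl , inj₂ refl
  third 2F 1F h = 2 , inj₂ refl , inj₂ refl
  third 2F 2F h = contradiction refl h

  coset-adjacent : ∀ {s t : Fin 3} e {x y} → s ≢ t →
    toℕ x ≡ (toℕ s * k + e) % m → toℕ y ≡ (toℕ t * k + e) % m → adj (CayZ3k k) x y ≡ true
  coset-adjacent {s} {t} e {x} {y} h p q with third s t h
  ... | δ , δ∈ , δ-sum = adjacent⁺ {x} {y} (step δ∈) (sym (trans (cong (λ z → (z + δ * k) % m) p)
          (trans (%-absorbˡ (toℕ s * k + e) (δ * k) m) (trans (cong (_% m) rearrange) (trans (wrap δ-sum) (sym q))))))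
    where
    step : δ ≡ 1 ⊎ δ ≡ 2 → Step (δ * k)
    step (inj₁ refl) = inj₂ (inj₂ (inj₁ (ℕ.+-identityʳ k)))
    step (inj₂ refl) = inj₂ (inj₂ (inj₂ refl))
    rearrange : toℕ s * k + e + δ * k ≡ (toℕ s + δ) * k + e
    rearrange = trans (ℕ.+-assoc (toℕ s * k) e (δ * k)) (trans (cong (toℕ s * k +_) (ℕ.+-comm e (δ * k)))
      (trans (sym (ℕ.+-assoc (toℕ s * k) (δ * k) e)) (cong (_+ e) (sym (ℕ.*-distribʳ-+ k (toℕ s) δ)))))
    wrap : toℕ s + δ ≡ toℕ t ⊎ toℕ s + δ ≡ 3 + toℕ t → ((toℕ s + δ) * k + e) % m ≡ (toℕ t * k + e) % m
    wrap (inj₁ r) = cong (λ z → (z * k + e) % m) r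
    wrap (inj₂ r) = trans (cong (λ z → (z * k + e) % m) r)
      (trans (cong (λ z → (z + e) % m) (trans (ℕ.*-distribʳ-+ k 3 (toℕ t)) (ℕ.+-comm m (toℕ t * k))))
        (trans (cong (_% m) (trans (ℕ.+-assoc (toℕ t * k) m e) (trans (cong (toℕ t * k +_) (ℕ.+-comm m e))
          (sym (ℕ.+-assoc (toℕ t * k) e m)))))
          (ℕ.[m+n]%n≡m%n (toℕ t * k + e) m)))

  multiple? : ∀ (a : Fin m) → Dec (∃[ t ] toℕ a ≡ (toℕ {3} t * k) % m)
  multiple? a = F.any? λ t → toℕ a ℕ.≟ (toℕ t * k) % m

  cosetClique : Subset m
  cosetClique = ⟪ multiple? ⟫

  -- A member of the clique plus `k` or `2k` has a factor below 6, and subtracting 3 at most once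
  -- makes it canonical.
  multiple : ∀ j {a : Fin m} → j < 6 → toℕ a ≡ (j * k) % m → a ∈ cosetClique
  multiple j {a} lt p with j ℕ.<? 3
  ... | yes lt′ = ∈⟪⟫⁺ multiple? (fromℕ< lt′ , trans p (cong (λ z → (z * k) % m) (sym (F.toℕ-fromℕ< lt′))))
  ... | no ge = ∈⟪⟫⁺ multiple? (fromℕ< j∸3<3 , trans p (trans (cong (λ z → (z * k) % m) (sym (ℕ.m∸n+n≡m (ℕ.≮⇒≥ ge))))
        (trans (cong (_% m) (ℕ.*-distribʳ-+ k (j ∸ 3) 3)) (trans (ℕ.[m+n]%n≡m%n ((j ∸ 3) * k) m)
          (cong (λ z → (z * k) % m) (sym (F.toℕ-fromℕ< j∸3<3)))))))
    where
    j∸3<3 : j ∸ 3 < 3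
    j∸3<3 = ℕ.∸-monoˡ-< lt (ℕ.≮⇒≥ ge)

  vertex : Fin 3 → Fin m
  vertex t = fromℕ< (ℕ.m%n<n (toℕ t * k) m)

  toℕ-vertex : ∀ t → toℕ (vertex t) ≡ (toℕ t * k) % m
  toℕ-vertex t = F.toℕ-fromℕ< (ℕ.m%n<n (toℕ t * k) m)

  -- The clique is the subgroup generated by `k`. Outer neighbours of its elements arise by adding 1
  -- or `m ∸ 1`; of three dominating vertices two use the same offset, so they lie in a common coset
  -- and are adjacent.
  coset-strong : Strong (CayZ3k k) cosetClique
  coset-strong = clique , avoid
    where
    clique : IsClique (CayZ3k k) cosetClique
    clique u v p q u≢v =
      let (s , e) = ∈⟪⟫⁻ multiple? p ; (t , e′) = ∈⟪⟫⁻ multiple? q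
      in coset-adjacent {s} {t} 0 {u} {v} (λ s≡t → u≢v (F.toℕ-injective (trans e (trans (cong (λ z → (toℕ z * k) % m) s≡t) (sym e′)))))
           (trans e (cong (_% m) (sym (ℕ.+-identityʳ (toℕ s * k)))))
           (trans e′ (cong (_% m) (sym (ℕ.+-identityʳ (toℕ t * k)))))
    offset : Bool → ℕ
    offset b = if b then 1 else m ∸ 1
    Beside : Fin 3 → Fin m → Set
    Beside t a = ∃[ b ] toℕ a ≡ (toℕ t * k + offset b) % m
    beside : ∀ t {a} → a ∉ cosetClique → ∃[ d ] Step d × toℕ a ≡ (toℕ (vertex t) + d) % m → Beside t a
    beside t {a} a∉ (d , s , e) =
      by s (trans e (trans (cong (λ z → (z + d) % m) (toℕ-vertex t)) (%-absorbˡ (toℕ t * k) d m)))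
      where
      by : ∀ {d} → Step d → toℕ a ≡ (toℕ t * k + d) % m → Beside t a
      by (inj₁ refl) q = true , q
      by (inj₂ (inj₁ refl)) q = false , q
      by (inj₂ (inj₂ (inj₁ refl))) q = contradiction (multiple (toℕ t + 1)
        (ℕ.+-mono-<-≤ (F.toℕ<n t) (s≤s z≤n)) (trans q (cong (_% m)
          (trans (cong (toℕ t * k +_) (sym (ℕ.+-identityʳ k))) (sym (ℕ.*-distribʳ-+ k (toℕ t) 1)))))) a∉
      by (inj₂ (inj₂ (inj₂ refl))) q = contradiction (multiple (toℕ t + 2)
        (ℕ.+-mono-<-≤ (F.toℕ<n t) (s≤s (s≤s z≤n))) (trans q (cong (_% m) (sym (ℕ.*-distribʳ-+ k (toℕ t) 2))))) a∉
    same-side : ∀ {s t a a′} → s ≢ t → ((b , _) : Beside s a) ((b′ , _) : Beside t a′) → b ≡ b′ →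
      adj (CayZ3k k) a a′ ≡ true
    same-side {s} {t} {a} {a′} s≢t (b , p) (_ , q) refl = coset-adjacent {s} {t} (offset b) {a} {a′} s≢t p q
    avoid : Unavoidable (CayZ3k k) cosetClique
    avoid I ind dom = collide (pigeonhole₃ λ t → proj₁ (proj₂ (proj₂ (dominator t))))
      where
      dominator : ∀ t → ∃[ a ] I a × Beside t a
      dominator t =
        let (a , a∈I , a∉ , t~a) = outside {CayZ3k k} ind dom (vertex t) (∈⟪⟫⁺ multiple? (t , toℕ-vertex t))
        in a , a∈I , beside t a∉ (adjacent⁻ {vertex t} {a} t~a)
      collide : ¬ (∃₂ λ s t → s F.< t × proj₁ (proj₂ (proj₂ (dominator s))) ≡ proj₁ (proj₂ (proj₂ (dominator t))))
      collide (s , t , s<t , e) = ind (proj₁ (proj₂ (dominator s))) (proj₁ (proj₂ (dominator t)))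
        (same-side (F.<⇒≢ s<t) (proj₂ (proj₂ (dominator s))) (proj₂ (proj₂ (dominator t))) e)

-- Size of a strong clique, mates and cross edges

module FourValent (G : Graph) (simple : IsSimple G) (regular : Regular 4 G) (vt : VertexTransitive G) where
  open Neighbourhoods G simple public
  open Degree4 regular public
  open StrongCliques G simple public
  open FixedEmbedding G simple regular public

  module _ (s : Symmetry G) where
    open Symmetry s

    g-~ : ∀ {u v} → u ~ v → g u ~ g v
    g-~ = trans (g-adj _ _)

    g-≁ : ∀ {u v} → u ≁ v → g u ≁ g v
    g-≁ = trans (g-adj _ _)

    g-Neighbours : ∀ {v ws} → Neighbours v ws → Neighbours (g v) (map g ws)
    g-Neighbours {v} {ws} N = neighbours
      (All.map⁺ (All.map g-~ (adjacent N))) (Unique.map⁺ g-injective (distinct N))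
      λ {x} p → subst (_∈ˡ map g ws) (gg⁻ x)
        (∈-map⁺ g (complete N (trans (sym (g-adj _ _)) (trans (cong (adj G _) (gg⁻ x)) p))))

  AllPairs-∈ : ∀ {R : V → V → Set} {xs} → Unique xs →
    (∀ {u v} → u ∈ˡ xs → v ∈ˡ xs → u ≢ v → R u v) → AllPairs R xs
  AllPairs-∈ [] h = []
  AllPairs-∈ (x∉ ∷ u) h =
    All.tabulate (λ y∈ → h (here refl) (there y∈) (All.lookup x∉ y∈))
    ∷ AllPairs-∈ u (λ p q → h (there p) (there q))

  independentList : ∀ {S} → AllPairs _≁_ S → IndependentList S
  independentList (p ∷ ps) (here refl) (here refl) = proj₂ simple _
  independentList (p ∷ ps) (here refl) (there v∈)  = All.lookup p v∈
  independentList (p ∷ ps) (there u∈)  (here refl) = trans (proj₁ simple _ _) (All.lookup p u∈)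
  independentList (p ∷ ps) (there u∈)  (there v∈)  = independentList ps u∈ v∈

  record StrongList (xs : List V) : Set where
    field
      unique  : Unique xs
      clique  : AllPairs _~_ xs
      blocked : ∀ S → AllPairs _≁_ S → ¬ All (λ c → Any (c ~_) S) xs

  members : Subset (n G) → List V
  members C = filter (_∈? C) (allFin (n G))

  members⁻ : ∀ {C v} → v ∈ˡ members C → v ∈ C
  members⁻ {C} p = proj₂ (∈-filter⁻ (_∈? C) {xs = allFin (n G)} p)

  members⁺ : ∀ {C v} → v ∈ C → v ∈ˡ members C
  members⁺ {C} {v} p = ∈-filter⁺ (_∈? C) (∈-allFin v) p

  strongList : ∀ {C} → IsStrongClique G C → StrongList (members C)
  strongList {C} strong = record
    { unique = u
    ; clique = AllPairs-∈ u λ p q → proj₁ strong _ _ (members⁻ p) (members⁻ q)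
    ; blocked = λ S ind dom → not-dominated strong S (independentList ind)
        λ c c∈ → All.lookup dom (members⁺ c∈) }
    where
    u : Unique (members C)
    u = Unique.filter⁺ (_∈? C) (Unique.allFin⁺ (n G))

  open StrongList

  strong-edge : ∀ {a b} → StrongList (a ∷ b ∷ []) → ∀ {x y} → a ~ x → b ~ y → x ~ y
  strong-edge s {x} {y} p q with x ~? y
  ... | yes r = r
  ... | no ¬r = contradiction (here p ∷ there (here q) ∷ [])
                  (blocked s (x ∷ y ∷ []) ((¬~⇒≁ ¬r ∷ []) ∷ [] ∷ []))

  strong-triangle : ∀ {a b c} → StrongList (a ∷ b ∷ c ∷ []) → Transversal a b c
  strong-triangle s x y z p q r with x ~? y | y ~? z | x ~? z
  ... | yes e | _ | _ = inj₁ e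
  ... | no _ | yes e | _ = inj₂ (inj₁ e)
  ... | no _ | no _ | yes e = inj₂ (inj₂ e)
  ... | no e | no e′ | no e″ = contradiction
          (here p ∷ there (here q) ∷ there (there (here r)) ∷ [])
          (blocked s (x ∷ y ∷ z ∷ []) ((¬~⇒≁ e ∷ ¬~⇒≁ e″ ∷ []) ∷ (¬~⇒≁ e′ ∷ []) ∷ [] ∷ []))

  strong-edge⇒K44 : ∀ {a b} → StrongList (a ∷ b ∷ []) → Embedding K44 G
  strong-edge⇒K44 {a} {b} s with clique s
  ... | (a~b ∷ []) ∷ _ with neighbours₁ a~b | neighbours₁ (~-sym a~b)
  ...   | p₁ , p₂ , p₃ , P@(neighbours (_ ∷ e₁ ∷ e₂ ∷ e₃ ∷ []) _ _)
        | q₁ , q₂ , q₃ , Q@(neighbours (_ ∷ f₁ ∷ f₂ ∷ f₃ ∷ []) _ _) =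
    embedding K44 (a ∷ q₁ ∷ q₂ ∷ q₃ ∷ b ∷ p₁ ∷ p₂ ∷ p₃ ∷ [])
      (nb 0 (4 ∷ 5 ∷ 6 ∷ 7 ∷ []) ∷ nb 4 (0 ∷ 1 ∷ 2 ∷ 3 ∷ [])
       ∷ cl (ad 5 1 ∷ []) ∷ cl (ad 5 2 ∷ []) ∷ cl (ad 5 3 ∷ [])
       ∷ cl (ad 6 1 ∷ []) ∷ cl (ad 6 2 ∷ []) ∷ cl (ad 6 3 ∷ [])
       ∷ cl (ad 7 1 ∷ []) ∷ cl (ad 7 2 ∷ []) ∷ cl (ad 7 3 ∷ []) ∷ [])
      refl
      (P , Q , strong-edge s e₁ f₁ , strong-edge s e₁ f₂ , strong-edge s e₁ f₃
             , strong-edge s e₂ f₁ , strong-edge s e₂ f₂ , strong-edge s e₂ f₃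
             , strong-edge s e₃ f₁ , strong-edge s e₃ f₂ , strong-edge s e₃ f₃ , tt)
      refl

  five-clique⇒K5 : ∀ {a b c d e} → AllPairs _~_ (a ∷ b ∷ c ∷ d ∷ e ∷ []) → Embedding (K 5) G
  five-clique⇒K5 {a} {b} {c} {d} {e}
    ((ab ∷ ac ∷ ad′ ∷ ae ∷ []) ∷ (bc ∷ bd ∷ be ∷ []) ∷ (cd ∷ ce ∷ []) ∷ (de ∷ []) ∷ _) =
    embedding (K 5) (a ∷ b ∷ c ∷ d ∷ e ∷ [])
      (cl (ad 0 1 ∷ []) ∷ cl (ad 0 2 ∷ []) ∷ cl (ad 0 3 ∷ []) ∷ cl (ad 0 4 ∷ [])
       ∷ cl (ad 1 2 ∷ []) ∷ cl (ad 1 3 ∷ []) ∷ cl (ad 1 4 ∷ [])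
       ∷ cl (ad 2 3 ∷ []) ∷ cl (ad 2 4 ∷ []) ∷ cl (ad 3 4 ∷ []) ∷ [])
      refl (ab , ac , ad′ , ae , bc , bd , be , cd , ce , de , tt) refl

  data Size (xs : List V) : Set where
    two   : ∀ {a b} → xs ≡ a ∷ b ∷ [] → Size xs
    three : ∀ {a b c} → xs ≡ a ∷ b ∷ c ∷ [] → Size xs
    four  : ∀ {a b c d} → xs ≡ a ∷ b ∷ c ∷ d ∷ [] → Size xs
    five  : ∀ {a b c d e} → xs ≡ a ∷ b ∷ c ∷ d ∷ e ∷ [] → Size xs

  -- The degree bounds the size by five. The empty list is dominated by the empty set, a single
  -- vertex by any one of its neighbours.
  size : ∀ {xs} → StrongList xs → Size xs
  size {[]} s = contradiction [] (blocked s [] [])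
  size {a ∷ []} s =
    let (x , _ , _ , _ , N) = neighbours₀ a
    in contradiction (here (All.head (adjacent N)) ∷ []) (blocked s (x ∷ []) ([] ∷ []))
  size {_ ∷ _ ∷ []} s = two refl
  size {_ ∷ _ ∷ _ ∷ []} s = three refl
  size {_ ∷ _ ∷ _ ∷ _ ∷ []} s = four refl
  size {_ ∷ _ ∷ _ ∷ _ ∷ _ ∷ []} s = five refl
  size {_ ∷ _ ∷ _ ∷ _ ∷ _ ∷ _ ∷ _} s =
    contradiction (AllPairs.head (clique s)) (no-five (AllPairs.tail (unique s)))

  Mate Cross : V → V → Set
  Mate u v = u ~ v × ∃[ z ] u ~ z × v ~ z
  Cross u v = u ~ v × ¬ (∃[ z ] u ~ z × v ~ z)

  common? : ∀ u v → Dec (∃[ z ] u ~ z × v ~ z)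
  common? u v = F.any? λ z → (u ~? z) ×-dec (v ~? z)

  mate? : ∀ u v → Dec (Mate u v)
  mate? u v = (u ~? v) ×-dec common? u v

  cross? : ∀ u v → Dec (Cross u v)
  cross? u v = (u ~? v) ×-dec ¬? (common? u v)

  Mate-sym : ∀ {u v} → Mate u v → Mate v u
  Mate-sym (p , z , q , r) = ~-sym p , z , r , q

  Cross-sym : ∀ {u v} → Cross u v → Cross v u
  Cross-sym (p , h) = ~-sym p , λ (z , q , r) → h (z , r , q)

  Mate⇒≢ : ∀ {u v} → Mate u v → u ≢ v
  Mate⇒≢ (p , _) = ~⇒≢ p

  Mate-Cross : ∀ {u v} → Mate u v → Cross u v → ⊥
  Mate-Cross (_ , c) (_ , h) = h c

  mate-or-cross : ∀ {u v} → u ~ v → Mate u v ⊎ Cross u v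
  mate-or-cross {u} {v} p with common? u v
  ... | yes c = inj₁ (p , c)
  ... | no h  = inj₂ (p , h)

  module _ (s : Symmetry G) where
    open Symmetry s

    g-Mate : ∀ {u v} → Mate u v → Mate (g u) (g v)
    g-Mate (p , z , q , r) = g-~ s p , g z , g-~ s q , g-~ s r

    g-Cross : ∀ {u v} → Cross u v → Cross (g u) (g v)
    g-Cross {u} {v} (p , h) = g-~ s p , λ (z , q , r) → h (g⁻ z
      , subst (_~ g⁻ z) (g⁻g u) (g-~ inverse q) , subst (_~ g⁻ z) (g⁻g v) (g-~ inverse r))

  Classmate : V → V → Set
  Classmate u v = u ≡ v ⊎ Mate u v

  classmate? : ∀ u v → Dec (Classmate u v)
  classmate? u v = (u F.≟ v) ⊎-dec mate? u v

  Classmate-sym : ∀ {u v} → Classmate u v → Classmate v u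
  Classmate-sym (inj₁ p) = inj₁ (sym p)
  Classmate-sym (inj₂ p) = inj₂ (Mate-sym p)

  Classmate⇒~ : ∀ {u v} → Classmate u v → u ≢ v → u ~ v
  Classmate⇒~ (inj₁ e) h = contradiction e h
  Classmate⇒~ (inj₂ p) h = proj₁ p

  module Transitive (Mate-trans : ∀ {u v w} → Mate u v → Mate v w → u ≢ w → Mate u w) where
    Classmate-trans : ∀ {u v w} → Classmate u v → Classmate v w → Classmate u w
    Classmate-trans (inj₁ refl) q = q
    Classmate-trans p@(inj₂ _) (inj₁ refl) = p
    Classmate-trans {u} {w = w} (inj₂ p) (inj₂ q) with u F.≟ w
    ... | yes e = inj₁ e
    ... | no e  = inj₂ (Mate-trans p q e)

    -- A symmetry carries the class of a to the class of any other vertex.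
    mates-localizable : ∀ {C a} → IsStrongClique G C →
      (∀ {v} → v ∈ C → Classmate a v) → (∀ {v} → Classmate a v → v ∈ C) → Localizable G
    mates-localizable {C} {a} strong C⇒ ⇒C = Partition.classes-localizable G classmate?
      (inj₁ refl) Classmate-sym Classmate-trans class-strong
      where
      class-strong : ∀ v → IsStrongClique G ⟪ classmate? v ⟫
      class-strong v with symmetry {G} vt a v
      ... | s , refl = Strong⇒IsStrongClique (clique′ , λ I ind dom →
              proj₂ image-strong I ind λ c c∈ → dom c (image⇒class c∈))
        where
        open Symmetry s
        image-strong : Strong G (image g-embedding C)
        image-strong = Strong-image g-embedding (IsStrongClique⇒Strong strong)
        image⇒class : ∀ {c} → c ∈ image g-embedding C → c ∈ ⟪ classmate? (g a) ⟫
        image⇒class p with image⁻ g-embedding p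
        ... | u , u∈ , refl = ∈⟪⟫⁺ (classmate? (g a)) (Sum.map (cong g) (g-Mate s) (C⇒ u∈))
        class⇒image : ∀ {c} → c ∈ ⟪ classmate? (g a) ⟫ → c ∈ image g-embedding C
        class⇒image {c} p = subst (_∈ image g-embedding C) (gg⁻ c) (image⁺ g-embedding (⇒C
          (Sum.map (λ e → trans (sym (g⁻g a)) (cong g⁻ e))
            (λ m → subst (λ x → Mate x (g⁻ c)) (g⁻g a) (g-Mate inverse m))
            (∈⟪⟫⁻ (classmate? (g a)) p))))
        clique′ : IsClique G ⟪ classmate? (g a) ⟫
        clique′ u v p q = proj₁ image-strong u v (class⇒image p) (class⇒image q)

  -- Strong 4-cliques

  K4 : V → V → V → V → Set
  K4 a b c d = (a ~ b × a ~ c × a ~ d) × (b ~ c × b ~ d × c ~ d)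

  module _ {a b c d : V} (K : K4 a b c d)
    (no-fifth : ∀ {x} → a ~ x → b ~ x → c ~ x → d ~ x → ⊥) where

    -- Transporting the clique to f forces a second neighbour.
    outer-two : ∀ {f} → Neighbours a (b ∷ c ∷ d ∷ f ∷ []) → b ~ f → c ~ f ⊎ d ~ f
    outer-two {f} N@(neighbours (_ ∷ _ ∷ _ ∷ af ∷ []) _ _) bf with symmetry {G} vt a f
    ... | s , refl =
      let ((ab , ac , ad′) , bc , bd , cd) = K
      in by-search (a ∷ b ∷ c ∷ d ∷ f ∷ g b ∷ g c ∷ g d ∷ g f ∷ [])
        (nb 0 (1 ∷ 2 ∷ 3 ∷ 4 ∷ []) ∷ nb 4 (5 ∷ 6 ∷ 7 ∷ 8 ∷ [])
         ∷ cl (ad 5 6 ∷ []) ∷ cl (ad 5 7 ∷ []) ∷ cl (ad 6 7 ∷ []) ∷ cl (ad 1 4 ∷ [])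
         ∷ nb 1 (0 ∷ 2 ∷ 3 ∷ 4 ∷ []) ∷ [])
        ((ad 2 4 ∷ ad 3 4 ∷ []) ∷ [])
        (N , g-Neighbours s N , g-~ s bc , g-~ s bd , g-~ s cd , bf
          , neighbours₄ (~-sym ab ∷ bc ∷ bd ∷ bf ∷ [])
              ((~⇒≢ ac ∷ ~⇒≢ ad′ ∷ ~⇒≢ af ∷ []) ∷ AllPairs.tail (distinct N)) , tt) refl
      where open Symmetry s

    -- All neighbours of `a`, `b`, `c` are now named, so the fourth neighbour `e` of `d` is adjacent
    -- to none of them. It is isolated in the neighbourhood of `d`, whereas the neighbourhood of `a`
    -- has no isolated vertex.
    outer-three : ∀ {f} → Neighbours a (b ∷ c ∷ d ∷ f ∷ []) → b ~ f → c ~ f → d ≁ f → ⊥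
    outer-three {f} N@(neighbours (_ ∷ _ ∷ _ ∷ af ∷ []) (_ ∷ _ ∷ (d≢f ∷ []) ∷ _) _) bf cf df with symmetry {G} vt a d
    ... | s , refl =
      let ((ab , ac , ad′) , bc , bd , cd) = K
          (e , D) = neighbours₃ (~-sym ad′) (~-sym bd) (~-sym cd) (~⇒≢ ab) (~⇒≢ ac) (~⇒≢ bc)
      in by-search (a ∷ b ∷ c ∷ d ∷ f ∷ g b ∷ g c ∷ g d ∷ g f ∷ e ∷ [])
        (nb 0 (1 ∷ 2 ∷ 3 ∷ 4 ∷ []) ∷ nb 3 (5 ∷ 6 ∷ 7 ∷ 8 ∷ []) ∷ nb 3 (0 ∷ 1 ∷ 2 ∷ 9 ∷ [])
         ∷ cl (ad 5 6 ∷ []) ∷ cl (ad 5 7 ∷ []) ∷ cl (ad 6 7 ∷ []) ∷ cl (ad 5 8 ∷ []) ∷ cl (ad 6 8 ∷ [])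
         ∷ nb 1 (0 ∷ 2 ∷ 3 ∷ 4 ∷ []) ∷ nb 2 (0 ∷ 1 ∷ 3 ∷ 4 ∷ []) ∷ cl (na 3 4 ∷ []) ∷ [])
        ([] ∷ [])
        (N , g-Neighbours s N , D , g-~ s bc , g-~ s bd , g-~ s cd , g-~ s bf , g-~ s cf
          , neighbours₄ (~-sym ab ∷ bc ∷ bd ∷ bf ∷ [])
              ((~⇒≢ ac ∷ ~⇒≢ ad′ ∷ ~⇒≢ af ∷ []) ∷ AllPairs.tail (distinct N))
          , neighbours₄ (~-sym ac ∷ ~-sym bc ∷ cd ∷ cf ∷ [])
              ((~⇒≢ ab ∷ ~⇒≢ ad′ ∷ ~⇒≢ af ∷ []) ∷ (~⇒≢ bd ∷ ~⇒≢ bf ∷ []) ∷ (d≢f ∷ []) ∷ [] ∷ [])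
          , df , tt) refl
      where open Symmetry s

  module _ {a b c d : V} (K : K4 a b c d)
    (no-fifth : ∀ {x} → a ~ x → b ~ x → c ~ x → d ~ x → ⊥) where

    outer-apart : ∀ {f} → Neighbours a (b ∷ c ∷ d ∷ f ∷ []) → b ≁ f
    outer-apart {f} N@(neighbours (_ ∷ _ ∷ _ ∷ af ∷ []) _ _) = ¬~⇒≁ λ bf →
      case (c ~? f) , (d ~? f) of λ
        { (yes cf , yes df) → no-fifth af bf cf df
        ; (yes cf , no ¬df) → outer-three K no-fifth N bf cf (¬~⇒≁ ¬df)
        ; (no ¬cf , _) → [ ¬cf , (λ df → swapped bf df (¬~⇒≁ ¬cf)) ]′ (outer-two K no-fifth N bf) }
      where
      swapped : b ~ f → d ~ f → c ≁ f → ⊥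
      swapped = let ((ab , ac , ad′) , bc , bd , cd) = K in
        outer-three ((ab , ad′ , ac) , bd , bc , ~-sym cd) (λ p q r s → no-fifth p q s r)
          (reorder (prep b (swap c d ↭-refl)) N)

  record OuterPattern (v : V) : Set where
    field
      {b c d f} : V
      around : Neighbours v (b ∷ c ∷ d ∷ f ∷ [])
      bc     : b ~ c
      bd     : b ~ d
      cd     : c ~ d
      bf     : b ≁ f
      cf     : c ≁ f
      df     : d ≁ f

  g-OuterPattern : (s : Symmetry G) → ∀ {v} → OuterPattern v → OuterPattern (Symmetry.g s v)
  g-OuterPattern s P = record
    { around = g-Neighbours s around ; bc = g-~ s bc ; bd = g-~ s bd ; cd = g-~ s cd
    ; bf = g-≁ s bf ; cf = g-≁ s cf ; df = g-≁ s df }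
    where open OuterPattern P

  outerPattern : ∀ {a b c d} → K4 a b c d → (∀ {x} → a ~ x → b ~ x → c ~ x → d ~ x → ⊥) →
    ∀ v → OuterPattern v
  outerPattern {a} {b} {c} {d} K@((ab , ac , ad′) , bc , bd , cd) no-fifth v
    with symmetry {G} vt a v | neighbours₃ ab ac ad′ (~⇒≢ bc) (~⇒≢ bd) (~⇒≢ cd)
  ... | s , refl | f , N = g-OuterPattern s record
    { around = N ; bc = bc ; bd = bd ; cd = cd
    ; bf = outer-apart K no-fifth N
    ; cf = outer-apart ((ac , ab , ad′) , ~-sym bc , cd , bd) (λ p q r s → no-fifth p r q s)
             (reorder (swap b c ↭-refl) N)
    ; df = outer-apart ((ad′ , ab , ac) , ~-sym bd , ~-sym cd , bc) (λ p q r s → no-fifth p r s q)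
             (reorder (↭-trans (prep b (swap c d ↭-refl)) (swap b d ↭-refl)) N) }

  pairwise : ∀ {R : V → V → Set} → (∀ {u v} → R u v → R v u) → ∀ {xs} → AllPairs R xs →
    ∀ {u v} → u ∈ˡ xs → v ∈ˡ xs → u ≢ v → R u v
  pairwise s (p ∷ ps) (here refl) (here refl) h = contradiction refl h
  pairwise s (p ∷ ps) (here refl) (there v∈)  h = All.lookup p v∈
  pairwise s (p ∷ ps) (there u∈)  (here refl) h = s (All.lookup p u∈)
  pairwise s (p ∷ ps) (there u∈)  (there v∈)  h = pairwise s ps u∈ v∈ h

  module Outer (patterns : ∀ v → OuterPattern v) where
    module P v = OuterPattern (patterns v)

    f : V → V
    f v = P.f v

    mates : V → List V
    mates v = P.b v ∷ P.c v ∷ P.d v ∷ []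

    mates-clique : ∀ v → AllPairs _~_ (mates v)
    mates-clique v = (P.bc v ∷ P.bd v ∷ []) ∷ (P.cd v ∷ []) ∷ [] ∷ []

    f-cross : ∀ v → Cross v (f v)
    f-cross v with P.around v | P.bf v | P.cf v | P.df v
    ... | N@(neighbours (_ ∷ _ ∷ _ ∷ vf ∷ []) _ _) | bf | cf | df = vf , λ (z , vz , fz) →
      case complete N vz of λ
        { (here refl)                         → ≁⇒¬~ bf (~-sym fz)
        ; (there (here refl))                 → ≁⇒¬~ cf (~-sym fz)
        ; (there (there (here refl)))         → ≁⇒¬~ df (~-sym fz)
        ; (there (there (there (here refl)))) → ~⇒≢ fz refl }

    mates⁺ : ∀ {v x} → x ∈ˡ mates v → Mate v x
    mates⁺ {v} p with adjacent (P.around v) | p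
    ... | vb ∷ vc ∷ vd ∷ _ ∷ [] | here refl                 = vb , P.c v , vc , P.bc v
    ... | vb ∷ vc ∷ vd ∷ _ ∷ [] | there (here refl)         = vc , P.b v , vb , ~-sym (P.bc v)
    ... | vb ∷ vc ∷ vd ∷ _ ∷ [] | there (there (here refl)) = vd , P.b v , vb , ~-sym (P.bd v)

    mates⁻ : ∀ {v x} → Mate v x → x ∈ˡ mates v
    mates⁻ {v} m@(vx , _) with complete (P.around v) vx
    ... | here p                         = here p
    ... | there (here p)                 = there (here p)
    ... | there (there (here p))         = there (there (here p))
    ... | there (there (there (here refl))) = contradiction (f-cross v) (Mate-Cross m)

    f-unique : ∀ {v x} → Cross v x → x ≡ f v
    f-unique {v} c@(vx , _) with complete (P.around v) vx
    ... | here p                         = contradiction c (Mate-Cross (mates⁺ (here p)))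
    ... | there (here p)                 = contradiction c (Mate-Cross (mates⁺ (there (here p))))
    ... | there (there (here p))         = contradiction c (Mate-Cross (mates⁺ (there (there (here p)))))
    ... | there (there (there (here p))) = p

    f-f : ∀ v → f (f v) ≡ v
    f-f v = sym (f-unique (Cross-sym (f-cross v)))

    f-injective : ∀ {u v} → f u ≡ f v → u ≡ v
    f-injective p = trans (sym (f-f _)) (trans (cong f p) (f-f _))

    mate : ∀ {u v} → u ~ v → v ≢ f u → Mate u v
    mate p h = [ id , (λ c → contradiction (f-unique c) h) ]′ (mate-or-cross p)

    Mate-trans : ∀ {u v w} → Mate u v → Mate v w → u ≢ w → Mate u w
    Mate-trans {v = v} p q h =
      pairwise ~-sym (mates-clique v) (mates⁻ (Mate-sym p)) (mates⁻ q) h , v , proj₁ p , ~-sym (proj₁ q)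

    open Transitive Mate-trans public

    g-f : (s : Symmetry G) → ∀ v → f (Symmetry.g s v) ≡ Symmetry.g s (f v)
    g-f s v = sym (f-unique (g-Cross s (f-cross v)))

    -- An edge of a 4-clique that is doubled by an edge between the outer neighbours of its ends.
    Partner : V → V → Set
    Partner v x = Mate v x × f v ~ f x

    partner? : ∀ v x → Dec (Partner v x)
    partner? v x = mate? v x ×-dec (f v ~? f x)

    Partner-sym : ∀ {v x} → Partner v x → Partner x v
    Partner-sym (p , q) = Mate-sym p , ~-sym q

    g-Partner : (s : Symmetry G) → ∀ {v x} → Partner v x → Partner (Symmetry.g s v) (Symmetry.g s x)
    g-Partner s (p , q) = g-Mate s p , subst₂ _~_ (sym (g-f s _)) (sym (g-f s _)) (g-~ s q)

    -- Otherwise the outer neighbours of the clique form an independent set dominating it.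
    partner-in : ∀ {xs} → StrongList xs → (∀ {u v} → u ∈ˡ xs → v ∈ˡ xs → u ≢ v → Mate u v) →
      ∃₂ Partner
    partner-in {xs} s mates with F.any? (λ u → F.any? (λ v → partner? u v))
    ... | yes p = p
    ... | no none = contradiction (All.tabulate λ {x} x∈ →
            Any.map⁺ (Any.map (λ { refl → proj₁ (f-cross x) }) x∈))
            (StrongList.blocked s (map f xs) (AllPairs.map⁺ (AllPairs-∈ (StrongList.unique s)
              λ {u} {v} p q h → ¬~⇒≁ λ e → none (u , v , mates p q h , e))))

    Partner-f : ∀ {v x} → Partner v x → Partner (f v) (f x)
    Partner-f {v} {x} (p , q) =
      mate q (λ e → Mate-Cross p (subst (Cross v) (sym (f-injective e)) (f-cross v)))
      , subst₂ _~_ (sym (f-f v)) (sym (f-f x)) (proj₁ p)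

    -- Two partners put `f x` and `f y` into the clique of `f a`. The remaining vertex `z` has a
    -- partner among `a`, `x`, `y`, which brings `f z` there too: two 4-cliques joined by a perfect
    -- matching.
    two-partners⇒H2 : (∀ v → ∃[ x ] Partner v x) → ∀ {a x y} → x ≢ y → Partner a x → Partner a y →
      Embedding (H 2) G
    two-partners⇒H2 partner {a} {x} {y} x≢y ax@(amx , fafx) ay@(amy , fafy)
      with neighbours₃ (proj₁ amx) (proj₁ amy) (proj₁ (f-cross a)) x≢y
             (λ { refl → Mate-Cross amx (f-cross a) }) (λ { refl → Mate-Cross amy (f-cross a) })
    ... | z , N@(neighbours (ax′ ∷ ay′ ∷ af ∷ az ∷ []) ((_ ∷ _ ∷ xz ∷ []) ∷ (_ ∷ yz ∷ []) ∷ (fz ∷ []) ∷ _) _) =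
      -- Each clique is listed in the order x, y, z, w of `H 2`: the last two vertices of either one
      -- are matched to the first two of the other.
      embedding (H 2) (a ∷ x ∷ y ∷ z ∷ f y ∷ f z ∷ f a ∷ f x ∷ [])
        (nb 0 (1 ∷ 2 ∷ 6 ∷ 3 ∷ [])
         ∷ cl (ad 1 2 ∷ []) ∷ cl (ad 1 3 ∷ []) ∷ cl (ad 2 3 ∷ [])
         ∷ cl (ad 1 7 ∷ []) ∷ cl (ad 2 4 ∷ []) ∷ cl (ad 3 5 ∷ [])
         ∷ cl (ad 6 7 ∷ []) ∷ cl (ad 4 6 ∷ []) ∷ cl (ad 5 6 ∷ [])
         ∷ cl (ad 4 7 ∷ []) ∷ cl (ad 5 7 ∷ []) ∷ cl (ad 4 5 ∷ [])
         ∷ cl (ne 1 4 ∷ []) ∷ cl (ne 1 5 ∷ []) ∷ cl (ne 2 5 ∷ []) ∷ cl (ne 2 7 ∷ []) ∷ cl (ne 3 4 ∷ [])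
         ∷ cl (ne 3 7 ∷ []) ∷ cl (ne 0 4 ∷ []) ∷ cl (ne 0 5 ∷ []) ∷ cl (ne 0 7 ∷ []) ∷ [])
        refl
        ( N , proj₁ mxy , proj₁ mxz , proj₁ myz
        , proj₁ (f-cross x) , proj₁ (f-cross y) , proj₁ (f-cross z)
        , fafx , ~-sym fafy , ~-sym fafz
        , fadj y x (inj₂ amy) (inj₂ amx) (x≢y ∘ sym) , fadj z x (inj₂ amz) (inj₂ amx) (xz ∘ sym)
        , fadj y z (inj₂ amy) (inj₂ amz) yz
        , apart mxy , apart mxz , apart myz , apart (Mate-sym mxy) , apart (Mate-sym myz)
        , apart (Mate-sym mxz) , apart amy , apart amz , apart amx , tt)
        refl
      where
      amz : Mate a z
      amz = mate az (fz ∘ sym)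
      mxy : Mate x y
      mxy = Mate-trans (Mate-sym amx) amy x≢y
      mxz : Mate x z
      mxz = Mate-trans (Mate-sym amx) amz xz
      myz : Mate y z
      myz = Mate-trans (Mate-sym amy) amz yz
      apart : ∀ {u v} → Mate u v → u ≢ f v
      apart m refl = Mate-Cross (Mate-sym m) (f-cross _)
      class-f : ∀ {u} → Classmate a u → u ≢ z → Classmate (f a) (f u)
      class-f (inj₁ refl) _ = inj₁ refl
      class-f (inj₂ m) h with complete N (proj₁ m)
      ... | here refl                         = inj₂ (proj₁ (Partner-f ax))
      ... | there (here refl)                 = inj₂ (proj₁ (Partner-f ay))
      ... | there (there (here refl))         = contradiction (f-cross a) (Mate-Cross m)
      ... | there (there (there (here refl))) = contradiction refl h
      class-fz : Classmate (f a) (f z)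
      class-fz = let (u , mzu , q) = partner z
        in Classmate-trans (class-f (Classmate-trans (inj₂ amz) (inj₂ mzu)) (Mate⇒≢ mzu ∘ sym))
             (inj₂ (proj₁ (Partner-f (Partner-sym (mzu , q)))))
      class-f′ : ∀ {u} → Classmate a u → Classmate (f a) (f u)
      class-f′ {u} c with u F.≟ z
      ... | yes refl = class-fz
      ... | no h = class-f c h
      fadj : ∀ u v → Classmate a u → Classmate a v → u ≢ v → f u ~ f v
      fadj u v p q h with Classmate-trans (Classmate-sym (class-f′ p)) (class-f′ q)
      ... | inj₁ e = contradiction (f-injective e) h
      ... | inj₂ m = proj₁ m
      fafz : f a ~ f z
      fafz = fadj a z (inj₁ refl) (inj₂ amz) (~⇒≢ az)

    module _ (partner : ∀ v → ∃[ x ] Partner v x)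
             (unique-partner : ∀ {v x y} → Partner v x → Partner v y → x ≡ y) where
      m : V → V
      m v = proj₁ (partner v)

      m-mate : ∀ v → Mate v (m v)
      m-mate v = proj₁ (proj₂ (partner v))

      m-unique : ∀ {v x} → Partner v x → x ≡ m v
      m-unique p = unique-partner p (proj₂ (partner _))

      m-m : ∀ v → m (m v) ≡ v
      m-m v = sym (m-unique (Partner-sym (proj₂ (partner v))))

      m-f : ∀ v → m (f v) ≡ f (m v)
      m-f v = sym (m-unique (Partner-f (proj₂ (partner v))))

      -- The partner relation cuts a 4-clique into two halves. Which vertex of the other half is
      -- taken is arbitrary, so `o` respects structure only up to `_≈_`.
      opposite : ∀ v → ∃[ x ] Mate v x × x ≢ m v
      opposite v with P.b v F.≟ m v
      ... | no h = P.b v , mates⁺ (here refl) , h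
      ... | yes e = P.c v , mates⁺ (there (here refl)) , λ e′ → ~⇒≢ (P.bc v) (trans e (sym e′))

      o : V → V
      o v = proj₁ (opposite v)

      o-mate : ∀ v → Mate v (o v)
      o-mate v = proj₁ (proj₂ (opposite v))

      o≢m : ∀ v → o v ≢ m v
      o≢m v = proj₂ (proj₂ (opposite v))

      mo≢ : ∀ v → m (o v) ≢ v
      mo≢ v e = o≢m v (trans (sym (m-m (o v))) (cong m e))

      mo≢m : ∀ v → m (o v) ≢ m v
      mo≢m v e = Mate⇒≢ (o-mate v) (trans (sym (m-m v)) (trans (cong m (sym e)) (m-m (o v))))

      mo-mate : ∀ v → Mate v (m (o v))
      mo-mate v = Mate-trans (o-mate v) (m-mate (o v)) (mo≢ v ∘ sym)

      mates-are : ∀ {v x} → Mate v x → x ≡ m v ⊎ x ≡ o v ⊎ x ≡ m (o v)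
      mates-are {v} {x} p with extend {v} {m v ∷ o v ∷ m (o v) ∷ f v ∷ []}
          ((o≢m v ∘ sym ∷ mo≢m v ∘ sym ∷ apart (m-mate v) ∷ [])
           ∷ (Mate⇒≢ (m-mate (o v)) ∷ apart (o-mate v) ∷ []) ∷ (apart (mo-mate v) ∷ []) ∷ [] ∷ [])
          (proj₁ (m-mate v) ∷ proj₁ (o-mate v) ∷ proj₁ (mo-mate v) ∷ proj₁ (f-cross v) ∷ [])
        where
        apart : ∀ {x} → Mate v x → x ≢ f v
        apart q refl = Mate-Cross q (f-cross v)
      ... | [] , N , _ with complete N (proj₁ p)
      ...   | here q                         = inj₁ q
      ...   | there (here q)                 = inj₂ (inj₁ q)
      ...   | there (there (here q))         = inj₂ (inj₂ q)
      ...   | there (there (there (here refl))) = contradiction (f-cross v) (Mate-Cross p)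

      infix 4 _≈_
      _≈_ : V → V → Set
      u ≈ v = v ≡ u ⊎ v ≡ m u

      ≈-sym : ∀ {u v} → u ≈ v → v ≈ u
      ≈-sym (inj₁ refl) = inj₁ refl
      ≈-sym (inj₂ refl) = inj₂ (sym (m-m _))

      ≈-trans : ∀ {u v w} → u ≈ v → v ≈ w → u ≈ w
      ≈-trans (inj₁ refl) q = q
      ≈-trans (inj₂ refl) (inj₁ refl) = inj₂ refl
      ≈-trans (inj₂ refl) (inj₂ refl) = inj₁ (m-m _)

      ≈⇒Classmate : ∀ {u v} → u ≈ v → Classmate u v
      ≈⇒Classmate (inj₁ refl) = inj₁ refl
      ≈⇒Classmate (inj₂ refl) = inj₂ (m-mate _)

      class-halves : ∀ {u v} → Classmate u v → v ≈ u ⊎ v ≈ o u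
      class-halves (inj₁ refl) = inj₁ (inj₁ refl)
      class-halves (inj₂ p) with mates-are p
      ... | inj₁ refl        = inj₁ (inj₂ (sym (m-m _)))
      ... | inj₂ (inj₁ refl) = inj₂ (inj₁ refl)
      ... | inj₂ (inj₂ refl) = inj₂ (inj₂ (sym (m-m _)))

      o-o : ∀ v → o (o v) ≈ v
      o-o v with mates-are (Mate-sym (o-mate v))
      ... | inj₁ e        = contradiction (sym e) (mo≢ v)
      ... | inj₂ (inj₁ e) = inj₁ e
      ... | inj₂ (inj₂ e) = inj₂ e

      o-m : ∀ v → o v ≈ o (m v)
      o-m v with mates-are {v} {o (m v)} (Mate-trans (m-mate v) (o-mate (m v))
                   (λ e → o≢m (m v) (trans (sym e) (sym (m-m v)))))
      ... | inj₁ e        = contradiction e (Mate⇒≢ (o-mate (m v)) ∘ sym)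
      ... | inj₂ (inj₁ e) = inj₁ e
      ... | inj₂ (inj₂ e) = inj₂ e

      o-cong : ∀ {u v} → u ≈ v → o u ≈ o v
      o-cong (inj₁ refl) = inj₁ refl
      o-cong (inj₂ refl) = o-m _

      f-cong : ∀ {u v} → u ≈ v → f u ≈ f v
      f-cong (inj₁ refl) = inj₁ refl
      f-cong (inj₂ refl) = inj₂ (sym (m-f _))

      v≉ov : ∀ v → ¬ v ≈ o v
      v≉ov v (inj₁ e) = Mate⇒≢ (o-mate v) (sym e)
      v≉ov v (inj₂ e) = o≢m v e

      v≉fv : ∀ v → ¬ v ≈ f v
      v≉fv v (inj₁ e) = ~⇒≢ (proj₁ (f-cross v)) (sym e)
      v≉fv v (inj₂ e) = Mate-Cross (m-mate v) (subst (Cross v) e (f-cross v))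

      -- A vertex up to `m` is a half clique about to be left through `f`. The step `o ∘ f` crosses
      -- over and passes to the far half of the next clique; `o` turns round inside a clique.
      open Darts {V} {_≈_} (inj₁ refl) ≈-sym ≈-trans (o ∘ f) o (o-cong ∘ f-cong) o-cong o-o
        (λ s → o-cong (≈-trans (f-cong (o-o (f s))) (inj₁ (sym (f-f s)))))
      open Oriented v≉ov (λ s e → v≉fv s (≈-sym (≈-trans (≈-sym (o-o (f s))) (≈-trans (o-cong e) (o-o s)))))

      ladderPeriod : ∀ v → Period v
      ladderPeriod = period (λ u v → (v F.≟ u) ⊎-dec (v F.≟ m u)) id (inj₁ ∘ sym)

      module _ (v₀ : V) (v₀-period : Period v₀) where
        open Period v₀-period renaming (pred to k; distinct to distinct-darts)

        z : ℕ → V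
        z i = S^ i v₀

        -- The walk returns to `v₀` only up to `m`. Taking `f (z k)` as entry of the first clique,
        -- in place of `o v₀`, makes the closing link exact and absorbs a possible interchange.
        x : ℕ → V
        x zero    = f (z k)
        x (suc i) = f (z i)

        x≈oz : ∀ i → x i ≈ o (z i)
        x≈oz zero    = ≈-trans (≈-sym (o-o _)) (o-cong returns)
        x≈oz (suc i) = ≈-sym (o-o (f (z i)))

        corners : Fin (suc k) → List V
        corners i = x (toℕ i) ∷ m (x (toℕ i)) ∷ z (toℕ i) ∷ m (z (toℕ i)) ∷ []

        corner : Fin (suc k) × Fin 4 → V
        corner (i , t) = L.lookup (corners i) t

        x-class : ∀ i → Classmate (z i) (x i)
        x-class i = Classmate-trans (inj₂ (o-mate (z i))) (≈⇒Classmate (≈-sym (x≈oz i)))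

        corner-class : ∀ p → Classmate (z (toℕ (proj₁ p))) (corner p)
        corner-class (i , 0F) = x-class (toℕ i)
        corner-class (i , 1F) = Classmate-trans (x-class (toℕ i)) (inj₂ (m-mate _))
        corner-class (i , 2F) = inj₁ refl
        corner-class (i , 3F) = inj₂ (m-mate _)

        x≉z : ∀ i → ¬ x i ≈ z i
        x≉z i e = v≉ov (z i) (≈-trans (≈-sym e) (x≈oz i))

        corners-distinct : ∀ i → Unique (corners i)
        corners-distinct i =
          (Mate⇒≢ (m-mate _) ∷ (λ e → x≉z (toℕ i) (inj₁ (sym e))) ∷ (λ e → x≉z (toℕ i) (≈-sym (inj₂ e))) ∷ [])
          ∷ ((λ e → x≉z (toℕ i) (inj₂ (sym e)))
             ∷ (λ e → x≉z (toℕ i) (inj₁ (trans (sym (m-m _)) (trans (cong m (sym e)) (m-m _))))) ∷ [])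
          ∷ (Mate⇒≢ (m-mate _) ∷ []) ∷ [] ∷ []

        z-injective : ∀ i j → i ≤ k → j ≤ k → z j ≈ z i → i ≡ j
        z-injective i j i≤k j≤k e = compare (ℕ.<-cmp i j)
          where
          compare : Tri (i < j) (i ≡ j) (j < i) → i ≡ j
          compare (tri< lt _ _) = contradiction (≈-sym e) (distinct-darts lt j≤k)
          compare (tri≈ _ p _)  = p
          compare (tri> _ _ gt) = contradiction e (distinct-darts gt i≤k)

        -- Classmates lie in the same half or in opposite halves; the second would mean that the
        -- walk meets its own reversal.
        same-class⇒≡ : ∀ i j → i ≤ k → j ≤ k → Classmate (z i) (z j) → i ≡ j
        same-class⇒≡ i j i≤k j≤k c =
          [ z-injective i j i≤k j≤k , (λ e → contradiction e (no-reverse j i v₀)) ]′ (class-halves c)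

        corner-injective : ∀ {p q} → corner p ≡ corner q → p ≡ q
        corner-injective {i , s} {j , t} e = slot (F.toℕ-injective
          (same-class⇒≡ (toℕ i) (toℕ j) (F.toℕ≤pred[n] i) (F.toℕ≤pred[n] j)
            (Classmate-trans (corner-class (i , s))
              (Classmate-sym (subst (Classmate (z (toℕ j))) (sym e) (corner-class (j , t))))))) e
          where
          slot : ∀ {i j s t} → i ≡ j → corner (i , s) ≡ corner (j , t) → (i , s) ≡ (j , t)
          slot {i} {s = s} {t} refl e = cong (i ,_) (lookup-injective (corners-distinct i) s t e)

        x-next : ∀ {i j : Fin (suc k)} → Next i j → x (toℕ j) ≡ f (z (toℕ i))
        x-next {i} {j} p =
          [ (λ (e , _) → cong x e) , (λ (e , e′) → trans (cong x e) (cong (λ l → f (z l)) (sym e′))) ]′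
            (mod-cases (F.toℕ≤pred[n] i) p)

        link : ∀ p q → HLink p q → f (corner p) ≡ corner q
        link (i , _) (j , _) (nx , inj₁ (refl , refl)) = sym (x-next nx)
        link (i , _) (j , _) (nx , inj₂ (refl , refl)) = trans (sym (m-f _)) (cong m (sym (x-next nx)))

        corner-preserves : ∀ p q → HAdj p q → corner p ~ corner q
        corner-preserves (i , s) (_ , t) (inj₁ (refl , h)) = Classmate⇒~
          (Classmate-trans (Classmate-sym (corner-class (i , s))) (corner-class (i , t)))
          (λ e → h (lookup-injective (corners-distinct i) s t e))
        corner-preserves p q (inj₂ (inj₁ l)) = subst (corner p ~_) (link p q l) (proj₁ (f-cross (corner p)))
        corner-preserves p q (inj₂ (inj₂ l)) = ~-sym (subst (corner q ~_) (link q p l) (proj₁ (f-cross (corner q))))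

        linked : ∀ (p : Fin (suc k) × Fin 4) → ∃[ q ] (HLink p q ⊎ HLink q p)
        linked (i , 0F) = let (j , e) = prev i in (j , 2F) , inj₂ (e , inj₁ (refl , refl))
        linked (i , 1F) = let (j , e) = prev i in (j , 3F) , inj₂ (e , inj₂ (refl , refl))
        linked (i , 2F) = let (j , e) = next i in (j , 0F) , inj₁ (e , inj₁ (refl , refl))
        linked (i , 3F) = let (j , e) = next i in (j , 1F) , inj₁ (e , inj₂ (refl , refl))

        class-corner : ∀ i {w} → Classmate (z (toℕ i)) w → ∃[ t ] corner (i , t) ≡ w
        class-corner i {w} c = [ upper , (λ e → lower (≈-trans e (≈-sym (x≈oz (toℕ i))))) ]′ (class-halves c)
          where
          upper : w ≈ z (toℕ i) → ∃[ t ] corner (i , t) ≡ w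
          upper (inj₁ e) = 2F , e
          upper (inj₂ e) = 3F , trans (cong m e) (m-m _)
          lower : w ≈ x (toℕ i) → ∃[ t ] corner (i , t) ≡ w
          lower (inj₁ e) = 0F , e
          lower (inj₂ e) = 1F , trans (cong m e) (m-m _)

        Lift : Fin (suc k) × Fin 4 → V → Set
        Lift p w = ∃[ q ] corner q ≡ w × HAdj p q

        corner-lifts : ∀ p {w} → corner p ~ w → Lift p w
        corner-lifts p@(i , s) {w} a = [ inside , across (linked p) ]′ (mate-or-cross a)
          where
          inside : Mate (corner p) w → Lift p w
          inside c =
            let (t , e) = class-corner i (Classmate-trans (corner-class p) (inj₂ c))
            in (i , t) , e , inj₁ (refl , λ s≡t → Mate⇒≢ c (trans (cong (λ r → corner (i , r)) s≡t) e))
          across : ∃[ q ] (HLink p q ⊎ HLink q p) → Cross (corner p) w → Lift p w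
          across (q , inj₁ l) c = q , trans (sym (link p q l)) (sym (f-unique c)) , inj₂ (inj₁ l)
          across (q , inj₂ l) c =
            q , trans (sym (f-f _)) (trans (cong f (link q p l)) (sym (f-unique c))) , inj₂ (inj₂ l)

        ladderEmbedding : Embedding (H (suc k)) G
        ladderEmbedding = record
          { f = corner ∘ remQuot {suc k} 4
          ; injective = remQuot-injective {suc k} 4 ∘ corner-injective
          ; preserves = λ {u} {v} e → corner-preserves _ _ (H-adj⁻ {suc k} {u} {v} e)
          ; lifts = λ {u} {w} e → lift u (corner-lifts (remQuot {suc k} 4 u) e) }
          where
          lift : ∀ u {w} → Lift (remQuot {suc k} 4 u) w →
            ∃[ v ] corner (remQuot {suc k} 4 v) ≡ w × adj (H (suc k)) u v ≡ true
          lift u ((i , t) , e , h) = combine i t , trans (cong corner (F.remQuot-combine i t)) e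
            , H-adj⁺ {suc k} {u} {combine i t} (subst (HAdj (remQuot {suc k} 4 u)) (sym (F.remQuot-combine i t)) h)

        -- A return after one step would put `v₀` and `f v₀` into the same 4-clique.
        ladder-length : 1 ≤ k
        ladder-length = positive k returns
          where
          positive : ∀ l → S^ (suc l) v₀ ≈ v₀ → 1 ≤ l
          positive zero e = contradiction
            (Classmate-trans (≈⇒Classmate (≈-sym e)) (Classmate-sym (inj₂ (o-mate (f v₀)))))
            λ { (inj₁ p) → ~⇒≢ (proj₁ (f-cross v₀)) p ; (inj₂ p) → Mate-Cross p (f-cross v₀) }
          positive (suc _) _ = s≤s z≤n

-- Strong triangles

module Triangles (G : Graph) (simple : IsSimple G) (regular : Regular 4 G) (vt : VertexTransitive G) where
  open FourValent G simple regular vt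

  Transversal-swap : ∀ {a b c} → Transversal a b c → Transversal a c b
  Transversal-swap t x y z p q r with t x z y p r q
  ... | inj₁ e        = inj₂ (inj₂ e)
  ... | inj₂ (inj₁ e) = inj₂ (inj₁ (~-sym e))
  ... | inj₂ (inj₂ e) = inj₁ e

  Transversal-cycle : ∀ {a b c} → Transversal a b c → Transversal b c a
  Transversal-cycle t x y z p q r with t z x y r p q
  ... | inj₁ e        = inj₂ (inj₂ (~-sym e))
  ... | inj₂ (inj₁ e) = inj₁ e
  ... | inj₂ (inj₂ e) = inj₂ (inj₁ (~-sym e))

  module Octahedron {a b c α α′ β′ γ γ′ : V} (t : Transversal a b c)
    (A : Neighbours a (b ∷ c ∷ α ∷ α′ ∷ [])) (B : Neighbours b (a ∷ c ∷ α ∷ β′ ∷ []))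
    (Γ : Neighbours c (a ∷ b ∷ γ ∷ γ′ ∷ [])) where

    -- Choosing `α` as neighbour of both `a` and `b` in the transversal condition makes it adjacent
    -- to every neighbour of `c`.
    α-neighbours : Neighbours α (a ∷ b ∷ γ ∷ γ′ ∷ [])
    α-neighbours with adjacent A | adjacent B | adjacent Γ
    ... | _ ∷ _ ∷ aα ∷ _ | _ ∷ _ ∷ bα ∷ _ | _ ∷ _ ∷ cγ ∷ cγ′ ∷ [] =
      neighbours₄ (~-sym aα ∷ ~-sym bα ∷ α~ cγ ∷ α~ cγ′ ∷ []) (distinct Γ)
      where
      α~ : ∀ {z} → c ~ z → α ~ z
      α~ {z} cz with t α α z aα bα cz
      ... | inj₁ e        = contradiction refl (~⇒≢ e)
      ... | inj₂ (inj₁ e) = e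
      ... | inj₂ (inj₂ e) = e

    -- 0-7 stand for a b c α α′ β′ γ γ′, and 8-11 for the images of b c α α′
    -- under a symmetry taking a to vertex i.
    around : ℕ → List Fact
    around i = nb 0 (1 ∷ 2 ∷ 3 ∷ 4 ∷ []) ∷ nb 1 (0 ∷ 2 ∷ 3 ∷ 5 ∷ []) ∷ nb 2 (0 ∷ 1 ∷ 6 ∷ 7 ∷ [])
      ∷ nb 3 (0 ∷ 1 ∷ 6 ∷ 7 ∷ []) ∷ tra 0 1 2 (3 ∷ 4 ∷ []) (3 ∷ 5 ∷ []) (6 ∷ 7 ∷ [])
      ∷ nb i (8 ∷ 9 ∷ 10 ∷ 11 ∷ []) ∷ iso (7 +_) (1 ∷ 2 ∷ 3 ∷ 4 ∷ []) ∷ []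

    module Moved (s : Symmetry G) where
      open Symmetry s

      vertices : Vec V 12
      vertices = a ∷ b ∷ c ∷ α ∷ α′ ∷ β′ ∷ γ ∷ γ′ ∷ g b ∷ g c ∷ g α ∷ g α′ ∷ []

      image-iso : Σ (V → V) λ h → (∀ u v → adj G (h u) (h v) ≡ adj G u v) ×
        All (λ i → look vertices (7 + i) ≡ h (look vertices i)) (1 ∷ 2 ∷ 3 ∷ 4 ∷ [])
      image-iso = g , g-adj , refl ∷ refl ∷ refl ∷ refl ∷ []

    α′≢β′ : α′ ≢ β′
    α′≢β′ with symmetry {G} vt a c
    ... | s , refl = by-search (Moved.vertices s) (around 2) ((ne 4 5 ∷ []) ∷ [])
      (A , B , Γ , α-neighbours , t , g-Neighbours s A , Moved.image-iso s , tt) refl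

    -- With `α′≢β′` and the two implications below, this identifies `α′`, `β′` with `γ`, `γ′` in
    -- some order. Split up, each claim is searched with a single symmetry, from `a` to `c` or from
    -- `a` to `b`.
    some-meet : α′ ≡ γ ⊎ α′ ≡ γ′ ⊎ β′ ≡ γ ⊎ β′ ≡ γ′
    some-meet with symmetry {G} vt a c
    ... | s , refl = by-search (Moved.vertices s) (cl (ne 4 5 ∷ []) ∷ around 2)
      ((eq 4 6 ∷ eq 4 7 ∷ eq 5 6 ∷ eq 5 7 ∷ []) ∷ [])
      (α′≢β′ , A , B , Γ , α-neighbours , t , g-Neighbours s A , Moved.image-iso s , tt) refl

    α′-meets : (β′ ≡ γ ⊎ β′ ≡ γ′ ⊎ α′ ≢ γ) × (β′ ≡ γ ⊎ β′ ≡ γ′ ⊎ α′ ≢ γ′)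
    α′-meets with symmetry {G} vt a c
    ... | s , refl = by-search (Moved.vertices s) (cl (ne 4 5 ∷ []) ∷ around 2)
      ((eq 5 6 ∷ eq 5 7 ∷ ne 4 6 ∷ []) ∷ (eq 5 6 ∷ eq 5 7 ∷ ne 4 7 ∷ []) ∷ [])
      (α′≢β′ , A , B , Γ , α-neighbours , t , g-Neighbours s A , Moved.image-iso s , tt) refl

    β′-meets : (α′ ≡ γ ⊎ α′ ≡ γ′ ⊎ β′ ≢ γ) × (α′ ≡ γ ⊎ α′ ≡ γ′ ⊎ β′ ≢ γ′)
    β′-meets with symmetry {G} vt a b
    ... | s , refl = by-search (Moved.vertices s) (cl (ne 4 5 ∷ []) ∷ around 1)
      ((eq 4 6 ∷ eq 4 7 ∷ ne 5 6 ∷ []) ∷ (eq 4 6 ∷ eq 4 7 ∷ ne 5 7 ∷ []) ∷ [])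
      (α′≢β′ , A , B , Γ , α-neighbours , t , g-Neighbours s A , Moved.image-iso s , tt) refl

    octahedron : Embedding (lex (K 3) (E 2)) G
    -- Antipodal pairs are consecutive; `γ` and `γ′` follow as auxiliary names for `α′` and `β′`.
    octahedron = embedding (lex (K 3) (E 2)) (a ∷ β′ ∷ b ∷ α′ ∷ c ∷ α ∷ γ ∷ γ′ ∷ [])
      (nb 0 (2 ∷ 4 ∷ 5 ∷ 3 ∷ []) ∷ nb 2 (0 ∷ 4 ∷ 5 ∷ 1 ∷ []) ∷ nb 4 (0 ∷ 2 ∷ 6 ∷ 7 ∷ []) ∷ nb 5 (0 ∷ 2 ∷ 6 ∷ 7 ∷ [])
       ∷ tra 0 2 4 (5 ∷ 3 ∷ []) (5 ∷ 1 ∷ []) (6 ∷ 7 ∷ [])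
       ∷ cl (ne 3 1 ∷ []) ∷ cl (eq 3 6 ∷ eq 3 7 ∷ eq 1 6 ∷ eq 1 7 ∷ [])
       ∷ cl (eq 1 6 ∷ eq 1 7 ∷ ne 3 6 ∷ []) ∷ cl (eq 1 6 ∷ eq 1 7 ∷ ne 3 7 ∷ [])
       ∷ cl (eq 3 6 ∷ eq 3 7 ∷ ne 1 6 ∷ []) ∷ cl (eq 3 6 ∷ eq 3 7 ∷ ne 1 7 ∷ []) ∷ [])
      refl
      (A , B , Γ , α-neighbours , t , α′≢β′ , some-meet , proj₁ α′-meets , proj₂ α′-meets
        , proj₁ β′-meets , proj₂ β′-meets , tt)
      refl

  octahedron : ∀ {a b c x} → a ~ b → a ~ c → b ~ c → Transversal a b c →
    a ~ x → b ~ x → x ≢ c → Embedding (lex (K 3) (E 2)) G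
  octahedron ab ac bc t ax bx x≢c =
    let (α′ , A) = neighbours₃ ab ac ax (~⇒≢ bc) (~⇒≢ bx) (x≢c ∘ sym)
        (β′ , B) = neighbours₃ (~-sym ab) bc bx (~⇒≢ ac) (~⇒≢ ax) (x≢c ∘ sym)
        (γ , γ′ , Γ) = neighbours₂ (~-sym ac) (~-sym bc) (~⇒≢ ab)
    in Octahedron.octahedron t A B Γ

  -- If α were related to no outer neighbour of b, it would be related to both outer
  -- neighbours of c.
  partner-exists : (E : V → V → Set) {α β₁ β₂ γ₁ γ₂ : V} →
    (∀ {β γ} → β ∈ˡ β₁ ∷ β₂ ∷ [] → γ ∈ˡ γ₁ ∷ γ₂ ∷ [] → E α β ⊎ E β γ ⊎ E α γ) →
    (∀ {γ} → γ ∈ˡ γ₁ ∷ γ₂ ∷ [] → E β₁ γ → E β₂ γ → ⊥) → (E α γ₁ → E α γ₂ → ⊥) → E α β₁ ⊎ E α β₂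
  partner-exists E {α} {β₁} {β₂} {γ₁} {γ₂} edge β-apart γ-apart =
    [ id , (λ e₁ → [ id , (λ e₂ → ⊥-elim (γ-apart e₁ e₂)) ]′ (try (there (here refl)))) ]′
      (try (here refl))
    where
    try : ∀ {γ} → γ ∈ˡ γ₁ ∷ γ₂ ∷ [] → (E α β₁ ⊎ E α β₂) ⊎ E α γ
    try γ∈ with edge (here refl) γ∈ | edge (there (here refl)) γ∈
    ... | inj₁ e        | _              = inj₁ (inj₁ e)
    ... | inj₂ _        | inj₁ e         = inj₁ (inj₂ e)
    ... | inj₂ (inj₂ e) | inj₂ _         = inj₂ e
    ... | inj₂ (inj₁ _) | inj₂ (inj₂ e)  = inj₂ e
    ... | inj₂ (inj₁ e) | inj₂ (inj₁ e′) = ⊥-elim (β-apart γ∈ e e′)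

  -- A vertex whose neighbourhood is 2K₂, respectively K₂ + 2K₁.
  record TwoTriangles (v : V) : Set where
    field
      {w x y z} : V
      star : Neighbours v (w ∷ x ∷ y ∷ z ∷ [])
      wx   : w ~ x
      yz   : y ~ z
      wy   : w ≁ y
      wz   : w ≁ z
      xy   : x ≁ y
      xz   : x ≁ z

  record OneTriangle (v : V) : Set where
    field
      {b c p q} : V
      star : Neighbours v (b ∷ c ∷ p ∷ q ∷ [])
      bc   : b ~ c
      bp   : b ≁ p
      bq   : b ≁ q
      cp   : c ≁ p
      cq   : c ≁ q
      pq   : p ≁ q

  g-TwoTriangles : (s : Symmetry G) → ∀ {v} → TwoTriangles v → TwoTriangles (Symmetry.g s v)
  g-TwoTriangles s P = record
    { star = g-Neighbours s star ; wx = g-~ s wx ; yz = g-~ s yz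
    ; wy = g-≁ s wy ; wz = g-≁ s wz ; xy = g-≁ s xy ; xz = g-≁ s xz }
    where open TwoTriangles P

  g-OneTriangle : (s : Symmetry G) → ∀ {v} → OneTriangle v → OneTriangle (Symmetry.g s v)
  g-OneTriangle s P = record
    { star = g-Neighbours s star ; bc = g-~ s bc ; bp = g-≁ s bp ; bq = g-≁ s bq
    ; cp = g-≁ s cp ; cq = g-≁ s cq ; pq = g-≁ s pq }
    where open OneTriangle P

  OnlyCommon : V → V → V → Set
  OnlyCommon a b c = ∀ {x} → a ~ x → b ~ x → x ≡ c

  module _ (two : ∀ v → TwoTriangles v) where
    no-two-triangles-on-edge : ∀ {v x y z} → v ~ x → v ~ y → v ~ z → x ~ y → x ~ z → y ≡ z
    no-two-triangles-on-edge {v} {x} {y} {z} vx vy vz xy xz = let module T = TwoTriangles (two v) in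
      by-search (v ∷ T.w ∷ T.x ∷ T.y ∷ T.z ∷ x ∷ y ∷ z ∷ [])
        (nb 0 (1 ∷ 2 ∷ 3 ∷ 4 ∷ []) ∷ cl (ad 1 2 ∷ []) ∷ cl (ad 3 4 ∷ [])
         ∷ cl (na 1 3 ∷ []) ∷ cl (na 1 4 ∷ []) ∷ cl (na 2 3 ∷ []) ∷ cl (na 2 4 ∷ [])
         ∷ cl (ad 0 5 ∷ []) ∷ cl (ad 0 6 ∷ []) ∷ cl (ad 0 7 ∷ []) ∷ cl (ad 5 6 ∷ []) ∷ cl (ad 5 7 ∷ []) ∷ [])
        ((eq 6 7 ∷ []) ∷ [])
        (T.star , T.wx , T.yz , T.wy , T.wz , T.xy , T.xz , vx , vy , vz , xy , xz , tt) refl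

    no-claw : ∀ {v x y z} → v ~ x → v ~ y → v ~ z → x ≢ y → x ≢ z → y ≢ z → x ≁ y → x ≁ z → y ~ z
    no-claw {v} {x} {y} {z} vx vy vz x≢y x≢z y≢z xy xz = let module T = TwoTriangles (two v) in
      by-search (v ∷ T.w ∷ T.x ∷ T.y ∷ T.z ∷ x ∷ y ∷ z ∷ [])
        (nb 0 (1 ∷ 2 ∷ 3 ∷ 4 ∷ []) ∷ cl (ad 1 2 ∷ []) ∷ cl (ad 3 4 ∷ [])
         ∷ cl (ad 0 5 ∷ []) ∷ cl (ad 0 6 ∷ []) ∷ cl (ad 0 7 ∷ [])
         ∷ cl (ne 5 6 ∷ []) ∷ cl (ne 5 7 ∷ []) ∷ cl (ne 6 7 ∷ []) ∷ cl (na 5 6 ∷ []) ∷ cl (na 5 7 ∷ []) ∷ [])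
        ((ad 6 7 ∷ []) ∷ [])
        (T.star , T.wx , T.yz , vx , vy , vz , x≢y , x≢z , y≢z , xy , xz , tt) refl

    apex : ∀ {b β₁ β₂ x} → b ~ β₁ → b ~ β₂ → β₁ ~ β₂ → β₁ ~ x → β₂ ~ x → x ≡ b
    apex bβ₁ bβ₂ β₁₂ e₁ e₂ = sym (no-two-triangles-on-edge β₁₂ (~-sym bβ₁) e₁ (~-sym bβ₂) e₂)

    outer-pair : ∀ {a b c} → a ~ b → b ~ c → a ~ c → OnlyCommon a b c →
      ∃₂ λ β₁ β₂ → Neighbours b (a ∷ c ∷ β₁ ∷ β₂ ∷ []) × β₁ ~ β₂
    outer-pair ab bc ac AB with neighbours₂ (~-sym ab) bc (~⇒≢ ac)
    ... | β₁ , β₂ , N@(neighbours (ba ∷ _ ∷ bβ₁ ∷ bβ₂ ∷ []) ((_ ∷ aβ₁ ∷ aβ₂ ∷ []) ∷ (cβ₁ ∷ cβ₂ ∷ []) ∷ (β₁₂ ∷ []) ∷ _) _) =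
      β₁ , β₂ , N , no-claw ba bβ₁ bβ₂ aβ₁ aβ₂ β₁₂
        (¬~⇒≁ λ e → cβ₁ (sym (AB e bβ₁))) (¬~⇒≁ λ e → cβ₂ (sym (AB e bβ₂)))

    -- `partner-exists` for adjacency. The two outer neighbours of `b` are adjacent with `b` as
    -- their only common neighbour, likewise those of `c`, so neither pair has an unwanted common
    -- neighbour.
    joins : ∀ {a b c α} → a ~ b → b ~ c → a ~ c → Transversal a b c →
      OnlyCommon a b c → OnlyCommon a c b → a ~ α → α ≢ b → α ≢ c →
      ∃[ β ] b ~ β × β ≢ a × β ≢ c × α ~ β
    joins {a} {b} {c} {α} ab bc ac t AB AC aα α≢b α≢c
      with outer-pair ab bc ac AB | outer-pair ac (~-sym bc) ab AC
    ... | β₁ , β₂ , neighbours (_ ∷ _ ∷ bβ₁ ∷ bβ₂ ∷ []) ((_ ∷ aβ₁ ∷ aβ₂ ∷ []) ∷ (cβ₁ ∷ cβ₂ ∷ []) ∷ _) _ , β₁₂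
        | γ₁ , γ₂ , neighbours (_ ∷ _ ∷ cγ₁ ∷ cγ₂ ∷ []) ((_ ∷ aγ₁ ∷ aγ₂ ∷ []) ∷ (bγ₁ ∷ bγ₂ ∷ []) ∷ _) _ , γ₁₂ =
      [ (λ e → β₁ , bβ₁ , aβ₁ ∘ sym , cβ₁ ∘ sym , e) , (λ e → β₂ , bβ₂ , aβ₂ ∘ sym , cβ₂ ∘ sym , e) ]′
        (partner-exists _~_
          (λ β∈ γ∈ → t _ _ _ aα (All.lookup (bβ₁ ∷ bβ₂ ∷ []) β∈) (All.lookup (cγ₁ ∷ cγ₂ ∷ []) γ∈))
          (λ γ∈ e₁ e₂ → All.lookup (bγ₁ ∷ bγ₂ ∷ []) γ∈ (sym (apex bβ₁ bβ₂ β₁₂ e₁ e₂)))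
          (λ e₁ e₂ → α≢c (apex cγ₁ cγ₂ γ₁₂ (~-sym e₁) (~-sym e₂))))

    -- The rows are `a b c`, `α₁ β₁ γ₁`, `α₂ β₂ γ₂`. Since `a` is adjacent to neither `βᵢ` nor `γᵢ`,
    -- `no-claw` at `αᵢ` closes the lower rows; at `b` and `c` it closes the columns.
    grid : ∀ {a b c α₁ α₂} → Neighbours a (b ∷ c ∷ α₁ ∷ α₂ ∷ []) → b ~ c → α₁ ~ α₂ → Transversal a b c →
      OnlyCommon a b c → OnlyCommon a c b → OnlyCommon b c a → Embedding LK33 G
    grid {a} {b} {c} {α₁} {α₂}
      A@(neighbours (ab ∷ ac ∷ aα₁ ∷ aα₂ ∷ []) ((_ ∷ bα₁ ∷ bα₂ ∷ []) ∷ (cα₁ ∷ cα₂ ∷ []) ∷ _) _)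
      bc α₁₂ t AB AC BC =
      let (β₁ , bβ₁ , aβ₁ , cβ₁ , α₁β₁) = joins ab bc ac t AB AC aα₁ (bα₁ ∘ sym) (cα₁ ∘ sym)
          (β₂ , bβ₂ , aβ₂ , cβ₂ , α₂β₂) = joins ab bc ac t AB AC aα₂ (bα₂ ∘ sym) (cα₂ ∘ sym)
          (γ₁ , cγ₁ , aγ₁ , bγ₁ , α₁γ₁) = joins ac (~-sym bc) ab (Transversal-swap t) AC AB aα₁ (cα₁ ∘ sym) (bα₁ ∘ sym)
          (γ₂ , cγ₂ , aγ₂ , bγ₂ , α₂γ₂) = joins ac (~-sym bc) ab (Transversal-swap t) AC AB aα₂ (cα₂ ∘ sym) (bα₂ ∘ sym)
          β₁≢β₂ = λ (e : β₁ ≡ β₂) → aβ₁ (apex aα₁ aα₂ α₁₂ α₁β₁ (subst (α₂ ~_) (sym e) α₂β₂))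
          γ₁≢γ₂ = λ (e : γ₁ ≡ γ₂) → aγ₁ (apex aα₁ aα₂ α₁₂ α₁γ₁ (subst (α₂ ~_) (sym e) α₂γ₂))
          aβ₁′ = ¬~⇒≁ λ e → cβ₁ (AB e bβ₁)
          aβ₂′ = ¬~⇒≁ λ e → cβ₂ (AB e bβ₂)
          aγ₁′ = ¬~⇒≁ λ e → bγ₁ (AC e cγ₁)
          aγ₂′ = ¬~⇒≁ λ e → bγ₂ (AC e cγ₂)
          β₁≢γ₁ = λ (e : β₁ ≡ γ₁) → aβ₁ (BC bβ₁ (subst (c ~_) (sym e) cγ₁))
          β₂≢γ₂ = λ (e : β₂ ≡ γ₂) → aβ₂ (BC bβ₂ (subst (c ~_) (sym e) cγ₂))
      in embedding LK33 (a ∷ b ∷ c ∷ α₁ ∷ β₁ ∷ γ₁ ∷ α₂ ∷ β₂ ∷ γ₂ ∷ [])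
        (nb 0 (1 ∷ 2 ∷ 3 ∷ 6 ∷ []) ∷ nb 1 (0 ∷ 2 ∷ 4 ∷ 7 ∷ []) ∷ nb 2 (0 ∷ 1 ∷ 5 ∷ 8 ∷ [])
         ∷ cl (ad 3 6 ∷ []) ∷ cl (ad 4 7 ∷ []) ∷ cl (ad 5 8 ∷ [])
         ∷ cl (ad 3 4 ∷ []) ∷ cl (ad 3 5 ∷ []) ∷ cl (ad 4 5 ∷ [])
         ∷ cl (ad 6 7 ∷ []) ∷ cl (ad 6 8 ∷ []) ∷ cl (ad 7 8 ∷ [])
         ∷ cl (na 0 4 ∷ []) ∷ cl (na 0 7 ∷ []) ∷ cl (na 0 5 ∷ []) ∷ cl (na 0 8 ∷ [])
         ∷ cl (na 1 5 ∷ []) ∷ cl (na 1 8 ∷ []) ∷ [])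
        refl
        ( A
        , neighbours₄ (~-sym ab ∷ bc ∷ bβ₁ ∷ bβ₂ ∷ [])
            ((~⇒≢ ac ∷ aβ₁ ∘ sym ∷ aβ₂ ∘ sym ∷ []) ∷ (cβ₁ ∘ sym ∷ cβ₂ ∘ sym ∷ []) ∷ (β₁≢β₂ ∷ []) ∷ [] ∷ [])
        , neighbours₄ (~-sym ac ∷ ~-sym bc ∷ cγ₁ ∷ cγ₂ ∷ [])
            ((~⇒≢ ab ∷ aγ₁ ∘ sym ∷ aγ₂ ∘ sym ∷ []) ∷ (bγ₁ ∘ sym ∷ bγ₂ ∘ sym ∷ []) ∷ (γ₁≢γ₂ ∷ []) ∷ [] ∷ [])
        , α₁₂
        , no-claw (~-sym ab) bβ₁ bβ₂ (aβ₁ ∘ sym) (aβ₂ ∘ sym) β₁≢β₂ aβ₁′ aβ₂′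
        , no-claw (~-sym ac) cγ₁ cγ₂ (aγ₁ ∘ sym) (aγ₂ ∘ sym) γ₁≢γ₂ aγ₁′ aγ₂′
        , α₁β₁ , α₁γ₁ , no-claw (~-sym aα₁) α₁β₁ α₁γ₁ (aβ₁ ∘ sym) (aγ₁ ∘ sym) β₁≢γ₁ aβ₁′ aγ₁′
        , α₂β₂ , α₂γ₂ , no-claw (~-sym aα₂) α₂β₂ α₂γ₂ (aβ₂ ∘ sym) (aγ₂ ∘ sym) β₂≢γ₂ aβ₂′ aγ₂′
        , aβ₁′ , aβ₂′ , aγ₁′ , aγ₂′
        , ¬~⇒≁ (λ e → aγ₁ (BC e cγ₁)) , ¬~⇒≁ (λ e → aγ₂ (BC e cγ₂)) , tt)
        refl

-- Graphs with exactly one triangle at each vertex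

module OneTriangles (G : Graph) (simple : IsSimple G) (regular : Regular 4 G) (vt : VertexTransitive G)
  (one : ∀ v → Triangles.OneTriangle G simple regular vt v) where
  open FourValent G simple regular vt
  open Triangles G simple regular vt
  module T v = OneTriangle (one v)

  module _ {v : V} where
    star-cases : ∀ {x} → v ~ x → (x ≡ T.b v ⊎ x ≡ T.c v) ⊎ (x ≡ T.p v ⊎ x ≡ T.q v)
    star-cases vx with complete (T.star v) vx
    ... | here e                         = inj₁ (inj₁ e)
    ... | there (here e)                 = inj₁ (inj₂ e)
    ... | there (there (here e))         = inj₂ (inj₁ e)
    ... | there (there (there (here e))) = inj₂ (inj₂ e)

    private
      vb = All.lookup (adjacent (T.star v)) (here refl)
      vc = All.lookup (adjacent (T.star v)) (there (here refl))
      vp = All.lookup (adjacent (T.star v)) (there (there (here refl)))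
      vq = All.lookup (adjacent (T.star v)) (there (there (there (here refl))))

    b-mate : Mate v (T.b v)
    b-mate = vb , T.c v , vc , T.bc v

    c-mate : Mate v (T.c v)
    c-mate = vc , T.b v , vb , ~-sym (T.bc v)

    bc-mate : Mate (T.b v) (T.c v)
    bc-mate = T.bc v , v , ~-sym vb , ~-sym vc

    p-cross : Cross v (T.p v)
    p-cross = vp , λ (z , vz , pz) → case star-cases vz of λ
      { (inj₁ (inj₁ refl)) → ≁⇒¬~ (T.bp v) (~-sym pz) ; (inj₁ (inj₂ refl)) → ≁⇒¬~ (T.cp v) (~-sym pz)
      ; (inj₂ (inj₁ refl)) → ~⇒≢ pz refl ; (inj₂ (inj₂ refl)) → ≁⇒¬~ (T.pq v) pz }

    q-cross : Cross v (T.q v)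
    q-cross = vq , λ (z , vz , qz) → case star-cases vz of λ
      { (inj₁ (inj₁ refl)) → ≁⇒¬~ (T.bq v) (~-sym qz) ; (inj₁ (inj₂ refl)) → ≁⇒¬~ (T.cq v) (~-sym qz)
      ; (inj₂ (inj₁ refl)) → ≁⇒¬~ (T.pq v) (~-sym qz) ; (inj₂ (inj₂ refl)) → ~⇒≢ qz refl }

    p≢q : T.p v ≢ T.q v
    p≢q with distinct (T.star v)
    ... | _ ∷ _ ∷ (h ∷ []) ∷ _ = h

    mate-cases : ∀ {x} → Mate v x → x ≡ T.b v ⊎ x ≡ T.c v
    mate-cases m@(vx , _) with star-cases vx
    ... | inj₁ e = e
    ... | inj₂ (inj₁ refl) = contradiction p-cross (Mate-Cross m)
    ... | inj₂ (inj₂ refl) = contradiction q-cross (Mate-Cross m)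

    cross-cases : ∀ {x} → Cross v x → x ≡ T.p v ⊎ x ≡ T.q v
    cross-cases k@(vx , _) with star-cases vx
    ... | inj₂ e = e
    ... | inj₁ (inj₁ refl) = contradiction k (Mate-Cross b-mate)
    ... | inj₁ (inj₂ refl) = contradiction k (Mate-Cross c-mate)

  Mate-trans : ∀ {u v w} → Mate u v → Mate v w → u ≢ w → Mate u w
  Mate-trans {v = v} p q h with mate-cases (Mate-sym p) | mate-cases q
  ... | inj₁ refl | inj₁ refl = contradiction refl h
  ... | inj₁ refl | inj₂ refl = bc-mate
  ... | inj₂ refl | inj₁ refl = Mate-sym bc-mate
  ... | inj₂ refl | inj₂ refl = contradiction refl h

  open Transitive Mate-trans public

  two-of : ∀ {R : V → V → Set} {v b c x y z : V} → (∀ {x} → R v x → x ≡ b ⊎ x ≡ c) →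
    R v x → R v y → x ≢ y → R v z → z ≡ x ⊎ z ≡ y
  two-of cases rx ry x≢y rz with cases rx | cases ry | cases rz
  ... | inj₁ refl | inj₁ refl | _         = contradiction refl x≢y
  ... | inj₂ refl | inj₂ refl | _         = contradiction refl x≢y
  ... | inj₁ refl | inj₂ refl | inj₁ refl = inj₁ refl
  ... | inj₁ refl | inj₂ refl | inj₂ refl = inj₂ refl
  ... | inj₂ refl | inj₁ refl | inj₁ refl = inj₂ refl
  ... | inj₂ refl | inj₁ refl | inj₂ refl = inj₁ refl

  two-mates : ∀ {v x y z} → Mate v x → Mate v y → x ≢ y → Mate v z → z ≡ x ⊎ z ≡ y
  two-mates = two-of {Mate} mate-cases

  two-cross : ∀ {v x y z} → Cross v x → Cross v y → x ≢ y → Cross v z → z ≡ x ⊎ z ≡ y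
  two-cross = two-of {Cross} cross-cases

  other : ∀ {v u} → Cross v u → ∃[ w ] Cross v w × w ≢ u
  other {v} k with cross-cases k
  ... | inj₁ refl = T.q v , q-cross , p≢q ∘ sym
  ... | inj₂ refl = T.p v , p-cross , p≢q

  cross-not-mate : ∀ {v x y} → Cross v x → Cross v y → ¬ Mate x y
  cross-not-mate (vx , h) (vy , _) (xy , _) = h (_ , vy , xy)

  Threefold : V → V → Set
  Threefold v w = Mate v w × ∃[ p ] Cross v p × ∃[ q ] Cross p q × Cross q w

  threefold? : ∀ v w → Dec (Threefold v w)
  threefold? v w = mate? v w ×-dec F.any? λ p → cross? v p ×-dec F.any? λ q → cross? p q ×-dec cross? q w

  Threefold-sym : ∀ {v w} → Threefold v w → Threefold w v
  Threefold-sym (m , p , vp , q , pq , qw) = Mate-sym m , q , Cross-sym qw , p , Cross-sym pq , Cross-sym vp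

  g-Threefold : (s : Symmetry G) → ∀ {v w} → Threefold v w → Threefold (Symmetry.g s v) (Symmetry.g s w)
  g-Threefold s (m , p , vp , q , pq , qw) = g-Mate s m , _ , g-Cross s vp , _ , g-Cross s pq , g-Cross s qw

  Mixed : V → Set
  Mixed v = ∃₂ λ x y → Mate v x × Mate v y × Threefold v x × ¬ Threefold v y

  g-Mixed : ∀ {u} → Mixed u → ∀ v → Mixed v
  g-Mixed {u} (x , y , ux , uy , tx , ty) v with symmetry {G} vt u v
  ... | s , refl = g x , g y , g-Mate s ux , g-Mate s uy , g-Threefold s tx
        , λ t → ty (subst₂ Threefold (g⁻g u) (g⁻g y) (g-Threefold (Symmetry.inverse s) t))
    where open Symmetry s

  -- The three pairs inside a triangle would have pairwise different Threefold status.
  unmixed : ∀ {v} → ¬ Mixed v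
  unmixed {v} M@(x , y , vx , vy , tx , ty) = at-y (g-Mixed M y)
    where
    x≢y : x ≢ y
    x≢y refl = ty tx
    xy : Mate x y
    xy = Mate-trans (Mate-sym vx) vy x≢y
    at-x : Threefold x y → Mixed x → ⊥
    at-x t (_ , z , _ , xz , _ , ¬t) with two-mates (Mate-sym vx) xy (Mate⇒≢ vy) xz
    ... | inj₁ refl = ¬t (Threefold-sym tx)
    ... | inj₂ refl = ¬t t
    at-y : Mixed y → ⊥
    at-y (z , _ , yz , _ , t , _) with two-mates (Mate-sym vy) (Mate-sym xy) (Mate⇒≢ vx) yz
    ... | inj₁ refl = ty (Threefold-sym t)
    ... | inj₂ refl = at-x (Threefold-sym t) (g-Mixed M x)

  -- The local form of a perfect matching between adjacent triangles.
  Squares : V → Set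
  Squares v = ∀ {p w} → Cross v p → Mate v w → ∃[ q ] Cross w q × Mate p q

  g-Squares : ∀ {u} → Squares u → ∀ v → Squares v
  g-Squares {u} sq v {p} {w} vp vw with symmetry {G} vt v u
  ... | s , refl =
    let (q , wq , pq) = sq (g-Cross s vp) (g-Mate s vw)
    in g⁻ q , subst (λ x → Cross x (g⁻ q)) (g⁻g w) (g-Cross (Symmetry.inverse s) wq)
            , subst (λ x → Mate x (g⁻ q)) (g⁻g p) (g-Mate (Symmetry.inverse s) pq)
    where open Symmetry s

  -- Cross paths v y y′ b and v z z′ c: the mates of y are the ends of the cross paths
  -- of length three at y.
  module _ (full : ∀ {v w} → Mate v w → Threefold v w) where
    ends : ∀ {v y y′ b z z′} → Cross v y → Cross y y′ → Cross y′ b → Mate v b →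
      Cross v z → y ≢ z → Cross z z′ → z′ ≢ v → ∀ {m} → Mate y m → m ≡ z′ ⊎ Cross b m
    ends {v} {y} {y′} {b} {z} {z′} vy yy′ y′b vb vz y≢z zz′ z′≢v {m} ym with full ym
    ... | _ , t , yt , t′ , tt′ , t′m
      with two-cross (Cross-sym vy) yy′ (λ { refl → Mate-Cross vb y′b }) yt
    ... | inj₂ refl with two-cross (Cross-sym yy′) y′b (λ { refl → Mate-Cross vb vy }) tt′
    ...   | inj₁ refl = contradiction t′m (Mate-Cross ym)
    ...   | inj₂ refl = inj₂ t′m
    ends {v} {y} {y′} {b} {z} {z′} vy yy′ y′b vb vz y≢z zz′ z′≢v {m} ym | _ , t , yt , t′ , tt′ , t′m
      | inj₁ refl with two-cross vy vz y≢z tt′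
    ...   | inj₁ refl = contradiction t′m (Mate-Cross ym)
    ...   | inj₂ refl with two-cross (Cross-sym vz) zz′ (z′≢v ∘ sym) t′m
    ...     | inj₁ refl = contradiction ym (λ e → Mate-Cross (Mate-sym e) vy)
    ...     | inj₂ refl = inj₁ refl

    module _ {v b c y y′ z z′ : V} (vb : Mate v b) (vc : Mate v c) (b≢c : b ≢ c)
      (vy : Cross v y) (yy′ : Cross y y′) (y′b : Cross y′ b)
      (vz : Cross v z) (zz′ : Cross z z′) (z′c : Cross z′ c) where

      -- With a common first vertex the two cross paths never have a choice: they agree at each step
      -- and would end at the same mate of `v`.
      y≢z : y ≢ z
      y≢z refl with two-cross (Cross-sym vy) yy′ (λ { refl → Mate-Cross vb y′b }) zz′
      ... | inj₁ refl = Mate-Cross vc z′c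
      ... | inj₂ refl with two-cross (Cross-sym yy′) y′b (λ { refl → Mate-Cross vb vy }) z′c
      ...   | inj₁ refl = Mate-Cross vc vy
      ...   | inj₂ refl = b≢c refl

      pick : ∀ {m w} → Mate y z′ → Mate y m → Cross b m → Mate v w → ∃[ q ] Cross w q × Mate y q
      pick yz′ ym bm vw with two-mates vb vc b≢c vw
      ... | inj₁ refl = _ , bm , ym
      ... | inj₂ refl = _ , Cross-sym z′c , yz′

      -- The two mates of `y` cannot both be `z′`, nor both cross neighbours of `b`, since these are
      -- never mates. So one is `z′`, which crosses to `c`, and the other crosses to `b`.
      squares-y : ∀ {w} → Mate v w → ∃[ q ] Cross w q × Mate y q
      squares-y vw with to-end b-mate | to-end c-mate
        where
        to-end : ∀ {m} → Mate y m → m ≡ z′ ⊎ Cross b m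
        to-end = ends vy yy′ y′b vb vz y≢z zz′ (λ { refl → Mate-Cross vc z′c })
      ... | inj₁ e | inj₁ e′ = contradiction (trans e (sym e′)) (Mate⇒≢ bc-mate)
      ... | inj₂ k | inj₂ k′ = contradiction bc-mate (cross-not-mate k k′)
      ... | inj₁ e | inj₂ k = pick (subst (Mate y) e b-mate) c-mate k vw
      ... | inj₂ k | inj₁ e = pick (subst (Mate y) e c-mate) b-mate k vw

    full⇒squares : ∀ v → Squares v
    full⇒squares v {p} vp vw with full (b-mate {v}) | full (c-mate {v})
    ... | _ , y , vy , y′ , yy′ , y′b | _ , z , vz , z′ , zz′ , z′c
      with two-cross vy vz (y≢z b-mate c-mate (Mate⇒≢ bc-mate) vy yy′ y′b vz zz′ z′c) vp
    ... | inj₁ refl = squares-y b-mate c-mate (Mate⇒≢ bc-mate) vy yy′ y′b vz zz′ z′c vw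
    ... | inj₂ refl = squares-y c-mate b-mate (Mate⇒≢ bc-mate ∘ sym) vz zz′ z′c vy yy′ y′b vw

  -- Without cross paths of length three between classmates, the edges between the outer
  -- neighbours of a strong triangle are edges of triangles.
  module _ {a b c : V} (ab : Mate a b) (ac : Mate a c) (bc : Mate b c) (t : Transversal a b c)
    (none : ∀ {x y} → Mate x y → ¬ Threefold x y) where

    edge-mate : ∀ {u v x y} → Mate u v → Cross u x → Cross v y → x ~ y → Mate x y
    edge-mate uv ux vy xy with mate-or-cross xy
    ... | inj₁ m = m
    ... | inj₂ k = contradiction (uv , _ , ux , _ , k , Cross-sym vy) (none uv)

    cross-list : ∀ v {x} → x ∈ˡ T.p v ∷ T.q v ∷ [] → Cross v x
    cross-list v (here refl) = p-cross
    cross-list v (there (here refl)) = q-cross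

    apart : ∀ {v x} → Mate (T.p v) x → Mate (T.q v) x → ⊥
    apart m m′ = cross-not-mate p-cross q-cross (Mate-trans m (Mate-sym m′) p≢q)

    -- `partner-exists` for `Mate`: no vertex is a mate of both cross neighbours of another, because
    -- these two would then be mates.
    at-b : ∀ {α} → Cross a α → ∃[ q ] Cross b q × Mate α q
    at-b {α} aα with partner-exists Mate {α} {T.p b} {T.q b} {T.p c} {T.q c}
        (λ β∈ γ∈ → let bβ = cross-list b β∈ ; cγ = cross-list c γ∈ in
          Sum.map (edge-mate ab aα bβ) (Sum.map (edge-mate bc bβ cγ) (edge-mate ac aα cγ))
            (t _ _ _ (proj₁ aα) (proj₁ bβ) (proj₁ cγ)))
        (λ _ → apart) (λ e e′ → apart (Mate-sym e) (Mate-sym e′))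
    ... | inj₁ m = _ , p-cross , m
    ... | inj₂ m = _ , q-cross , m

  -- Comparing only the pairs at `a` suffices: unequal status contradicts `unmixed`, and equal
  -- status is carried to all pairs of mates by symmetries.
  squares : ∀ {a b c} → Mate a b → Mate a c → Mate b c → Transversal a b c → ∀ v → Squares v
  squares {a} {b} {c} ab ac bc t with threefold? a b | threefold? a c
  ... | yes p | no q = contradiction (b , c , ab , ac , p , q) unmixed
  ... | no p | yes q = contradiction (c , b , ac , ab , q , p) unmixed
  ... | yes p | yes q = full⇒squares full
    where
    full : ∀ {v w} → Mate v w → Threefold v w
    full {v} {w} vw with threefold? v w | symmetry {G} vt v a
    ... | yes t | _ = t
    ... | no ¬t | s , refl with two-mates ab ac (Mate⇒≢ bc) (g-Mate s vw)
    ...   | e = subst₂ Threefold (Symmetry.g⁻g s v) (Symmetry.g⁻g s w)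
                  (g-Threefold (Symmetry.inverse s) ([ (λ { refl → p }) , (λ { refl → q }) ]′ e))
  ... | no p | no q = g-Squares at-a
    where
    none : ∀ {x y} → Mate x y → ¬ Threefold x y
    none {x} {y} xy t with symmetry {G} vt x a
    ... | s , refl with two-mates ab ac (Mate⇒≢ bc) (g-Mate s xy)
    ...   | e = [ (λ e → p (subst (Threefold a) e (g-Threefold s t))) , (λ e → q (subst (Threefold a) e (g-Threefold s t))) ]′ e
    at-a : Squares a
    at-a ap aw with two-mates ab ac (Mate⇒≢ bc) aw
    ... | inj₁ refl = at-b ab ac bc t none ap
    ... | inj₂ refl = at-b ac ab (Mate-sym bc) (Transversal-swap t) none ap

-- Cycles of triangles and their monodromy

permutation₃ : (a b c : Fin 3) → a ≢ 0F → b ≢ 1F → c ≢ 2F → a ≢ b → a ≢ c → b ≢ c →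
  (a ≡ 1F × b ≡ 2F × c ≡ 0F) ⊎ (a ≡ 2F × b ≡ 0F × c ≡ 1F)
permutation₃ = toWitness {a? = F.all? λ a → F.all? λ b → F.all? λ c →
  ¬? (a F.≟ 0F) →-dec (¬? (b F.≟ 1F) →-dec (¬? (c F.≟ 2F) →-dec
  (¬? (a F.≟ b) →-dec (¬? (a F.≟ c) →-dec (¬? (b F.≟ c) →-dec
  (((a F.≟ 1F) ×-dec (b F.≟ 2F) ×-dec (c F.≟ 0F)) ⊎-dec
   ((a F.≟ 2F) ×-dec (b F.≟ 0F) ×-dec (c F.≟ 1F))))))))} tt

module TriangleCycles (G : Graph) (simple : IsSimple G) (regular : Regular 4 G) (vt : VertexTransitive G)
  (one : ∀ v → Triangles.OneTriangle G simple regular vt v)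
  (squares : ∀ v → OneTriangles.Squares G simple regular vt one v) where
  open FourValent G simple regular vt
  open OneTriangles G simple regular vt one hiding (squares)

  record Dart : Set where
    constructor dart
    field
      {tail head} : V
      edge : Cross head tail
  open Dart

  infix 4 _≐_ _∥_
  -- Darts are compared by their ends alone, since the `Cross` proofs inside them contain functions.
  record _≐_ (s t : Dart) : Set where
    constructor _,_
    field
      tail≡ : tail s ≡ tail t
      head≡ : head s ≡ head t
  open _≐_

  record _∥_ (s t : Dart) : Set where
    constructor _,_
    field
      tail∥ : Classmate (tail s) (tail t)
      head∥ : Classmate (head s) (head t)
  open _∥_

  ≐-refl : ∀ {s} → s ≐ s
  ≐-refl = refl , refl

  ≐-sym : ∀ {s t} → s ≐ t → t ≐ s
  ≐-sym (p , q) = sym p , sym q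

  ≐-trans : ∀ {s t u} → s ≐ t → t ≐ u → s ≐ u
  ≐-trans (p , q) (p′ , q′) = trans p p′ , trans q q′

  ∥-refl : ∀ {s} → s ∥ s
  ∥-refl = inj₁ refl , inj₁ refl

  ∥-sym : ∀ {s t} → s ∥ t → t ∥ s
  ∥-sym (p , q) = Classmate-sym p , Classmate-sym q

  ∥-trans : ∀ {s t u} → s ∥ t → t ∥ u → s ∥ u
  ∥-trans (p , q) (p′ , q′) = Classmate-trans p p′ , Classmate-trans q q′

  ≐⇒∥ : ∀ {s t} → s ≐ t → s ∥ t
  ≐⇒∥ (p , q) = inj₁ p , inj₁ q

  -- `S` continues along the cross edges. `r` keeps the head and replaces the tail by the other
  -- cross neighbour: it turns round at the head, instead of reversing the edge.
  S r : Dart → Dart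
  S (dart k) = let (_ , k′ , _) = other k in dart (Cross-sym k′)
  r (dart k) = let (_ , k′ , _) = other k in dart k′

  ahead : ∀ s → head (S s) ≢ tail s
  ahead (dart k) = proj₂ (proj₂ (other k))

  ahead-cross : ∀ s → Cross (head s) (head (S s))
  ahead-cross (dart k) = proj₁ (proj₂ (other k))

  cross-classmates : ∀ {v x y} → Cross v x → Cross v y → Classmate x y → x ≡ y
  cross-classmates k k′ (inj₁ e) = e
  cross-classmates k k′ (inj₂ m) = contradiction m (cross-not-mate k k′)

  Classmate-Cross : ∀ {x y} → Classmate x y → ¬ Cross x y
  Classmate-Cross (inj₁ refl) (p , _) = ~⇒≢ p refl
  Classmate-Cross (inj₂ m) k = Mate-Cross m k

  -- Squares match the cross neighbours of `v` with those of `v′`. If `w` were matched to `u′`, it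
  -- would be a classmate of `u`, but distinct cross neighbours of `v` are not classmates.
  parallel : ∀ {v u w v′ u′ w′} → Cross v u → Cross v w → w ≢ u → Cross v′ u′ → Cross v′ w′ → w′ ≢ u′ →
    Classmate v v′ → Classmate u u′ → Classmate w w′
  parallel vu vw w≢u vu′ vw′ w≢u′ (inj₁ refl) c with cross-classmates vu vu′ c
  ... | refl with two-cross vu vw (w≢u ∘ sym) vw′
  ...   | inj₁ refl = contradiction refl w≢u′
  ...   | inj₂ refl = inj₁ refl
  parallel {v} vu vw w≢u vu′ vw′ w≢u′ (inj₂ m) c with squares v vw m
  ... | q , vq , wq with two-cross vu′ vw′ (w≢u′ ∘ sym) vq
  ...   | inj₂ refl = inj₂ wq
  ...   | inj₁ refl =
    contradiction (cross-classmates vw vu (Classmate-trans (inj₂ wq) (Classmate-sym c))) w≢u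

  ahead-unique : ∀ {s w} → Cross (head s) w → w ≢ tail s → w ≡ head (S s)
  ahead-unique {s} k h with two-cross (edge s) (ahead-cross s) (ahead s ∘ sym) k
  ... | inj₁ e = contradiction e h
  ... | inj₂ e = e

  S-cong : ∀ {s t} → s ∥ t → S s ∥ S t
  S-cong {s} {t} (p , q) = q , parallel (edge s) (ahead-cross s) (ahead s) (edge t) (ahead-cross t) (ahead t) q p

  S-cong≐ : ∀ {s t} → s ≐ t → S s ≐ S t
  S-cong≐ {s} {t} (p , q) = q , ahead-unique {t} (subst (λ v → Cross v (head (S s))) q (ahead-cross s))
    (λ e → ahead s (trans e (sym p)))

  r-cong : ∀ {s t} → s ∥ t → r s ∥ r t
  r-cong p = head∥ (S-cong p) , tail∥ (S-cong p)

  r-cong≐ : ∀ {s t} → s ≐ t → r s ≐ r t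
  r-cong≐ p = head≡ (S-cong≐ p) , tail≡ (S-cong≐ p)

  rr : ∀ s → r (r s) ≐ s
  rr s = sym (ahead-unique {r s} (edge s) (ahead s ∘ sym)) , refl

  SrS : ∀ s → S (r (S s)) ≐ r s
  SrS s = refl , sym (ahead-unique {r (S s)} (Cross-sym (ahead-cross s)) (ahead (S s) ∘ sym))

  module D≐ = Darts {Dart} {_≐_} ≐-refl ≐-sym ≐-trans S r S-cong≐ r-cong≐ rr SrS
  module D∥ = Darts {Dart} {_∥_} ∥-refl ∥-sym ∥-trans S r S-cong r-cong (λ s → ≐⇒∥ (rr s)) (λ s → ≐⇒∥ (SrS s))

  s∦rs : ∀ s → ¬ s ∥ r s
  s∦rs s (p , _) = ahead s (sym (cross-classmates (edge s) (ahead-cross s) p))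

  Ss∦rs : ∀ s → ¬ S s ∥ r s
  Ss∦rs s (p , _) = Classmate-Cross p (ahead-cross s)

  open D∥.Oriented s∦rs Ss∦rs

  S^ : ℕ → Dart → Dart
  S^ = iterate S

  reverse-or-parallel : ∀ s t → Classmate (head s) (head t) → s ∥ t ⊎ s ∥ r t
  reverse-or-parallel s t (inj₁ e) with two-cross (edge t) (ahead-cross t) (ahead t ∘ sym) (subst (λ v → Cross v (tail s)) e (edge s))
  ... | inj₁ e′ = inj₁ (≐⇒∥ (e′ , e))
  ... | inj₂ e′ = inj₂ (≐⇒∥ (e′ , e))
  reverse-or-parallel s t (inj₂ m) with squares (head s) (edge s) m
  ... | q , tq , sq with two-cross (edge t) (ahead-cross t) (ahead t ∘ sym) tq
  ...   | inj₁ refl = inj₁ (inj₂ sq , inj₂ m)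
  ...   | inj₂ refl = inj₂ (inj₂ sq , inj₂ m)

  same-head : ∀ {s t} → s ∥ t → head s ≡ head t → s ≐ t
  same-head {s} {t} (p , _) e = cross-classmates (subst (λ v → Cross v (tail s)) e (edge s)) (edge t) p , e

  parallel-dart : ∀ s {v} → Mate (head s) v → Σ Dart λ t → head t ≡ v × t ∥ s
  parallel-dart s m = let (q , vq , sq) = squares (head s) (edge s) m
    in dart vq , refl , (inj₂ (Mate-sym sq) , inj₂ (Mate-sym m))

  module Layers (s₀ : Dart) (s₀-period : D∥.Period s₀) (s : Fin 3 → Dart) (s∥ : ∀ x → s x ∥ s₀)
    (s-distinct : ∀ {x y} → x ≢ y → head (s x) ≢ head (s y)) where
    open D∥.Period s₀-period renaming (pred to k; distinct to distinct-darts) public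

    walk : Fin 3 → ℕ → Dart
    walk x i = S^ i (s x)

    at : Fin 3 → ℕ → V
    at x i = head (walk x i)

    walk∥ : ∀ x i → walk x i ∥ S^ i s₀
    walk∥ x i = D∥.S^-cong i (s∥ x)

    walks-parallel : ∀ x y i → walk x i ∥ walk y i
    walks-parallel x y i = ∥-trans (walk∥ x i) (∥-sym (walk∥ y i))

    at-distinct : ∀ {x y} i → x ≢ y → at x i ≢ at y i
    at-distinct {x} {y} i h e =
      s-distinct h (head≡ (D≐.S^-injective i (same-head (walks-parallel x y i) e)))

    at-mate : ∀ {x y} i → x ≢ y → Mate (at x i) (at y i)
    at-mate {x} {y} i h = [ (λ e → contradiction e (at-distinct i h)) , id ]′ (head∥ (walks-parallel x y i))

    level : ∀ {i j} → i ≤ k → j ≤ k → S^ i s₀ ∥ S^ j s₀ → i ≡ j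
    level {i} {j} i≤k j≤k p = compare (ℕ.<-cmp i j)
      where
      compare : Tri (i < j) (i ≡ j) (j < i) → i ≡ j
      compare (tri< lt _ _) = contradiction p (distinct-darts lt j≤k)
      compare (tri≈ _ e _)  = e
      compare (tri> _ _ gt) = contradiction (∥-sym p) (distinct-darts gt i≤k)

    -- A common vertex makes the darts of the base walk parallel or mutually reversed. Reversal is
    -- impossible, parallelism gives equal levels, and within a level the three walks are disjoint.
    at-injective : ∀ {x y i j} → i ≤ k → j ≤ k → at x i ≡ at y j → x ≡ y × i ≡ j
    at-injective {x} {y} {i} {j} i≤k j≤k e =
      [ (λ p → same-level (level i≤k j≤k p) e) , (λ p → contradiction p (no-reverse i j s₀)) ]′
        (reverse-or-parallel (S^ i s₀) (S^ j s₀) (Classmate-trans (Classmate-sym (head∥ (walk∥ x i)))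
          (Classmate-trans (inj₁ e) (head∥ (walk∥ y j)))))
      where
      same-level : ∀ {j} → i ≡ j → at x i ≡ at y j → x ≡ y × i ≡ j
      same-level refl e with x F.≟ y
      ... | yes p = p , refl
      ... | no h  = contradiction e (at-distinct i h)

    mates-at : ∀ x i {w} → Mate (at x i) w → ∃[ y ] y ≢ x × at y i ≡ w
    mates-at 0F i m = [ (λ e → 1F , (λ ()) , sym e) , (λ e → 2F , (λ ()) , sym e) ]′
      (two-mates (at-mate i λ ()) (at-mate i λ ()) (at-distinct {1F} {2F} i λ ()) m)
    mates-at 1F i m = [ (λ e → 0F , (λ ()) , sym e) , (λ e → 2F , (λ ()) , sym e) ]′
      (two-mates (at-mate i λ ()) (at-mate i λ ()) (at-distinct {0F} {2F} i λ ()) m)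
    mates-at 2F i m = [ (λ e → 0F , (λ ()) , sym e) , (λ e → 1F , (λ ()) , sym e) ]′
      (two-mates (at-mate i λ ()) (at-mate i λ ()) (at-distinct {0F} {1F} i λ ()) m)

    -- A return after one step would make the ends of a cross edge classmates; after two steps, the
    -- two cross neighbours of one vertex.
    long : 2 ≤ k
    long = positive k returns
      where
      positive : ∀ l → S^ (suc l) s₀ ∥ s₀ → 2 ≤ l
      positive zero (p , _) = contradiction (edge s₀) (Classmate-Cross p)
      positive (suc zero) (p , _) = contradiction (cross-classmates (ahead-cross s₀) (edge s₀) p) (ahead s₀)
      positive (suc (suc l)) _ = s≤s (s≤s z≤n)

    returning : ∀ {t} → t ∥ s₀ → ∃[ y ] t ≐ s y
    returning {t} p with head t F.≟ head (s 0F)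
    ... | yes e = 0F , same-head (∥-trans p (∥-sym (s∥ 0F))) e
    ... | no h with head∥ (∥-trans (s∥ 0F) (∥-sym p))
    ...   | inj₁ e = contradiction (sym e) h
    ...   | inj₂ m = let (y , _ , e) = mates-at 0F 0 m
                     in y , same-head (∥-trans p (∥-sym (s∥ y))) (sym e)

    monodromy : ∀ x → ∃[ y ] S^ (suc k) (s x) ≐ s y
    monodromy x = returning (∥-trans (walk∥ x (suc k)) returns)

    -- Symmetries carry walks to walks, possibly reversed; either way a monodromy with one
    -- fixed walk is trivial.
    module _ (σ : Symmetry G) where
      open Symmetry σ

      move : Dart → Dart
      move t = dart (g-Cross σ (edge t))

      move-S : ∀ t → move (S t) ≐ S (move t)
      move-S t = refl , ahead-unique {move t} (g-Cross σ (ahead-cross t)) (λ e → ahead t (g-injective e))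

      move-S^ : ∀ i t → move (S^ i t) ≐ S^ i (move t)
      move-S^ zero    t = ≐-refl
      move-S^ (suc i) t = ≐-trans (move-S (S^ i t)) (S-cong≐ (move-S^ i t))

      move-cong : ∀ {t u} → t ≐ u → move t ≐ move u
      move-cong (p , q) = cong g p , cong g q

    Closed : Dart → Set
    Closed t = S^ (suc k) t ≐ t

    closed-resp : ∀ {t u} → t ≐ u → Closed t → Closed u
    closed-resp p c = ≐-trans (D≐.S^-cong (suc k) (≐-sym p)) (≐-trans c p)

    -- If `s y` is carried to `s z`, then retracing carries `r (s z)` to `r (s y)`, which by
    -- assumption is also the end of the walk from `r (s y)`; injectivity gives `s z ≐ s y`.
    closed-unreverse : ∀ y → Closed (r (s y)) → Closed (s y)
    closed-unreverse y c =
      let (z , e) = monodromy y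
          reversed : r (s z) ≐ r (s y)
          reversed = D≐.S^-injective (suc k) (≐-trans (D≐.S^-cong (suc k) (r-cong≐ (≐-sym e)))
            (≐-trans (D≐.retrace (suc k) (s y)) (≐-sym c)))
      in ≐-trans e (≐-trans (≐-sym (rr (s z))) (≐-trans (r-cong≐ reversed) (rr (s y))))

    closed-everywhere : ∀ x y → Closed (s x) → Closed (s y)
    closed-everywhere x y c = let (σ , e) = symmetry {G} vt (head (s x)) (head (s y)) in carry σ e
      where
      carry : ∀ (σ : Symmetry G) → Symmetry.g σ (head (s x)) ≡ head (s y) → Closed (s y)
      carry σ e =
        [ (λ p → closed-resp (p , e) moved)
        , (λ p → closed-unreverse y (closed-resp (p , e) moved)) ]′
          (two-cross (edge (s y)) (ahead-cross (s y)) (ahead (s y) ∘ sym)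
            (subst (λ v → Cross v (tail (move σ (s x)))) e (edge (move σ (s x)))))
        where
        moved : Closed (move σ (s x))
        moved = ≐-trans (≐-sym (move-S^ σ (suc k) (s x))) (move-cong σ c)

    module Untwisted (closed : ∀ x → Closed (s x)) where
      step : ∀ x {i j : Fin (suc k)} → Next i j → S (walk x (toℕ i)) ≐ walk x (toℕ j)
      step x {i} {j} nx =
        [ (λ (e , _) → D≐.≈-reflexive (cong (walk x) (sym e)))
        , (λ (e , e′) → ≐-trans (D≐.≈-reflexive (cong (λ l → S (walk x l)) e′))
            (≐-trans (closed x) (D≐.≈-reflexive (cong (walk x) (sym e))))) ]′
          (mod-cases (F.toℕ≤pred[n] i) nx)

      corner : Fin 3 × Fin (suc k) → V
      corner (x , i) = at x (toℕ i)

      corner-next : ∀ x {i j : Fin (suc k)} → Next i j → Cross (corner (x , i)) (corner (x , j))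
      corner-next x {i} {j} nx =
        subst (Cross (corner (x , i))) (head≡ (step x nx)) (ahead-cross (walk x (toℕ i)))

      corner-preserves : ∀ p q → CartAdj p q → corner p ~ corner q
      corner-preserves (x , i) (_ , j) (inj₁ (refl , _ , inj₁ nx)) = proj₁ (corner-next x nx)
      corner-preserves (x , i) (_ , j) (inj₁ (refl , _ , inj₂ nx)) = ~-sym (proj₁ (corner-next x nx))
      corner-preserves (x , i) (y , _) (inj₂ (refl , h)) = proj₁ (at-mate (toℕ i) h)

      corner-injective : ∀ p q → corner p ≡ corner q → p ≡ q
      corner-injective (x , i) (y , j) e =
        let (x≡y , i≡j) = at-injective (F.toℕ≤pred[n] i) (F.toℕ≤pred[n] j) e
        in cong₂ _,_ x≡y (F.toℕ-injective i≡j)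

      Lift : Fin 3 × Fin (suc k) → V → Set
      Lift p w = ∃[ q ] corner q ≡ w × CartAdj p q

      corner-lifts : ∀ p {w} → corner p ~ w → Lift p w
      corner-lifts p@(x , i) {w} a = [ inside , across ]′ (mate-or-cross a)
        where
        inside : Mate (corner p) w → Lift p w
        inside m = let (y , h , e) = mates-at x (toℕ i) m in (y , i) , e , inj₂ (refl , h ∘ sym)
        different : ∀ {j} → corner p ~ corner (x , j) → i ≢ j
        different b i≡j = ~⇒≢ b (cong (λ l → corner (x , l)) i≡j)
        across : Cross (corner p) w → Lift p w
        across c = [ backward (prev i) , forward (next i) ]′
          (two-cross (edge (walk x (toℕ i))) (ahead-cross (walk x (toℕ i))) (ahead (walk x (toℕ i)) ∘ sym) c)
          where
          forward : ∃[ j ] Next i j → w ≡ head (S (walk x (toℕ i))) → Lift p w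
          forward (j , nx) e = (x , j) , trans (sym (head≡ (step x nx))) (sym e)
            , inj₁ (refl , different (proj₁ (corner-next x nx)) , inj₁ nx)
          backward : ∃[ j ] Next j i → w ≡ tail (walk x (toℕ i)) → Lift p w
          backward (j , nx) e = (x , j) , trans (tail≡ (step x nx)) (sym e)
            , inj₁ (refl , different (~-sym (proj₁ (corner-next x nx))) , inj₂ nx)

      prism : Embedding (cart (C 3) (C (suc k))) G
      prism = record
        { f = corner ∘ remQuot {3} (suc k)
        ; injective = λ {u} {v} e → remQuot-injective {3} (suc k) (corner-injective _ _ e)
        ; preserves = λ {u} {v} e → corner-preserves _ _ (cart-adj⁻ {suc k} {u} {v} e)
        ; lifts = λ {u} e → lift u (corner-lifts (remQuot {3} (suc k) u) e) }
        where
        lift : ∀ u {w} → Lift (remQuot {3} (suc k) u) w →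
          ∃[ v ] corner (remQuot {3} (suc k) v) ≡ w × adj (cart (C 3) (C (suc k))) u v ≡ true
        lift u ((x , i) , e , h) = combine x i , trans (cong corner (F.remQuot-combine x i)) e
          , cart-adj⁺ {suc k} {u} {combine x i} (subst (CartAdj (remQuot {3} (suc k) u)) (sym (F.remQuot-combine x i)) h)

    module Twisted (rot₀ : S^ (suc k) (s 0F) ≐ s 1F) (rot₁ : S^ (suc k) (s 1F) ≐ s 2F)
      (rot₂ : S^ (suc k) (s 2F) ≐ s 0F) where
      open Cay3 k using (m; Step; adjacent⁻; adjacent⁺)

      shift : ∀ {x y} → S^ (suc k) (s x) ≐ s y → ∀ j → walk x (j + suc k) ≐ walk y j
      shift {x} rot j = ≐-trans (D≐.≈-reflexive (iterate-+ S j (suc k) (s x))) (D≐.S^-cong j rot)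

      -- Under the rotation a single walk runs through the three layers in turn. Its positions are
      -- the elements of the cyclic group: one step is the generator 1, a full turn is the generator
      -- of the triangles.
      unfold : ∀ x j → walk 0F (j + toℕ x * suc k) ≐ walk x j
      unfold 0F j = D≐.≈-reflexive (cong (walk 0F) (ℕ.+-identityʳ j))
      unfold 1F j = ≐-trans (D≐.≈-reflexive (cong (λ l → walk 0F (j + l)) (ℕ.+-identityʳ (suc k)))) (shift rot₀ j)
      unfold 2F j = ≐-trans (D≐.≈-reflexive (cong (walk 0F)
          (trans (cong (j +_) (ℕ.+-comm (suc k) (1 * suc k))) (sym (ℕ.+-assoc j (1 * suc k) (suc k))))))
        (≐-trans (shift rot₀ (j + 1 * suc k))
          (≐-trans (D≐.≈-reflexive (cong (λ l → walk 1F (j + l)) (ℕ.+-identityʳ (suc k)))) (shift rot₁ j)))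

      around : ∀ j → walk 0F (j + m) ≐ walk 0F j
      around j = ≐-trans (D≐.≈-reflexive (cong (walk 0F)
          (trans (cong (j +_) (ℕ.+-comm (suc k) (2 * suc k))) (trans (sym (ℕ.+-assoc j (2 * suc k) (suc k)))
            (trans (ℕ.+-assoc j (2 * suc k) (suc k)) (trans (cong (j +_) (ℕ.+-comm (2 * suc k) (suc k)))
              (sym (ℕ.+-assoc j (suc k) (2 * suc k)))))))))
        (≐-trans (unfold 2F (j + suc k)) (shift rot₂ j))

      around* : ∀ q j → walk 0F (j + q * m) ≐ walk 0F j
      around* zero    j = D≐.≈-reflexive (cong (walk 0F) (ℕ.+-identityʳ j))
      around* (suc q) j = ≐-trans (D≐.≈-reflexive (cong (walk 0F)
          (trans (cong (j +_) (ℕ.+-comm m (q * m))) (sym (ℕ.+-assoc j (q * m) m)))))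
        (≐-trans (around (j + q * m)) (around* q j))

      reduce-mod : ∀ j → walk 0F (j % m) ≐ walk 0F j
      reduce-mod j = ≐-trans (≐-sym (around* (j ℕ./ m) (j % m)))
        (D≐.≈-reflexive (cong (walk 0F) (sym (ℕ.m≡m%n+[m/n]*n j m))))

      corner : Fin m → V
      corner u = at 0F (toℕ u)

      corner-at : ∀ x (i : Fin (suc k)) → corner (combine x i) ≡ at x (toℕ i)
      corner-at x i = trans (cong (at 0F) (trans (F.toℕ-combine x i)
          (trans (ℕ.+-comm (suc k * toℕ x) (toℕ i)) (cong (toℕ i +_) (ℕ.*-comm (suc k) (toℕ x))))))
        (head≡ (unfold x (toℕ i)))

      corner-injective : ∀ u v → corner u ≡ corner v → u ≡ v
      corner-injective u v e =
        let (x , i) = remQuot {3} (suc k) u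
            (y , j) = remQuot {3} (suc k) v
            (x≡y , i≡j) = at-injective {x} {y} {toℕ i} {toℕ j} (F.toℕ≤pred[n] i) (F.toℕ≤pred[n] j)
              (trans (sym (position u)) (trans e (position v)))
        in remQuot-injective {3} (suc k) (cong₂ _,_ x≡y (F.toℕ-injective i≡j))
        where
        position : ∀ u → corner u ≡ at (proj₁ (remQuot {3} (suc k) u)) (toℕ (proj₂ (remQuot {3} (suc k) u)))
        position u = trans (cong corner (sym (F.combine-remQuot {3} (suc k) u)))
          (corner-at (proj₁ (remQuot {3} (suc k) u)) (proj₂ (remQuot {3} (suc k) u)))

      back-step : ∀ j → S (walk 0F (j + (m ∸ 1))) ≐ walk 0F j
      back-step j = ≐-trans (D≐.≈-reflexive (cong (walk 0F) (sym (ℕ.+-suc j (m ∸ 1))))) (around j)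

      step-adjacent : ∀ j {d} → Step d → at 0F j ~ at 0F (j + d)
      step-adjacent j (inj₁ refl) = subst (λ l → at 0F j ~ at 0F l) (ℕ.+-comm 1 j) (proj₁ (ahead-cross (walk 0F j)))
      step-adjacent j (inj₂ (inj₁ refl)) =
        ~-sym (subst (at 0F (j + (m ∸ 1)) ~_) (head≡ (back-step j)) (proj₁ (ahead-cross (walk 0F (j + (m ∸ 1))))))
      step-adjacent j (inj₂ (inj₂ (inj₁ refl))) =
        subst (at 0F j ~_) (sym (head≡ (shift rot₀ j))) (proj₁ (at-mate j λ ()))
      step-adjacent j (inj₂ (inj₂ (inj₂ refl))) =
        subst (at 0F j ~_) (sym (head≡ (unfold 2F j))) (proj₁ (at-mate j λ ()))

      corner-preserves : ∀ {u v} → adj (CayZ3k (suc k)) u v ≡ true → corner u ~ corner v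
      corner-preserves {u} {v} a = let (d , st , e) = adjacent⁻ {u} {v} a in
        subst (corner u ~_) (sym (trans (cong (at 0F) e) (head≡ (reduce-mod (toℕ u + d)))))
          (step-adjacent (toℕ u) st)

      Lift : Fin m → V → Set
      Lift u w = ∃[ v ] corner v ≡ w × adj (CayZ3k (suc k)) u v ≡ true

      corner-lifts : ∀ u {w} → corner u ~ w → Lift u w
      corner-lifts u {w} a = [ inside , across ]′ (mate-or-cross a)
        where
        reach : ∀ {d} → Step d → at 0F (toℕ u + d) ≡ w → Lift u w
        reach {d} st e = v , trans (trans (cong (at 0F) v≡) (head≡ (reduce-mod (toℕ u + d)))) e
          , adjacent⁺ {u} {v} st v≡
          where
          v : Fin m
          v = fromℕ< (ℕ.m%n<n (toℕ u + d) m)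
          v≡ : toℕ v ≡ (toℕ u + d) % m
          v≡ = F.toℕ-fromℕ< (ℕ.m%n<n (toℕ u + d) m)
        inside : Mate (corner u) w → Lift u w
        inside mt = go (mates-at 0F (toℕ u) mt)
          where
          go : ∃[ y ] y ≢ 0F × at y (toℕ u) ≡ w → Lift u w
          go (0F , h , _) = contradiction refl h
          go (1F , _ , e) = reach (inj₂ (inj₂ (inj₁ refl))) (trans (head≡ (shift rot₀ (toℕ u))) e)
          go (2F , _ , e) = reach (inj₂ (inj₂ (inj₂ refl))) (trans (head≡ (unfold 2F (toℕ u))) e)
        across : Cross (corner u) w → Lift u w
        across c =
          [ (λ e → reach (inj₂ (inj₁ refl)) (trans (tail≡ (back-step (toℕ u))) (sym e)))
          , (λ e → reach (inj₁ refl) (trans (cong (at 0F) (ℕ.+-comm (toℕ u) 1)) (sym e))) ]′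
            (two-cross (edge (walk 0F (toℕ u))) (ahead-cross (walk 0F (toℕ u))) (ahead (walk 0F (toℕ u)) ∘ sym) c)

      circulant : Embedding (CayZ3k (suc k)) G
      circulant = record
        { f = corner ; injective = corner-injective _ _
        ; preserves = λ {u} {v} → corner-preserves {u} {v} ; lifts = λ {u} → corner-lifts u }

  -- Renaming two layers turns one 3-cycle of the layers into the other, which reduces both to
  -- `Twisted`.
  swap₁₂ : Fin 3 → Fin 3
  swap₁₂ 0F = 0F
  swap₁₂ 1F = 2F
  swap₁₂ 2F = 1F

  swap₁₂-injective : ∀ {x y} → swap₁₂ x ≡ swap₁₂ y → x ≡ y
  swap₁₂-injective {x} {y} e = trans (sym (involutive x)) (trans (cong swap₁₂ e) (involutive y))
    where
    involutive : ∀ x → swap₁₂ (swap₁₂ x) ≡ x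
    involutive 0F = refl
    involutive 1F = refl
    involutive 2F = refl

  Prism-or-circulant : Set
  Prism-or-circulant =
    (∃[ m ] m ≥ 3 × Embedding (cart (C 3) (C m)) G) ⊎ (∃[ k ] k ≥ 1 × Embedding (CayZ3k k) G)

  module Monodromy (s₀ : Dart) (s₀-period : D∥.Period s₀) (s : Fin 3 → Dart) (s∥ : ∀ x → s x ∥ s₀)
    (s-distinct : ∀ {x y} → x ≢ y → head (s x) ≢ head (s y)) where
    open Layers s₀ s₀-period s s∥ s-distinct

    target : Fin 3 → Fin 3
    target x = proj₁ (monodromy x)

    rotates : ∀ {x y} → target x ≡ y → S^ (suc k) (s x) ≐ s y
    rotates {x} refl = proj₂ (monodromy x)

    target-injective : ∀ {x y} → x ≢ y → target x ≢ target y
    target-injective {x} {y} h e = s-distinct h (head≡ (D≐.S^-injective (suc k)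
      (≐-trans (rotates {x} e) (≐-sym (rotates {y} refl)))))

    prism-or-circulant : Prism-or-circulant
    prism-or-circulant = settle (F.any? λ x → target x F.≟ x)
      where
      settle : Dec (∃[ x ] target x ≡ x) → Prism-or-circulant
      settle (yes (x , e)) =
        inj₁ (suc k , s≤s long , Untwisted.prism (λ y → closed-everywhere x y (rotates {x} e)))
      settle (no none) =
        [ (λ (p , q , r′) → inj₂ (suc k , s≤s z≤n , Twisted.circulant (rotates {0F} p) (rotates {1F} q) (rotates {2F} r′)))
        , (λ (p , q , r′) → inj₂ (suc k , s≤s z≤n , Layers.Twisted.circulant s₀ s₀-period (s ∘ swap₁₂)
            (λ x → s∥ (swap₁₂ x)) (λ h → s-distinct (h ∘ swap₁₂-injective))
            (rotates {0F} p) (rotates {2F} r′) (rotates {1F} q))) ]′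
          (permutation₃ (target 0F) (target 1F) (target 2F)
            (λ e → none (0F , e)) (λ e → none (1F , e)) (λ e → none (2F , e))
            (target-injective λ ()) (target-injective λ ()) (target-injective λ ()))

  parallel? : ∀ s t → Dec (s ∥ t)
  parallel? s t = map′ (λ (p , q) → p , q) (λ (p , q) → p , q)
    (classmate? (tail s) (tail t) ×-dec classmate? (head s) (head t))

  period : ∀ s → D∥.Period s
  period = D∥.period parallel? (λ s → combine (tail s) (head s))
    (λ {s} {t} e → let (p , q) = F.combine-injective (tail s) (head s) (tail t) (head t) e in ≐⇒∥ (p , q))

  start : V → Fin 3 → Dart
  start v 0F = dart (p-cross {v})
  start v 1F = proj₁ (parallel-dart (dart (p-cross {v})) b-mate)
  start v 2F = proj₁ (parallel-dart (dart (p-cross {v})) c-mate)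

  start-head : ∀ v x → head (start v x) ≡ L.lookup (v ∷ T.b v ∷ T.c v ∷ []) x
  start-head v 0F = refl
  start-head v 1F = refl
  start-head v 2F = refl

  start∥ : ∀ v x → start v x ∥ start v 0F
  start∥ v 0F = ∥-refl
  start∥ v 1F = proj₂ (proj₂ (parallel-dart (dart (p-cross {v})) b-mate))
  start∥ v 2F = proj₂ (proj₂ (parallel-dart (dart (p-cross {v})) c-mate))

  start-distinct : ∀ v {x y} → x ≢ y → head (start v x) ≢ head (start v y)
  start-distinct v {x} {y} h e = h (lookup-injective
    ((Mate⇒≢ b-mate ∷ Mate⇒≢ c-mate ∷ []) ∷ (Mate⇒≢ bc-mate ∷ []) ∷ [] ∷ []) x y
    (trans (sym (start-head v x)) (trans e (start-head v y))))

  prism-or-circulant : V → Prism-or-circulant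
  prism-or-circulant v =
    Monodromy.prism-or-circulant (start v 0F) (period (start v 0F)) (start v) (start∥ v) (start-distinct v)

-- Assembling the classification

data Component (G : Graph) : Set where
  k44        : Embedding K44 G → Component G
  k5         : Embedding (K 5) G → Component G
  octahedral : Embedding (lex (K 3) (E 2)) G → Component G
  lk33       : Embedding LK33 G → Component G
  ladder     : ∀ {m} → m ≥ 2 → Embedding (H m) G → Component G
  circulant  : ∀ {k} → k ≥ 1 → Embedding (CayZ3k k) G → Component G
  prism      : ∀ {m} → m ≥ 3 → Embedding (cart (C 3) (C m)) G → Component G

module Classification (G : Graph) (simple : IsSimple G) (regular : Regular 4 G) (vt : VertexTransitive G) where
  open FourValent G simple regular vt
  open Triangles G simple regular vt
  open StrongList

  -- Symmetries move the given copy of `H` so that a copy passes through each vertex.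
  coloured : ∀ {H} → StrongColouring H → Fin (n H) → Embedding H G → Localizable G
  coloured κ u e = StrongColouring⇒Localizable simple κ λ v →
    let (s , p) = symmetry {G} vt (Embedding.f e u) v
    in Embedding-∘ (Symmetry.g-embedding s) e , u , p

  module FourClique {C : Subset (n G)} {a b c d : V} (strong : IsStrongClique G C)
    (listed : members C ≡ a ∷ b ∷ c ∷ d ∷ []) (members-strong : StrongList (a ∷ b ∷ c ∷ d ∷ []))
    (k4 : K4 a b c d) (patterns : ∀ v → OuterPattern v) where
    open Outer patterns

    a-mates : All (Mate a) (b ∷ c ∷ d ∷ [])
    a-mates = let ((ab , ac , ad′) , bc , bd , cd) = k4 in
      (ab , c , ac , bc) ∷ (ac , b , ab , ~-sym bc) ∷ (ad′ , b , ab , ~-sym bd) ∷ []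

    from-a : ∀ {x} → x ∈ˡ a ∷ b ∷ c ∷ d ∷ [] → Classmate a x
    from-a (here refl) = inj₁ refl
    from-a (there p) = inj₂ (All.lookup a-mates p)

    to-list : ∀ {x} → Classmate a x → x ∈ˡ a ∷ b ∷ c ∷ d ∷ []
    to-list (inj₁ refl) = here refl
    to-list {x} (inj₂ m) with Any.any? (x F.≟_) (b ∷ c ∷ d ∷ [])
    ... | yes p = there p
    -- A further mate, `f a` and the three listed mates would be five neighbours of `a`.
    ... | no h = contradiction (proj₁ m ∷ proj₁ (f-cross a) ∷ All.map proj₁ a-mates)
          (no-five (((λ { refl → Mate-Cross m (f-cross a) }) ∷ All.¬Any⇒All¬ _ h)
            ∷ All.map (λ { q refl → Mate-Cross q (f-cross a) }) a-mates ∷ AllPairs.tail (unique members-strong)))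

    local : Localizable G
    local = mates-localizable strong
      (λ v∈ → from-a (subst (_ ∈ˡ_) listed (members⁺ v∈)))
      (λ m → members⁻ {C} (subst (_ ∈ˡ_) (sym listed) (to-list m)))

    some-partner : ∃₂ Partner
    some-partner = partner-in members-strong λ p q h →
      [ (λ u≡v → contradiction u≡v h) , id ]′ (Classmate-trans (Classmate-sym (from-a p)) (from-a q))

    spread : ∃₂ Partner → ∀ v → ∃[ x ] Partner v x
    spread (u , x , p) v = let (s , q) = symmetry {G} vt u v
      in Symmetry.g s x , subst (λ w → Partner w (Symmetry.g s x)) q (g-Partner s p)

    module _ (partner : ∀ v → ∃[ x ] Partner v x) where
      module _ (none : ¬ (∃[ y ] Partner a y × y ≢ proj₁ (partner a))) where
        only : ∀ {y} → Partner a y → y ≡ proj₁ (partner a)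
        only {y} p with y F.≟ proj₁ (partner a)
        ... | yes q = q
        ... | no h = contradiction (y , p , h) none

        unique-partner : ∀ {v x y} → Partner v x → Partner v y → x ≡ y
        unique-partner {v} p q with symmetry {G} vt v a
        ... | s , refl = Symmetry.g-injective s (trans (only (g-Partner s p)) (sym (only (g-Partner s q))))

      component : Dec (∃[ y ] Partner a y × y ≢ proj₁ (partner a)) → Component G
      component (yes (y , p , h)) = ladder (s≤s (s≤s z≤n)) (two-partners⇒H2 partner h p (proj₂ (partner a)))
      component (no none) =
        let π = ladderPeriod partner (unique-partner none) a
        in ladder (s≤s (ladder-length partner (unique-partner none) a π))
             (ladderEmbedding partner (unique-partner none) a π)

    result : Component G × Localizable G
    result = component (spread some-partner)
      (F.any? (λ y → partner? a y ×-dec ¬? (y F.≟ proj₁ (spread some-partner a)))) , local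

  four-clique : ∀ {C a b c d} → IsStrongClique G C → members C ≡ a ∷ b ∷ c ∷ d ∷ [] →
    StrongList (a ∷ b ∷ c ∷ d ∷ []) → Component G × Localizable G
  four-clique {C} {a} {b} {c} {d} strong listed members-strong =
    FourClique.result strong listed members-strong (k4 (clique members-strong))
      (outerPattern (k4 (clique members-strong)) no-fifth)
    where
    k4 : AllPairs _~_ (a ∷ b ∷ c ∷ d ∷ []) → K4 a b c d
    k4 ((ab ∷ ac ∷ ad′ ∷ []) ∷ (bc ∷ bd ∷ []) ∷ (cd ∷ []) ∷ _) = (ab , ac , ad′) , bc , bd , cd
    no-fifth : ∀ {x} → a ~ x → b ~ x → c ~ x → d ~ x → ⊥
    no-fifth {x} ax bx cx dx =
      blocked members-strong (x ∷ []) ([] ∷ []) (here ax ∷ here bx ∷ here cx ∷ here dx ∷ [])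

  only-common : ∀ {a b c} → a ~ b → a ~ c → b ~ c → Transversal a b c →
    Embedding (lex (K 3) (E 2)) G ⊎ OnlyCommon a b c
  only-common {a} {b} {c} ab ac bc t with F.any? (λ x → (a ~? x) ×-dec (b ~? x) ×-dec ¬? (x F.≟ c))
  ... | yes (x , ax , bx , h) = inj₁ (octahedron ab ac bc t ax bx h)
  ... | no none = inj₂ only
    where
    only : OnlyCommon a b c
    only {x} ax bx with x F.≟ c
    ... | yes e = e
    ... | no h = contradiction (x , ax , bx , h) none

  module StrongTriangle {C : Subset (n G)} {a b c : V} (strong : IsStrongClique G C)
    (listed : members C ≡ a ∷ b ∷ c ∷ []) (ab : a ~ b) (ac : a ~ c) (bc : b ~ c)
    (t : Transversal a b c)
    (AB : OnlyCommon a b c) (AC : OnlyCommon a c b) (BC : OnlyCommon b c a) where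

    module _ (one : ∀ v → OneTriangle v) where
      open OneTriangles G simple regular vt one

      ab-mate : Mate a b
      ab-mate = ab , c , ac , bc

      ac-mate : Mate a c
      ac-mate = ac , b , ab , ~-sym bc

      bc-mate′ : Mate b c
      bc-mate′ = bc , a , ~-sym ab , ~-sym ac

      from-a : ∀ {x} → x ∈ˡ a ∷ b ∷ c ∷ [] → Classmate a x
      from-a (here refl) = inj₁ refl
      from-a (there (here refl)) = inj₂ ab-mate
      from-a (there (there (here refl))) = inj₂ ac-mate

      to-list : ∀ {x} → Classmate a x → x ∈ˡ a ∷ b ∷ c ∷ []
      to-list (inj₁ refl) = here refl
      to-list (inj₂ m) = [ (λ e → there (here e)) , (λ e → there (there (here e))) ]′
        (two-mates ab-mate ac-mate (~⇒≢ bc) m)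

      local : Localizable G
      local = mates-localizable strong
        (λ v∈ → from-a (subst (_ ∈ˡ_) listed (members⁺ v∈)))
        (λ m → members⁻ {C} (subst (_ ∈ˡ_) (sym listed) (to-list m)))

      component : (∀ v → Squares v) → Component G
      component sq = [ (λ (m , le , e) → prism le e) , (λ (k , le , e) → circulant le e) ]′
        (TriangleCycles.prism-or-circulant G simple regular vt one sq a)

      one-triangle : Component G × Localizable G
      one-triangle = component (squares ab-mate ac-mate bc-mate′ t) , local

    -- The `OnlyCommon` hypotheses exclude edges from `b`, `c` to the outer neighbours of `a`, so
    -- the edge between `α₁` and `α₂` alone decides the shape of every neighbourhood.
    disjoint-outers : Component G × Localizable G
    disjoint-outers with neighbours₂ ab ac (~⇒≢ bc)
    ... | α₁ , α₂ , A@(neighbours (_ ∷ _ ∷ aα₁ ∷ aα₂ ∷ []) ((_ ∷ bα₁ ∷ bα₂ ∷ []) ∷ (cα₁ ∷ cα₂ ∷ []) ∷ _) _)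
      with ¬~⇒≁ (λ e → cα₁ (sym (AB aα₁ e))) | ¬~⇒≁ (λ e → cα₂ (sym (AB aα₂ e)))
         | ¬~⇒≁ (λ e → bα₁ (sym (AC aα₁ e))) | ¬~⇒≁ (λ e → bα₂ (sym (AC aα₂ e))) | α₁ ~? α₂
    ... | b≁α₁ | b≁α₂ | c≁α₁ | c≁α₂ | yes α₁₂ = lk33 e , coloured colouring-LK33 0F e
      where
      two-triangles : ∀ v → TwoTriangles v
      two-triangles v with symmetry {G} vt a v
      ... | s , refl = g-TwoTriangles s record
        { star = A ; wx = bc ; yz = α₁₂ ; wy = b≁α₁ ; wz = b≁α₂ ; xy = c≁α₁ ; xz = c≁α₂ }
      e : Embedding LK33 G
      e = grid two-triangles A bc α₁₂ t AB AC BC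
    ... | b≁α₁ | b≁α₂ | c≁α₁ | c≁α₂ | no α₁≁α₂ = one-triangle one
      where
      one : ∀ v → OneTriangle v
      one v with symmetry {G} vt a v
      ... | s , refl = g-OneTriangle s record
        { star = A ; bc = bc ; bp = b≁α₁ ; bq = b≁α₂ ; cp = c≁α₁ ; cq = c≁α₂ ; pq = ¬~⇒≁ α₁≁α₂ }

  triangle : ∀ {C a b c} → IsStrongClique G C → members C ≡ a ∷ b ∷ c ∷ [] → Transversal a b c →
    AllPairs _~_ (a ∷ b ∷ c ∷ []) → Component G × Localizable G
  triangle {C} {a} {b} {c} strong listed t ((ab ∷ ac ∷ []) ∷ (bc ∷ []) ∷ _) = split
    (only-common ab ac bc t) (only-common ac ab (~-sym bc) (Transversal-swap t))
    (only-common bc (~-sym ab) (~-sym ac) (Transversal-cycle t))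
    where
    octahedral′ : Embedding (lex (K 3) (E 2)) G → Component G × Localizable G
    octahedral′ e = octahedral e , coloured colouring-octahedron 0F e
    split : Embedding (lex (K 3) (E 2)) G ⊎ OnlyCommon a b c → Embedding (lex (K 3) (E 2)) G ⊎ OnlyCommon a c b →
      Embedding (lex (K 3) (E 2)) G ⊎ OnlyCommon b c a → Component G × Localizable G
    split (inj₁ e) _ _ = octahedral′ e
    split (inj₂ _) (inj₁ e) _ = octahedral′ e
    split (inj₂ _) (inj₂ _) (inj₁ e) = octahedral′ e
    split (inj₂ AB) (inj₂ AC) (inj₂ BC) =
      StrongTriangle.disjoint-outers strong listed ab ac bc t AB AC BC

  classify : HasStrongClique G → Component G × Localizable G
  classify (C , strong) = by-size (size (strongList strong))
    where
    as-list : ∀ {xs} → members C ≡ xs → StrongList xs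
    as-list listed = subst StrongList listed (strongList strong)
    by-size : Size (members C) → Component G × Localizable G
    by-size (two listed) =
      let e = strong-edge⇒K44 (as-list listed) in k44 e , coloured colouring-K44 0F e
    by-size (three listed) = triangle strong listed (strong-triangle (as-list listed)) (clique (as-list listed))
    by-size (four listed) = four-clique strong listed (as-list listed)
    by-size (five listed) =
      let e = five-clique⇒K5 (clique (as-list listed)) in k5 e , coloured colouring-K5 0F e

component⇒InFamily : ∀ {G} → Connected G → Component G → InFamily G
component⇒InFamily con (k44 e)        = inj₁ (isomorphism e con 0F)
component⇒InFamily con (k5 e)         = inj₂ (inj₁ (isomorphism e con 0F))
component⇒InFamily con (octahedral e) = inj₂ (inj₂ (inj₁ (isomorphism e con 0F)))
component⇒InFamily con (lk33 e)       = inj₂ (inj₂ (inj₂ (inj₁ (isomorphism e con 0F))))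
component⇒InFamily con (ladder {suc _} le e) =
  inj₂ (inj₂ (inj₂ (inj₂ (inj₁ (_ , le , isomorphism e con 0F)))))
component⇒InFamily con (circulant {suc _} le e) =
  inj₂ (inj₂ (inj₂ (inj₂ (inj₂ (inj₁ (_ , le , isomorphism e con 0F))))))
component⇒InFamily con (prism {suc _} le e) =
  inj₂ (inj₂ (inj₂ (inj₂ (inj₂ (inj₂ (_ , le , isomorphism e con 0F))))))

strong-transfer : ∀ {G H C} → IsSimple G → G ≅ H → Strong H C → HasStrongClique G
strong-transfer {G} simple φ s =
  _ , StrongCliques.Strong⇒IsStrongClique G simple (Strong-image (≅⇒Embedding φ) s)

InFamily⇒strong : ∀ {G} → IsSimple G → InFamily G → HasStrongClique G
InFamily⇒strong s (inj₁ φ) = strong-transfer s φ (StrongColouring.strong colouring-K44 0F)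
InFamily⇒strong s (inj₂ (inj₁ φ)) = strong-transfer s φ (StrongColouring.strong colouring-K5 0F)
InFamily⇒strong s (inj₂ (inj₂ (inj₁ φ))) = strong-transfer s φ (StrongColouring.strong colouring-octahedron 0F)
InFamily⇒strong s (inj₂ (inj₂ (inj₂ (inj₁ φ)))) = strong-transfer s φ (StrongColouring.strong colouring-LK33 0F)
InFamily⇒strong s (inj₂ (inj₂ (inj₂ (inj₂ (inj₁ (suc m , _ , φ)))))) = strong-transfer s φ (H-strong m)
InFamily⇒strong s (inj₂ (inj₂ (inj₂ (inj₂ (inj₂ (inj₁ (suc k , _ , φ))))))) =
  strong-transfer s φ (Cay3.coset-strong k)
InFamily⇒strong s (inj₂ (inj₂ (inj₂ (inj₂ (inj₂ (inj₂ (suc m , _ , φ))))))) = strong-transfer s φ (cart-strong m)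

theorem5p3 : ((G : Graph) → IsSimple G → Connected G → Regular 4 G → VertexTransitive G →
    HasStrongClique G ⇔ InFamily G)
    ×
    ((G : Graph) → IsSimple G → Regular 4 G → VertexTransitive G →
    HasStrongClique G → Localizable G)
theorem5p3 =
  (λ G simple connected regular vt → mk⇔
    (λ strong → component⇒InFamily connected (proj₁ (Classification.classify G simple regular vt strong)))
    (InFamily⇒strong simple))
  , λ G simple regular vt strong → proj₂ (Classification.classify G simple regular vt strong)
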